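{- Let $b \geq 3$ be an integer. Then the equation $$\frac{(1 + s)\zeta_b'(s)}{1 + \zeta_b(s)} - \log\left(\frac{1 + \zeta_b(s)}{b}\right) = 0$$ has a unique solution $s = s_{b,0}$ over the positive real numbers. Moreover, setting $$\eta_{b,0} := 1 + \frac{1}{(1 + s_{b,0})\log b}\log\left(\frac{1 + \zeta_b(s_{b,0})}{b}\right),$$ we have $0 < \eta_{b,0} < 1$ and $$\#\mathcal{N}_{b,0}(x) < x^{\eta_{b,0} + o(1)}, \quad \text{as } x \to +\infty.$$
   Context: For an integer $b \geq 2$, every positive integer $n$ has a unique representation $n = \sum_{j=0}^{\ell} d_j b^j$ with $d_0,\dots,d_\ell \in \{0,\dots,b-1\}$ and $d_\ell \neq 0$; the $d_0,\dots,d_\ell$ are the base $b$ digits of $n$. Let $p_{b,0}(n)$ be the product of the nonzero base $b$ digits of $n$. For real $x \geq 1$, let $\mathcal{N}_{b,0}(x) := \{n \leq x : p_{b,0}(n) \mid n\}$, where $n$ ranges over positive integers. For real $s \geq 0$, let $\zeta_b(s) := \sum_{d=1}^{b-1} d^{ -s}$, and let $\zeta_b'$ be its derivative with respect to $s$. $\log$ is the natural logarithm. The notation $f(x) < x^{\eta + o(1)}$ as $x \to +\infty$ (with $b$ fixed) means that there is a function $\varepsilon(x)$ with $\varepsilon(x) \to 0$ as $x \to +\infty$ such that $f(x) < x^{\eta + \varepsilon(x)}$ for all sufficiently large $x$. -}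

module Defs where

open import Algebra.Bundles using (CommutativeRing; Semiring)
import Algebra.Definitions.RawSemiring as RawSemiringDefs
open import Algebra.Structures using (IsCommutativeRing)
open import Data.Digit using (toDigits)
open import Data.Fin.Base using (toℕ)
open import Data.List.Base using (List; length; map; filter)
open import Data.List.Membership.Propositional using (_∈_)
open import Data.List.Relation.Unary.Unique.Propositional using (Unique)
open import Data.Nat.Base as ℕ using (ℕ; suc; _!)
open import Data.Nat.Divisibility using (_∣_)
open import Data.Nat.ListAction using (product)
import Data.Nat.Properties as ℕₚ
open import Data.Product.Base using (Σ; ∃; ∃-syntax; _×_; proj₁)
open import Data.Sum.Base using ([_,_]′)
open import Function.Bundles using (_⇔_)
open import Level using (0ℓ)
import Relation.Binary.Construct.NonStrictToStrict as Strict
open import Relation.Binary.Core using (Rel)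
open import Relation.Binary.PropositionalEquality.Core using (_≡_; _≢_)
open import Relation.Binary.Structures using (IsTotalOrder)
open import Relation.Nullary.Decidable using (¬?; fromWitness)

-- A Dedekind-complete ordered field. Classically there is exactly one up to
-- isomorphism, so "for every R : Reals" means "for the real numbers".
-- Inversion and sup are total operations; they are unconstrained at 0 and at
-- sets that are empty or unbounded above, respectively.
record Reals : Set₁ where
  infix  4 _≤_
  infixl 6 _+_
  infixl 7 _*_
  infix  8 -_
  infix  9 _⁻¹
  field
    ℝ   : Set
    _+_ : ℝ → ℝ → ℝ
    _*_ : ℝ → ℝ → ℝ
    -_  : ℝ → ℝ
    _⁻¹ : ℝ → ℝ
    0#  : ℝ
    1#  : ℝ
    _≤_ : Rel ℝ 0ℓ
    sup : (ℝ → Set) → ℝ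

  UpperBound : (ℝ → Set) → ℝ → Set
  UpperBound P u = ∀ x → P x → x ≤ u

  field
    isCommutativeRing : IsCommutativeRing _≡_ _+_ _*_ -_ 0# 1#
    0≢1               : 0# ≢ 1#
    *-inverseʳ        : ∀ x → x ≢ 0# → x * x ⁻¹ ≡ 1#
    isTotalOrder      : IsTotalOrder _≡_ _≤_
    +-monoˡ-≤         : ∀ z {x y} → x ≤ y → x + z ≤ y + z
    *-nonNegative     : ∀ {x y} → 0# ≤ x → 0# ≤ y → 0# ≤ x * y
    sup-upper         : ∀ P → ∃ P → ∃ (UpperBound P) → UpperBound P (sup P)
    sup-least         : ∀ P → ∃ P → ∃ (UpperBound P) →
                        ∀ u → UpperBound P u → sup P ≤ u

  commutativeRing : CommutativeRing 0ℓ 0ℓ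
  commutativeRing = record { isCommutativeRing = isCommutativeRing }

-- Product of the nonzero base b digits. The order in which toDigits lists
-- the digits does not matter here.
p₀ : (b : ℕ) → 2 ℕ.≤ b → ℕ → ℕ
p₀ b b≥2 n = product (filter (λ d → ¬? (d ℕₚ.≟ 0)) (map toℕ digits))
  where digits = proj₁ (toDigits b {fromWitness b≥2} n)

HasCardinality : (ℕ → Set) → ℕ → Set
HasCardinality P k =
  Σ (List ℕ) λ ns → Unique ns × (∀ n → n ∈ ns ⇔ P n) × length ns ≡ k

module Analysis (R : Reals) where

  open Reals R public
  open RawSemiringDefs (Semiring.rawSemiring (CommutativeRing.semiring commutativeRing)) public
    using (sum) renaming (_^_ to _^ℕ_; _×_ to _·_)
  open Strict _≡_ _≤_ public using (_<_)

  infixl 6 _-_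
  infixl 7 _/_
  infixr 8 _^_

  _-_ : ℝ → ℝ → ℝ
  x - y = x + - y

  _/_ : ℝ → ℝ → ℝ
  x / y = x * y ⁻¹

  ∣_∣ : ℝ → ℝ
  ∣ x ∣ = [ (λ _ → x) , (λ _ → - x) ]′ (IsTotalOrder.total isTotalOrder 0# x)

  fromℕ : ℕ → ℝ
  fromℕ n = n · 1#

  -- "The real number satisfying P", for P satisfied by exactly one real
  -- number: the supremum of a singleton is its element.
  the : (ℝ → Set) → ℝ
  the = sup

  ConvergesTo : (ℕ → ℝ) → ℝ → Set
  ConvergesTo u L =
    ∀ ε → 0# < ε → ∃[ N ] ∀ n → N ℕ.≤ n → ∣ u n - L ∣ < ε

  HasDerivativeAt : (ℝ → ℝ) → ℝ → ℝ → Set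
  HasDerivativeAt f x L =
    ∀ ε → 0# < ε → ∃[ δ ] (0# < δ ×
      (∀ h → h ≢ 0# → ∣ h ∣ < δ → ∣ (f (x + h) - f x) / h - L ∣ < ε))

  TendsTo0AtInfinity : (ℝ → ℝ) → Set
  TendsTo0AtInfinity f =
    ∀ ε → 0# < ε → ∃[ X ] ∀ x → X ≤ x → ∣ f x ∣ < ε

  deriv : (ℝ → ℝ) → ℝ → ℝ
  deriv f x = the (HasDerivativeAt f x)

  exp : ℝ → ℝ
  exp x = the (ConvergesTo λ n → sum {n} λ k → x ^ℕ toℕ k / fromℕ (toℕ k !))

  -- Meaningful for positive arguments only; likewise _^_ for positive bases.
  log : ℝ → ℝ
  log x = the (λ y → exp y ≡ x)

  _^_ : ℝ → ℝ → ℝ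
  x ^ s = exp (s * log x)

  -- The index i : Fin (b ∸ 1) stands for the digit d = i + 1.
  ζ : ℕ → ℝ → ℝ
  ζ b s = sum {b ℕ.∸ 1} λ i → fromℕ (suc (toℕ i)) ^ (- s)

  𝒩₀ : (b : ℕ) → 2 ℕ.≤ b → ℝ → ℕ → Set
  𝒩₀ b b≥2 x n = 0 ℕ.< n × fromℕ n ≤ x × p₀ b b≥2 n ∣ n

  -- Cardinality of a finite set of natural numbers, as a real number.
  # : (ℕ → Set) → ℝ
  # P = the (λ r → ∃[ k ] (HasCardinality P k × r ≡ fromℕ k))

  -- f(x) < x^(η + o(1)) as x → +∞.
  _<x^[_+o1] : (ℝ → ℝ) → ℝ → Set
  f <x^[ η +o1] = Σ (ℝ → ℝ) λ ε → TendsTo0AtInfinity ε ×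
    (∃[ X ] ∀ x → X ≤ x → f x < x ^ (η + ε x))

{-# OPTIONS --safe #-}
module Submission where

-- Fix s > 0.  Expanding over the digits, the sum of p₀(n)^(-s) over n < b^N is (1 + ζ(s))^N, so at
-- most m^s (1 + ζ(s))^N such n have p₀(n) = m; if moreover p₀(n) ∣ n ≤ x, there are at most x / m of
-- them.  The geometric mean of the two bounds with weights 1/(1 + s) and s/(1 + s) does not depend
-- on m, and p₀ takes only polynomially many values in N ≈ log x / log b.  This gives the exponent
-- η(s) for every s > 0; the equation picks its minimum.
--
-- Its left-hand side is log b minus the height at -1 of the tangent at s to the strictly convex
-- function g = log (1 + ζ), hence increasing.  It is negative at 0, positive far out, and Lipschitz
-- on bounded intervals, which gives the root.
--
-- All estimates on exp, including convexity and derivatives, come from exp (x + y) = exp x exp y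
-- and 1 + x ≤ exp x.

-- `exp`, `log`, `deriv` and `#` are defined as suprema of sets meant to have one element, so each
-- value is pinned down by existence and uniqueness before anything is computed. Most inequalities
-- are then sums of multiples of known ones, with a ring identity matching the differences of the
-- two sides.
--
-- With ℓ = log b the exponent satisfies (1 + s) ℓ η(s) = s ℓ + g(s), so (1 + s)^2 ℓ η'(s) = ℓ -
-- g(s) + (1 + s) g'(s), which is the left-hand side of the equation; this is why its root is the
-- minimum. Neither g nor η is differentiated in the code: `m` stands for -g' and enters through the
-- tangent inequality, and only the derivative of ζ is computed.
--
-- Continuity is replaced by a bound on how fast a function can rise; the intermediate value theorem
-- in this form serves both `log` and the root. The root is bracketed explicitly: at 0 all b digits
-- weigh 1, so g(0) = ℓ, and the far end `T` comes from ζ - 1 = O(1/s) and ζ' = O(1/s^2), while ℓ -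
-- g stays bounded away from 0.

open import Defs
open import Algebra.Bundles using (CommutativeRing)
import Algebra.Properties.Ring as RingProperties
import Algebra.Properties.Semiring.Mult as Multiplication
import Algebra.Properties.Semiring.Mult.TCOptimised as Multiples
import Algebra.Solver.Ring as RingSolver
open import Algebra.Solver.Ring.AlmostCommutativeRing
  using (fromCommutativeRing; _-Raw-AlmostCommutative⟶_; Induced-equivalence)
open import Axiom.ExcludedMiddle using (ExcludedMiddle)
open import Data.Digit using (toDigits; fromDigits; Expansion)
open import Data.Fin.Base using (toℕ; fromℕ<)
open import Data.Fin.Properties using (toℕ<n; toℕ-fromℕ<)
import Data.Integer.Base as ℤ
import Data.Integer.Properties as ℤₚ
open import Data.List.Base
  using (List; []; _∷_; length; map; filter; upTo; cartesianProductWith; downFrom)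
open import Data.List.Membership.Propositional using (_∈_)
open import Data.List.Membership.Propositional.Properties
  using (∈-cartesianProductWith⁺; ∈-cartesianProductWith⁻; ∈-upTo⁺; ∈-upTo⁻; ∈-filter⁺; ∈-filter⁻; ∈-downFrom⁺)
open import Data.List.Membership.Propositional.Properties.WithK using (unique∧set⇒bag)
open import Data.List.Properties using (length-++; length-map; length-upTo)
open import Data.List.Relation.Binary.BagAndSetEquality using (∼bag⇒↭)
open import Data.List.Relation.Binary.Permutation.Propositional.Properties using (↭-length)
open import Data.List.Relation.Unary.Any using (here; there)
import Data.List.Relation.Unary.Unique.Propositional.Properties as Unique
open import Data.Maybe.Base as Maybe using (Maybe)
open import Data.Nat.Base as ℕ using (ℕ; zero; suc; z≤n; s≤s; _!)
open import Data.Nat.DivMod using ([m+kn]%n≡m%n; m<n⇒m%n≡m; m<n*o⇒m/o<n; m≡m%n+[m/n]*n; m%n<n)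
open import Data.Nat.Divisibility using (_∣_; divides; ∣m+n∣m⇒∣n; ∣⇒≤; n∣m*n)
open import Data.Nat.ListAction using (product)
import Data.Nat.Properties as ℕₚ
open import Data.Product using (∃!)
open import Data.Product.Base using (∃; ∃-syntax; _×_; _,_; proj₁; proj₂)
open import Data.Sum.Base using (_⊎_; inj₁; inj₂; [_,_]′)
open import Function.Bundles using (mk⇔)
import Function.Construct.Composition as Composition
import Function.Construct.Symmetry as Symmetry
open import Level using (0ℓ)
open import Relation.Binary.Bundles using (Poset)
open import Relation.Binary.Definitions using (WeaklyDecidable)
open import Relation.Binary.PropositionalEquality
  using (_≡_; _≢_; refl; sym; trans; cong; cong₂; subst; module ≡-Reasoning; subst₂)
import Relation.Binary.Reasoning.PartialOrder as PartialOrderReasoning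
import Relation.Binary.Reasoning.Setoid as SetoidReasoning
open import Relation.Binary.Structures using (IsTotalOrder)
open import Relation.Nullary using (¬_; yes; no; contradiction; Dec)
open import Relation.Nullary.Decidable using (dec⇒maybe; ¬?; fromWitness)

-- A ring solver with integer coefficients.

module IntegerCoefficientSolver (R : CommutativeRing 0ℓ 0ℓ) where

  open ℤ using (ℤ; +_; -[1+_]; _⊖_)
  open CommutativeRing R renaming (refl to ≈-refl; sym to ≈-sym; trans to ≈-trans)
  open RingProperties ring using (-‿distribˡ-*; -‿distribʳ-*; -0#≈0#; -‿involutive; -‿+-comm)
  open Multiples semiring using () renaming (_×_ to _ו_; 1+× to 1+ו; ×-homo-+ to ו-homo-+; ×1-homo-* to ו1-homo-*)
  open SetoidReasoning setoid

  -- Integers can be compared and cancelled by computation, which elements of an abstract ring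
  -- cannot. With the optimised multiples the image of 1 computes to `1#`, so that `:1` stands for
  -- `1#` in the solver's goals.
  ⟦_⟧ℤ : ℤ → Carrier
  ⟦ + n ⟧ℤ      = n ו 1#
  ⟦ -[1+ n ] ⟧ℤ = - (suc n ו 1#)

  -‿homo : ∀ i → ⟦ ℤ.- i ⟧ℤ ≈ - ⟦ i ⟧ℤ
  -‿homo (+ zero)   = ≈-sym -0#≈0#
  -‿homo (+ suc n)  = ≈-refl
  -‿homo (-[1+ n ]) = ≈-sym (-‿involutive _)

  ⊖-homo : ∀ m n → ⟦ m ⊖ n ⟧ℤ ≈ m ו 1# + - (n ו 1#)
  ⊖-homo zero    zero    = ≈-sym (-‿inverseʳ 0#)
  ⊖-homo zero    (suc n) = ≈-sym (+-identityˡ _)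
  ⊖-homo (suc m) zero    = begin
    suc m ו 1#          ≈⟨ +-identityʳ _ ⟨
    suc m ו 1# + 0#     ≈⟨ +-congˡ -0#≈0# ⟨
    suc m ו 1# + - 0#   ∎
  ⊖-homo (suc m) (suc n) = begin
    ⟦ suc m ⊖ suc n ⟧ℤ                     ≡⟨ cong ⟦_⟧ℤ (ℤₚ.[1+m]⊖[1+n]≡m⊖n m n) ⟩
    ⟦ m ⊖ n ⟧ℤ                             ≈⟨ ⊖-homo m n ⟩
    m ו 1# + - (n ו 1#)                    ≈⟨ +-congʳ (+-identityˡ _) ⟨
    0# + m ו 1# + - (n ו 1#)               ≈⟨ +-congʳ (+-congʳ (-‿inverseʳ 1#)) ⟨
    1# + - 1# + m ו 1# + - (n ו 1#)        ≈⟨ +-congʳ (+-assoc _ _ _) ⟩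
    1# + (- 1# + m ו 1#) + - (n ו 1#)      ≈⟨ +-congʳ (+-congˡ (+-comm _ _)) ⟩
    1# + (m ו 1# + - 1#) + - (n ו 1#)      ≈⟨ +-congʳ (+-assoc _ _ _) ⟨
    1# + m ו 1# + - 1# + - (n ו 1#)        ≈⟨ +-assoc _ _ _ ⟩
    1# + m ו 1# + (- 1# + - (n ו 1#))      ≈⟨ +-cong (≈-sym (1+ו m 1#)) (-‿+-comm 1# (n ו 1#)) ⟩
    suc m ו 1# + - (1# + n ו 1#)           ≈⟨ +-congˡ (-‿cong (1+ו n 1#)) ⟨
    suc m ו 1# + - (suc n ו 1#)            ∎

  +-homo : ∀ i j → ⟦ i ℤ.+ j ⟧ℤ ≈ ⟦ i ⟧ℤ + ⟦ j ⟧ℤ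
  +-homo (+ m)    (+ n)    = ו-homo-+ 1# m n
  +-homo (+ m)    -[1+ n ] = ⊖-homo m (suc n)
  +-homo -[1+ m ] (+ n)    = ≈-trans (⊖-homo n (suc m)) (+-comm _ _)
  +-homo -[1+ m ] -[1+ n ] = begin
    - (suc (suc (m ℕ.+ n)) ו 1#)       ≡⟨ cong (λ k → - (k ו 1#)) (ℕₚ.+-suc (suc m) n) ⟨
    - ((suc m ℕ.+ suc n) ו 1#)         ≈⟨ -‿cong (ו-homo-+ 1# (suc m) (suc n)) ⟩
    - (suc m ו 1# + suc n ו 1#)        ≈⟨ -‿+-comm _ _ ⟨
    - (suc m ו 1#) + - (suc n ו 1#)    ∎

  +*-homo : ∀ m j → ⟦ + m ℤ.* j ⟧ℤ ≈ m ו 1# * ⟦ j ⟧ℤ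
  +*-homo m (+ n)    = ≈-trans (reflexive (cong ⟦_⟧ℤ (sym (ℤₚ.pos-* m n)))) (ו1-homo-* m n)
  +*-homo m -[1+ n ] = begin
    ⟦ + m ℤ.* ℤ.- (+ suc n) ⟧ℤ         ≡⟨ cong ⟦_⟧ℤ (ℤₚ.neg-distribʳ-* (+ m) (+ suc n)) ⟨
    ⟦ ℤ.- (+ m ℤ.* + suc n) ⟧ℤ         ≈⟨ -‿homo (+ m ℤ.* + suc n) ⟩
    - ⟦ + m ℤ.* + suc n ⟧ℤ             ≈⟨ -‿cong (+*-homo m (+ suc n)) ⟩
    - (m ו 1# * (suc n ו 1#))          ≈⟨ -‿distribʳ-* _ _ ⟩
    m ו 1# * - (suc n ו 1#)            ∎

  *-homo : ∀ i j → ⟦ i ℤ.* j ⟧ℤ ≈ ⟦ i ⟧ℤ * ⟦ j ⟧ℤ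
  *-homo (+ m)    j = +*-homo m j
  *-homo -[1+ m ] j = begin
    ⟦ ℤ.- (+ suc m) ℤ.* j ⟧ℤ           ≡⟨ cong ⟦_⟧ℤ (ℤₚ.neg-distribˡ-* (+ suc m) j) ⟨
    ⟦ ℤ.- (+ suc m ℤ.* j) ⟧ℤ           ≈⟨ -‿homo (+ suc m ℤ.* j) ⟩
    - ⟦ + suc m ℤ.* j ⟧ℤ               ≈⟨ -‿cong (+*-homo (suc m) j) ⟩
    - (suc m ו 1# * ⟦ j ⟧ℤ)            ≈⟨ -‿distribˡ-* _ _ ⟩
    - (suc m ו 1#) * ⟦ j ⟧ℤ            ∎

  morphism : ℤ.+-*-rawRing -Raw-AlmostCommutative⟶ fromCommutativeRing R
  morphism = record
    { ⟦_⟧    = ⟦_⟧ℤ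
    ; +-homo = +-homo
    ; *-homo = *-homo
    ; -‿homo = -‿homo
    ; 0-homo = ≈-refl
    ; 1-homo = ≈-refl
    }

  _coeff≟_ : WeaklyDecidable (Induced-equivalence morphism)
  i coeff≟ j = Maybe.map (λ i≡j → reflexive (cong ⟦_⟧ℤ i≡j)) (dec⇒maybe (i ℤₚ.≟ j))

  open RingSolver ℤ.+-*-rawRing (fromCommutativeRing R) morphism _coeff≟_ public
    using (Polynomial; solve; _:=_; _:+_; _:*_; _:-_; :-_; con)

  :0 :1 : ∀ {n} → Polynomial n
  :0 = con (+ 0)
  :1 = con (+ 1)

-- Ordered-field arithmetic.

module OrderedField (em : ExcludedMiddle 0ℓ) (R : Reals) where

  open Analysis R
  open CommutativeRing commutativeRing
    using (+-assoc; +-comm; +-identityˡ; +-identityʳ; *-assoc; *-comm; *-identityˡ; *-identityʳ)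
  open IntegerCoefficientSolver commutativeRing


  open IsTotalOrder isTotalOrder public
    using ()
    renaming (refl to ≤-refl; trans to ≤-trans; antisym to ≤-antisym; total to ≤-total; reflexive to ≤-reflexive)

  poset : Poset 0ℓ 0ℓ 0ℓ
  poset = record { isPartialOrder = IsTotalOrder.isPartialOrder isTotalOrder }

  module ≤-Reasoning where
    open PartialOrderReasoning poset public

  2# ½ : ℝ
  2# = 1# + 1#
  ½ = 2# ⁻¹

  ≡-by : ∀ {a b x y} → x ≡ y → b - a ≡ y - x → a ≡ b
  ≡-by {a} {b} {x} refl b-a≡ = begin
    a               ≡⟨ solve 2 (λ x₀ x₁ → (x₀) := (x₁ :- x₁ :+ x₀)) refl a x ⟩
    (x - x) + a     ≡⟨ cong (_+ a) b-a≡ ⟨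
    (b - a) + a     ≡⟨ solve 2 (λ x₀ x₁ → (x₀ :- x₁ :+ x₁) := (x₀)) refl b a ⟩
    b               ∎
    where open ≡-Reasoning

  -- Splits an estimate into a combination of known inequalities, assembled with `_⊕_` and `_⊗_`,
  -- and a ring identity between differences that is left to the solver.
  ≤-by : ∀ {a b x y} → x ≤ y → b - a ≡ y - x → a ≤ b
  ≤-by {a} {b} {x} {y} x≤y b-a≡ =
    subst (_≤ b) a≡ (subst (x + (a - x) ≤_) b≡ (+-monoˡ-≤ (a - x) x≤y))
    where
    a≡ : x + (a - x) ≡ a
    a≡ = solve 2 (λ x₀ x₁ → (x₀ :+ (x₁ :- x₀)) := (x₁)) refl x a
    b≡ : y + (a - x) ≡ b
    b≡ = ≡-by (sym b-a≡)
        (solve 4 (λ x₀ x₁ x₂ x₃ → (x₀ :- (x₁ :+ (x₂ :- x₃))) :=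
              (x₀ :- x₂ :- (x₁ :- x₃))) refl b y a x)

  <-by : ∀ {a b x y} → x < y → b - a ≡ y - x → a < b
  <-by {a} {b} {x} {y} (x≤y , x≢y) b-a≡ = ≤-by x≤y b-a≡ , λ a≡b →
    x≢y (≡-by a≡b (trans (sym b-a≡) refl))

  <⇒≤ : ∀ {x y} → x < y → x ≤ y
  <⇒≤ = proj₁

  ≤-<-trans : ∀ {x y z} → x ≤ y → y < z → x < z
  ≤-<-trans x≤y (y≤z , y≢z) = ≤-trans x≤y y≤z , λ { refl → y≢z (≤-antisym y≤z x≤y) }

  <-≤-trans : ∀ {x y z} → x < y → y ≤ z → x < z
  <-≤-trans (x≤y , x≢y) y≤z = ≤-trans x≤y y≤z , λ { refl → x≢y (≤-antisym x≤y y≤z) }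

  <-trans : ∀ {x y z} → x < y → y < z → x < z
  <-trans (x≤y , _) = ≤-<-trans x≤y

  <⇒≱ : ∀ {x y} → x < y → ¬ (y ≤ x)
  <⇒≱ (x≤y , x≢y) y≤x = x≢y (≤-antisym x≤y y≤x)

  -- Totality compares only weakly; deciding equality by excluded middle gives the strict
  -- alternative.
  ≤⊎> : ∀ x y → x ≤ y ⊎ y < x
  ≤⊎> x y with ≤-total x y
  ... | inj₁ x≤y = inj₁ x≤y
  ... | inj₂ y≤x with em {P = y ≡ x}
  ...   | yes refl = inj₁ y≤x
  ...   | no y≢x   = inj₂ (y≤x , y≢x)

  ≮⇒≥ : ∀ {x y} → ¬ (x < y) → y ≤ x
  ≮⇒≥ {x} {y} x≮y with ≤⊎> y x
  ... | inj₁ y≤x = y≤x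
  ... | inj₂ x<y = contradiction x<y x≮y

  ≰⇒> : ∀ {x y} → ¬ (x ≤ y) → y < x
  ≰⇒> {x} {y} x≰y with ≤⊎> x y
  ... | inj₁ x≤y = contradiction x≤y x≰y
  ... | inj₂ y<x = y<x

  infixl 6 _⊕_ _⊕<_
  infixl 7 _⊗_ _⊗<_

  _⊕_ : ∀ {x y u v} → x ≤ y → u ≤ v → x + u ≤ y + v
  _⊕_ {x} {y} {u} {v} x≤y u≤v =
    ≤-trans (+-monoˡ-≤ u x≤y) (≤-by u≤v
        (solve 3 (λ x₀ x₁ x₂ → (x₀ :+ x₁ :- (x₀ :+ x₂)) := (x₁ :- x₂)) refl y v u))

  _⊕<_ : ∀ {x y u v} → x ≤ y → u < v → x + u < y + v
  _⊕<_ {x} {y} {u} {v} x≤y u<v =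
    ≤-<-trans (+-monoˡ-≤ u x≤y) (<-by u<v
        (solve 3 (λ x₀ x₁ x₂ → (x₀ :+ x₁ :- (x₀ :+ x₂)) := (x₁ :- x₂)) refl y v u))

  _⊗_ : ∀ {c x y} → 0# ≤ c → x ≤ y → c * x ≤ c * y
  _⊗_ {c} {x} {y} 0≤c x≤y =
    ≤-by (*-nonNegative 0≤c (≤-by {0#} {y - x} x≤y
        (solve 2 (λ x₀ x₁ → (x₀ :- x₁ :- :0) :=
              (x₀ :- x₁)) refl
              y x)))
                  (solve 3 (λ x₀ x₁ x₂ → (x₀ :* x₁ :- x₀ :* x₂) :=
                        (x₀ :* (x₁ :- x₂) :- :0)) refl c y x)

  0<⇒≢0 : ∀ {x} → 0# < x → x ≢ 0#
  0<⇒≢0 (_ , 0≢x) x≡0 = 0≢x (sym x≡0)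

  *-cancel-0 : ∀ {x y} → x ≢ 0# → x * y ≡ 0# → y ≡ 0#
  *-cancel-0 {x} {y} x≢0 xy≡0 = begin
    y                                     ≡⟨ solve 1 (λ x₀ → (x₀) := (x₀ :* :1)) refl y ⟩
    y * 1#                                ≡⟨ cong (y *_) (*-inverseʳ x x≢0) ⟨
    y * (x * x ⁻¹)
        ≡⟨ solve 3 (λ x₀ x₁ x₂ → (x₀ :* (x₁ :* x₂)) := (x₁ :* x₀ :* x₂)) refl y x (x ⁻¹) ⟩
    x * y * x ⁻¹                          ≡⟨ cong (_* x ⁻¹) xy≡0 ⟩
    0# * x ⁻¹                             ≡⟨ solve 1 (λ x₀ → (:0 :* x₀) := (:0)) refl (x ⁻¹) ⟩
    0#                                    ∎
    where open ≡-Reasoning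

  *-positive : ∀ {x y} → 0# < x → 0# < y → 0# < x * y
  *-positive 0<x 0<y = *-nonNegative (<⇒≤ 0<x) (<⇒≤ 0<y) , λ 0≡xy →
    0<⇒≢0 0<y (*-cancel-0 (0<⇒≢0 0<x) (sym 0≡xy))

  _⊗<_ : ∀ {c x y} → 0# < c → x < y → c * x < c * y
  _⊗<_ {c} {x} {y} 0<c x<y =
    <-by (*-positive 0<c (<-by {0#} {y - x} x<y
        (solve 2 (λ x₀ x₁ → (x₀ :- x₁ :- :0) :=
              (x₀ :- x₁)) refl
              y x)))
                  (solve 3 (λ x₀ x₁ x₂ → (x₀ :* x₁ :- x₀ :* x₂) :=
                        (x₀ :* (x₁ :- x₂) :- :0)) refl c y x)

  square-nonNegative : ∀ x → 0# ≤ x * x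
  square-nonNegative x with ≤-total 0# x
  ... | inj₁ 0≤x = *-nonNegative 0≤x 0≤x
  ... | inj₂ x≤0 = ≤-by (*-nonNegative 0≤-x 0≤-x)
      (solve 1 (λ x₀ → (x₀ :* x₀ :- :0) := ((:- x₀) :* (:- x₀) :- :0)) refl x)
    where
    0≤-x : 0# ≤ - x
    0≤-x = ≤-by x≤0 (solve 1 (λ x₀ → ((:- x₀) :- :0) := (:0 :- x₀)) refl x)

  0<1 : 0# < 1#
  0<1 = ≤-by (square-nonNegative 1#) (solve 0 ((:1 :- :0) := (:1 :* :1 :- :0)) refl) , 0≢1

  0≤1 : 0# ≤ 1#
  0≤1 = <⇒≤ 0<1

  0<2 : 0# < 2#
  0<2 = <-by (<⇒≤ 0<1 ⊕< 0<1) (solve 0 ((:1 :+ :1 :- :0) := (:1 :+ :1 :- (:0 :+ :0))) refl)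

  ⁻¹-positive : ∀ {x} → 0# < x → 0# < x ⁻¹
  ⁻¹-positive {x} 0<x with ≤⊎> (x ⁻¹) 0#
  ... | inj₂ 0<x⁻¹ = 0<x⁻¹
  ... | inj₁ x⁻¹≤0 = contradiction
    (≤-by (<⇒≤ 0<x ⊗ x⁻¹≤0)
      (trans {j = x * 0# - 1#}
          (solve 1 (λ x₀ → (:0 :- :1) :=
                (x₀ :* :0 :- :1)) refl
                x) (cong (λ z → x * 0# - z) (sym (*-inverseʳ x (0<⇒≢0 0<x))))))
    (<⇒≱ 0<1)

  x*x⁻¹≡1 : ∀ {x} → 0# < x → x * x ⁻¹ ≡ 1#
  x*x⁻¹≡1 0<x = *-inverseʳ _ (0<⇒≢0 0<x)

  2*½≡1 : 2# * ½ ≡ 1#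
  2*½≡1 = x*x⁻¹≡1 0<2

  0<½ : 0# < ½
  0<½ = ⁻¹-positive 0<2

  *-cancelˡ-≤ : ∀ {c x y} → 0# < c → c * x ≤ c * y → x ≤ y
  *-cancelˡ-≤ {c} {x} {y} 0<c cx≤cy with ≤⊎> x y
  ... | inj₁ x≤y = x≤y
  ... | inj₂ y<x = contradiction cx≤cy (<⇒≱ (0<c ⊗< y<x))

  *-cancelˡ-< : ∀ {c x y} → 0# < c → c * x < c * y → x < y
  *-cancelˡ-< {c} {x} {y} 0<c cx<cy with ≤⊎> y x
  ... | inj₂ x<y = x<y
  ... | inj₁ y≤x = contradiction (<⇒≤ 0<c ⊗ y≤x) (<⇒≱ cx<cy)

  *-cancelˡ-≡ : ∀ {c x y} → 0# < c → c * x ≡ c * y → x ≡ y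
  *-cancelˡ-≡ 0<c cx≡cy = ≤-antisym (*-cancelˡ-≤ 0<c (≤-reflexive cx≡cy)) (*-cancelˡ-≤ 0<c (≤-reflexive (sym cx≡cy)))

  y*[x/y]≡x : ∀ {x y} → 0# < y → y * (x / y) ≡ x
  y*[x/y]≡x {x} {y} 0<y = begin
    y * (x / y)
        ≡⟨ solve 3 (λ x₀ x₁ x₂ → (x₀ :* (x₁ :* x₂)) := (x₁ :* (x₀ :* x₂))) refl y x (y ⁻¹) ⟩
    x * (y * y ⁻¹)   ≡⟨ cong (x *_) (x*x⁻¹≡1 0<y) ⟩
    x * 1#           ≡⟨ solve 1 (λ x₀ → (x₀ :* :1) := (x₀)) refl x ⟩
    x                ∎
    where open ≡-Reasoning

  *-mono-≤ : ∀ {x y u v} → 0# ≤ x → 0# ≤ v → x ≤ y → u ≤ v → x * u ≤ y * v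
  *-mono-≤ {x} {y} {u} {v} 0≤x 0≤v x≤y u≤v = ≤-by (0≤x ⊗ u≤v ⊕ 0≤v ⊗ x≤y)
      (solve 4 (λ x₀ x₁ x₂ x₃ → (x₀ :* x₁ :- x₂ :* x₃) :=
            (x₂ :* x₁ :+ x₁ :* x₀ :- (x₂ :* x₃ :+ x₁ :* x₂))) refl y v x u)

  ∣x∣≤ : ∀ {x c} → x ≤ c → - x ≤ c → ∣ x ∣ ≤ c
  ∣x∣≤ {x} x≤c -x≤c with ≤-total 0# x
  ... | inj₁ _ = x≤c
  ... | inj₂ _ = -x≤c

  ∣x∣< : ∀ {x c} → x < c → - x < c → ∣ x ∣ < c
  ∣x∣< {x} x<c -x<c with ≤-total 0# x
  ... | inj₁ _ = x<c
  ... | inj₂ _ = -x<c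

  x≤∣x∣ : ∀ x → x ≤ ∣ x ∣
  x≤∣x∣ x with ≤-total 0# x
  ... | inj₁ _   = ≤-refl
  ... | inj₂ x≤0 = ≤-by {x} { - x} (x≤0 ⊕ x≤0)
      (solve 1 (λ x₀ → ((:- x₀) :- x₀) := (:0 :+ :0 :- (x₀ :+ x₀))) refl x)

  -x≤∣x∣ : ∀ x → - x ≤ ∣ x ∣
  -x≤∣x∣ x with ≤-total 0# x
  ... | inj₁ 0≤x = ≤-by { - x} {x} (0≤x ⊕ 0≤x)
      (solve 1 (λ x₀ → (x₀ :- (:- x₀)) := (x₀ :+ x₀ :- (:0 :+ :0))) refl x)
  ... | inj₂ _   = ≤-refl

  0≤∣x∣ : ∀ x → 0# ≤ ∣ x ∣
  0≤∣x∣ x with ≤-total 0# x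
  ... | inj₁ 0≤x = 0≤x
  ... | inj₂ x≤0 = ≤-by {0#} { - x} x≤0 (solve 1 (λ x₀ → ((:- x₀) :- :0) := (:0 :- x₀)) refl x)

  -- How every value introduced by `the` is computed.
  sup-singleton : ∀ (P : ℝ → Set) {a} → P a → (∀ y → P y → y ≡ a) → sup P ≡ a
  sup-singleton P {a} Pa unique = ≤-antisym
    (sup-least P (a , Pa) bounded a (proj₂ bounded)) (sup-upper P (a , Pa) bounded a Pa)
    where
    bounded : ∃ (UpperBound P)
    bounded = a , λ y Py → ≤-reflexive (unique y Py)

  open Multiplication (CommutativeRing.semiring commutativeRing)
    using () renaming (×-homo-+ to ·-homo-+; ×1-homo-* to ·1-homo-*)

  fromℕ-+ : ∀ m n → fromℕ (m ℕ.+ n) ≡ fromℕ m + fromℕ n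
  fromℕ-+ = ·-homo-+ 1#

  fromℕ-* : ∀ m n → fromℕ (m ℕ.* n) ≡ fromℕ m * fromℕ n
  fromℕ-* = ·1-homo-*

  0≤fromℕ : ∀ n → 0# ≤ fromℕ n
  0≤fromℕ zero    = ≤-refl
  0≤fromℕ (suc n) = ≤-by (0≤1 ⊕ 0≤fromℕ n)
      (solve 1 (λ x₀ → (:1 :+ x₀ :- :0) := (:1 :+ x₀ :- (:0 :+ :0))) refl (fromℕ n))

  fromℕ-mono-≤ : ∀ {m n} → m ℕ.≤ n → fromℕ m ≤ fromℕ n
  fromℕ-mono-≤ (z≤n {n})                   = 0≤fromℕ n
  fromℕ-mono-≤ {suc m} {suc n} (s≤s m≤n) = ≤-refl {1#} ⊕ fromℕ-mono-≤ {m} {n} m≤n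

  fromℕ-mono-< : ∀ {m n} → m ℕ.< n → fromℕ m < fromℕ n
  fromℕ-mono-< {m} {n} m<n = <-≤-trans (<-by 0<1
      (solve 1 (λ x₀ → (:1 :+ x₀ :- x₀) := (:1 :- :0)) refl (fromℕ m))) (fromℕ-mono-≤ m<n)

  0<fromℕ : ∀ {n} → 0 ℕ.< n → 0# < fromℕ n
  0<fromℕ = fromℕ-mono-<

  -- If the naturals were bounded, n + 1 ≤ sup would give n ≤ sup - 1 for all n, and sup - 1 would
  -- be a smaller upper bound.
  archimedean : ∀ x → ∃[ n ] x < fromℕ n
  archimedean x with em {P = ∃[ n ] x < fromℕ n}
  ... | yes found = found
  ... | no ¬found = contradiction (sup-least IsNat nonempty bounded (sup IsNat - 1#) sup-1-bounds)
    (<⇒≱ (<-by 0<1 (solve 1 (λ x₀ → (x₀ :- (x₀ :- :1)) := (:1 :- :0)) refl (sup IsNat))))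
    where
    IsNat : ℝ → Set
    IsNat r = ∃[ n ] r ≡ fromℕ n
    nonempty : ∃ IsNat
    nonempty = 0# , 0 , refl
    bounded : ∃ (UpperBound IsNat)
    bounded = x , λ { _ (n , refl) → ≮⇒≥ (λ x<n → ¬found (n , x<n)) }
    sup-1-bounds : UpperBound IsNat (sup IsNat - 1#)
    sup-1-bounds _ (n , refl) = ≤-by (sup-upper IsNat nonempty bounded (fromℕ (suc n)) (suc n , refl))
        (solve 2 (λ x₀ x₁ → (x₀ :- :1 :- x₁) := (x₀ :- (:1 :+ x₁))) refl (sup IsNat) (fromℕ n))

  floor : ∀ x → 0# ≤ x → ∃[ n ] (fromℕ n ≤ x × x < fromℕ (suc n))
  floor x 0≤x = search (proj₁ (archimedean x)) (proj₂ (archimedean x))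
    where
    search : ∀ n → x < fromℕ n → ∃[ m ] (fromℕ m ≤ x × x < fromℕ (suc m))
    search zero    x<0 = contradiction 0≤x (<⇒≱ x<0)
    search (suc n) x<1+n with ≤⊎> (fromℕ n) x
    ... | inj₁ n≤x = n , n≤x , x<1+n
    ... | inj₂ x<n = search n x<n

-- Finite sums over intervals, rectangles and triangles.

module FiniteSums (em : ExcludedMiddle 0ℓ) (R : Reals) where

  open Analysis R
  open OrderedField em R
  open IntegerCoefficientSolver commutativeRing
  open CommutativeRing commutativeRing using (+-assoc; +-identityˡ; +-identityʳ; *-comm; distribˡ)

  ∑ : ℕ → (ℕ → ℝ) → ℝ
  ∑ n f = sum {n} (λ k → f (toℕ k))

  ∑-last : ∀ n f → ∑ (suc n) f ≡ ∑ n f + f n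
  ∑-last zero    f = solve 1 (λ x₀ → (x₀ :+ :0) := (:0 :+ x₀)) refl (f 0)
  ∑-last (suc n) f = trans (cong (f 0 +_) (∑-last n (λ i → f (suc i)))) (sym (+-assoc _ _ _))

  ∑-cong : ∀ n {f g} → (∀ i → f i ≡ g i) → ∑ n f ≡ ∑ n g
  ∑-cong zero    f≡g = refl
  ∑-cong (suc n) f≡g = cong₂ _+_ (f≡g 0) (∑-cong n (λ i → f≡g (suc i)))

  ∑-mono : ∀ n {f g} → (∀ i → i ℕ.< n → f i ≤ g i) → ∑ n f ≤ ∑ n g
  ∑-mono zero    f≤g = ≤-refl
  ∑-mono (suc n) f≤g = f≤g 0 (s≤s z≤n) ⊕ ∑-mono n (λ i i<n → f≤g (suc i) (s≤s i<n))

  ∑-zero : ∀ n → ∑ n (λ _ → 0#) ≡ 0#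
  ∑-zero zero    = refl
  ∑-zero (suc n) = ≡-by (∑-zero n)
      (solve 1 (λ x₀ → (:0 :- (:0 :+ x₀)) := (:0 :- x₀)) refl (∑ n (λ _ → 0#)))

  ∑-nonNegative : ∀ n {f} → (∀ i → 0# ≤ f i) → 0# ≤ ∑ n f
  ∑-nonNegative n {f} 0≤f = subst (_≤ ∑ n f) (∑-zero n) (∑-mono n (λ i _ → 0≤f i))

  ∑-+ : ∀ n f g → ∑ n (λ i → f i + g i) ≡ ∑ n f + ∑ n g
  ∑-+ zero    f g = solve 0 ((:0) := (:0 :+ :0)) refl
  ∑-+ (suc n) f g = ≡-by (∑-+ n (λ i → f (suc i)) (λ i → g (suc i)))
      (solve 5 (λ x₀ x₁ x₂ x₃ x₄ → (x₀ :+ x₁ :+ (x₂ :+ x₃) :- (x₀ :+ x₂ :+ x₄)) :=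
            (x₁ :+ x₃ :- x₄)) refl
            (f 0) (∑ n (λ i → f (suc i))) (g 0) (∑ n (λ i → g (suc i))) (∑ n (λ i → f (suc i) + g (suc i))))

  ∑-* : ∀ n c f → ∑ n (λ i → c * f i) ≡ c * ∑ n f
  ∑-* zero    c f = solve 1 (λ x₀ → (:0) := (x₀ :* :0)) refl c
  ∑-* (suc n) c f = ≡-by (∑-* n c (λ i → f (suc i)))
      (solve 4 (λ x₀ x₁ x₂ x₃ → (x₀ :* (x₁ :+ x₂) :- (x₀ :* x₁ :+ x₃)) :=
            (x₀ :* x₂ :- x₃)) refl c (f 0) (∑ n (λ i → f (suc i))) (∑ n (λ i → c * f (suc i))))

  ∑-linear : ∀ n a f b g → ∑ n (λ i → a * f i + b * g i) ≡ a * ∑ n f + b * ∑ n g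
  ∑-linear n a f b g = trans (∑-+ n (λ i → a * f i) (λ i → b * g i)) (cong₂ _+_ (∑-* n a f) (∑-* n b g))

  ∑-positive : ∀ n {f} → (∀ i → 0# < f i) → 0# < ∑ (suc n) f
  ∑-positive n {f} 0<f = <-≤-trans (0<f 0)
    (≤-by (∑-nonNegative n {λ i → f (suc i)} (λ i → <⇒≤ (0<f (suc i))))
        (solve 2 (λ x₀ x₁ → (x₀ :+ x₁ :- x₀) := (x₁ :- :0)) refl (f 0) (∑ n (λ i → f (suc i)))))

  ∑-member : ∀ {n i f} → (∀ i → 0# ≤ f i) → i ℕ.< n → f i ≤ ∑ n f
  ∑-member {suc n} {zero}  {f} 0≤f _         = ≤-by (∑-nonNegative n {λ i → f (suc i)} (λ i → 0≤f (suc i)))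
      (solve 2 (λ x₀ x₁ → (x₀ :+ x₁ :- x₀) := (x₁ :- :0)) refl (f 0) (∑ n (λ i → f (suc i))))
  ∑-member {suc n} {suc i} {f} 0≤f (s≤s i<n) = ≤-trans (∑-member {n} {i} {λ i → f (suc i)} (λ i → 0≤f (suc i)) i<n) (≤-by (0≤f 0)
      (solve 2 (λ x₀ x₁ → (x₀ :+ x₁ :- x₁) := (x₀ :- :0)) refl (f 0) (∑ n (λ i → f (suc i)))))

  ∑-concat : ∀ m n f → ∑ (m ℕ.+ n) f ≡ ∑ m f + ∑ n (λ i → f (m ℕ.+ i))
  ∑-concat zero    n f = sym (+-identityˡ _)
  ∑-concat (suc m) n f = trans (cong (f 0 +_) (∑-concat m n (λ i → f (suc i)))) (sym (+-assoc _ _ _))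

  ∑-mono-length : ∀ {m n f} → (∀ i → 0# ≤ f i) → m ℕ.≤ n → ∑ m f ≤ ∑ n f
  ∑-mono-length {n = n} 0≤f z≤n       = ∑-nonNegative n 0≤f
  ∑-mono-length {f = f} 0≤f (s≤s m≤n) = ≤-refl {f 0} ⊕ ∑-mono-length (λ i → 0≤f (suc i)) m≤n

  -- The sum over i + j = n, with the term i = 0 split off and f shifted in its first argument.
  antidiagonal : ℕ → (ℕ → ℕ → ℝ) → ℝ
  antidiagonal zero    f = f 0 0
  antidiagonal (suc n) f = f 0 (suc n) + antidiagonal n (λ i → f (suc i))

  antidiagonal-cong : ∀ n {f g} → (∀ i j → i ℕ.+ j ≡ n → f i j ≡ g i j) →
                      antidiagonal n f ≡ antidiagonal n g
  antidiagonal-cong zero    f≡g = f≡g 0 0 refl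
  antidiagonal-cong (suc n) f≡g =
    cong₂ _+_ (f≡g 0 (suc n) refl) (antidiagonal-cong n (λ i j i+j≡n → f≡g (suc i) j (cong suc i+j≡n)))

  antidiagonal-last : ∀ n f →
    antidiagonal (suc n) f ≡ antidiagonal n (λ i j → f i (suc j)) + f (suc n) 0
  antidiagonal-last zero    f = refl
  antidiagonal-last (suc n) f = trans (cong (f 0 (suc (suc n)) +_) (antidiagonal-last n (λ i → f (suc i)))) (sym (+-assoc _ _ _))

  antidiagonal-+ : ∀ n f g →
    antidiagonal n (λ i j → f i j + g i j) ≡ antidiagonal n f + antidiagonal n g
  antidiagonal-+ zero    f g = refl
  antidiagonal-+ (suc n) f g = begin
    (f₀ + g₀) + antidiagonal n (λ i j → f (suc i) j + g (suc i) j)   ≡⟨ cong (f₀ + g₀ +_) (antidiagonal-+ n (λ i → f (suc i)) (λ i → g (suc i))) ⟩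
    (f₀ + g₀) + (fₛ + gₛ)
        ≡⟨ solve 4 (λ x₀ x₁ x₂ x₃ → (x₀ :+ x₁ :+ (x₂ :+ x₃)) :=
              (x₀ :+ x₂ :+ (x₁ :+ x₃))) refl f₀ g₀ fₛ gₛ ⟩
    (f₀ + fₛ) + (g₀ + gₛ)                                            ∎
    where
    open ≡-Reasoning
    f₀ = f 0 (suc n)
    g₀ = g 0 (suc n)
    fₛ = antidiagonal n (λ i → f (suc i))
    gₛ = antidiagonal n (λ i → g (suc i))

  antidiagonal-* : ∀ n c f → antidiagonal n (λ i j → c * f i j) ≡ c * antidiagonal n f
  antidiagonal-* zero    c f = refl
  antidiagonal-* (suc n) c f = trans
    (cong (c * f 0 (suc n) +_) (antidiagonal-* n c (λ i → f (suc i)))) (sym (distribˡ c _ _))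

  rectangle : ℕ → ℕ → (ℕ → ℕ → ℝ) → ℝ
  rectangle m n f = ∑ m (λ i → ∑ n (f i))

  -- The sum over i + j < n, grouped by antidiagonals.
  triangle : ℕ → (ℕ → ℕ → ℝ) → ℝ
  triangle n f = ∑ n (λ k → antidiagonal k f)

  -- Regroups by rows: row i = 0 splits off and the rest is a smaller triangle. This makes triangles
  -- and rectangles comparable row by row.
  triangle-suc : ∀ n f → triangle (suc n) f ≡ ∑ (suc n) (f 0) + triangle n (λ i → f (suc i))
  triangle-suc zero    f = sym (+-identityʳ _)
  triangle-suc (suc n) f = begin
    triangle (suc (suc n)) f                                   ≡⟨ ∑-last (suc n) (λ k → antidiagonal k f) ⟩
    triangle (suc n) f + (f 0 (suc n) + last)                  ≡⟨ cong (_+ (f 0 (suc n) + last)) (triangle-suc n f) ⟩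
    ∑ (suc n) (f 0) + triangle n fₛ + (f 0 (suc n) + last)
        ≡⟨ solve 5 (λ x₀ x₁ x₂ x₃ x₄ → (x₀ :+ x₁ :+ x₂ :+ (x₃ :+ x₄)) :=
              (x₀ :+ x₁ :+ x₃ :+ (x₂ :+ x₄))) refl
              ((f 0) 0) (∑ n (λ i → (f 0) (suc i))) (triangle n fₛ) (f 0 (suc n)) last ⟩
    (∑ (suc n) (f 0) + f 0 (suc n)) + (triangle n fₛ + last)   ≡⟨ cong₂ _+_ (∑-last (suc n) (f 0)) (∑-last n (λ k → antidiagonal k fₛ)) ⟨
    ∑ (suc (suc n)) (f 0) + triangle (suc n) fₛ                ∎
    where
    open ≡-Reasoning
    fₛ = λ i → f (suc i)
    last = antidiagonal n fₛ

  -- Row i has m - i entries in the triangle and n ≥ m in the rectangle.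
  triangle≤rectangle : ∀ {m n f} → (∀ i j → 0# ≤ f i j) → m ℕ.≤ n → triangle m f ≤ rectangle m n f
  triangle≤rectangle {zero}          0≤f _   = ≤-refl
  triangle≤rectangle {suc m} {n} {f} 0≤f m<n = subst (_≤ rectangle (suc m) n f) (sym (triangle-suc m f))
    (∑-mono-length (0≤f 0) m<n ⊕ triangle≤rectangle (λ i → 0≤f (suc i)) (ℕₚ.<⇒≤ m<n))

  -- For i < m, row i has n entries in the rectangle and m + n - i in the triangle.
  rectangle≤triangle : ∀ m n {f} → (∀ i j → 0# ≤ f i j) → rectangle m n f ≤ triangle (m ℕ.+ n) f
  rectangle≤triangle zero    n {f} 0≤f = ∑-nonNegative n (λ k → antidiagonal-nonNegative k 0≤f)
    where
    antidiagonal-nonNegative : ∀ n {g} → (∀ i j → 0# ≤ g i j) → 0# ≤ antidiagonal n g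
    antidiagonal-nonNegative zero    0≤g = 0≤g 0 0
    antidiagonal-nonNegative (suc n) {g} 0≤g =
      subst (_≤ antidiagonal (suc n) g) (+-identityˡ 0#) (0≤g 0 (suc n) ⊕ antidiagonal-nonNegative n (λ i → 0≤g (suc i)))
  rectangle≤triangle (suc m) n {f} 0≤f = subst (rectangle (suc m) n f ≤_) (sym (triangle-suc (m ℕ.+ n) f))
    (∑-mono-length (0≤f 0) (ℕₚ.≤-trans (ℕₚ.m≤n+m n m) (ℕₚ.n≤1+n (m ℕ.+ n))) ⊕ rectangle≤triangle m n (λ i → 0≤f (suc i)))

  rectangle-linear : ∀ m n c f g →
    rectangle m n (λ i j → c * f i j + g i j) ≡ c * rectangle m n f + rectangle m n g
  rectangle-linear m n c f g = begin
    rectangle m n (λ i j → c * f i j + g i j)          ≡⟨ ∑-cong m (λ i → ∑-+ n (λ j → c * f i j) (g i)) ⟩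
    ∑ m (λ i → ∑ n (λ j → c * f i j) + ∑ n (g i))      ≡⟨ ∑-cong m (λ i → cong (_+ ∑ n (g i)) (∑-* n c (f i))) ⟩
    ∑ m (λ i → c * ∑ n (f i) + ∑ n (g i))              ≡⟨ ∑-+ m (λ i → c * ∑ n (f i)) (λ i → ∑ n (g i)) ⟩
    ∑ m (λ i → c * ∑ n (f i)) + rectangle m n g        ≡⟨ cong (_+ rectangle m n g) (∑-* m c (λ i → ∑ n (f i))) ⟩
    c * rectangle m n f + rectangle m n g              ∎
    where open ≡-Reasoning

  triangle-linear : ∀ n c f g →
    triangle n (λ i j → c * f i j + g i j) ≡ c * triangle n f + triangle n g
  triangle-linear n c f g = begin
    triangle n (λ i j → c * f i j + g i j)
      ≡⟨ ∑-cong n (λ k → trans (antidiagonal-+ k (λ i j → c * f i j) g) (cong (_+ antidiagonal k g) (antidiagonal-* k c f))) ⟩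
    ∑ n (λ k → c * antidiagonal k f + antidiagonal k g)
      ≡⟨ ∑-+ n (λ k → c * antidiagonal k f) (λ k → antidiagonal k g) ⟩
    ∑ n (λ k → c * antidiagonal k f) + triangle n g
      ≡⟨ cong (_+ triangle n g) (∑-* n c (λ k → antidiagonal k f)) ⟩
    c * triangle n f + triangle n g
      ∎
    where open ≡-Reasoning

  rectangle-product : ∀ m n f g → rectangle m n (λ i j → f i * g j) ≡ ∑ m f * ∑ n g
  rectangle-product m n f g = begin
    rectangle m n (λ i j → f i * g j)   ≡⟨ ∑-cong m (λ i → trans (∑-* n (f i) g) (*-comm (f i) (∑ n g))) ⟩
    ∑ m (λ i → ∑ n g * f i)             ≡⟨ ∑-* m (∑ n g) f ⟩
    ∑ n g * ∑ m f                       ≡⟨ *-comm _ _ ⟩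
    ∑ m f * ∑ n g                       ∎
    where open ≡-Reasoning

-- Absolute values and limits of sequences.

module Limits (em : ExcludedMiddle 0ℓ) (R : Reals) where

  open Analysis R
  open OrderedField em R
  open IntegerCoefficientSolver commutativeRing

  x*½+x*½≡x : ∀ x → x * ½ + x * ½ ≡ x
  x*½+x*½≡x x = ≡-by (cong (x *_) 2*½≡1)
      (solve 2 (λ x₀ x₁ → (x₀ :- (x₀ :* x₁ :+ x₀ :* x₁)) :=
            (x₀ :* :1 :- x₀ :* ((:1 :+ :1) :* x₁))) refl x ½)

  ∣-∣-swap : ∀ x y → ∣ x - y ∣ ≤ ∣ y - x ∣
  ∣-∣-swap x y = ∣x∣≤ (≤-trans (≤-reflexive
      (solve 2 (λ x₀ x₁ → (x₀ :- x₁) :=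
            (:- (x₁ :- x₀))) refl
            x y)) (-x≤∣x∣ (y - x))) (≤-trans (≤-reflexive
                (solve 2 (λ x₀ x₁ → (:- (x₀ :- x₁)) := (x₁ :- x₀)) refl x y)) (x≤∣x∣ (y - x)))

  ∣+∣ : ∀ x y → ∣ x + y ∣ ≤ ∣ x ∣ + ∣ y ∣
  ∣+∣ x y = ∣x∣≤ (x≤∣x∣ x ⊕ x≤∣x∣ y) (≤-by (-x≤∣x∣ x ⊕ -x≤∣x∣ y)
      (solve 4 (λ x₀ x₁ x₂ x₃ → (x₀ :+ x₁ :- (:- (x₂ :+ x₃))) :=
            (x₀ :+ x₁ :- ((:- x₂) :+ (:- x₃)))) refl (∣ x ∣) (∣ y ∣) x y))

  -- 2 (∣x∣∣y∣ ∓ x y) = (∣x∣ ∓ x)(∣y∣ + y) + (∣x∣ ± x)(∣y∣ - y).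
  ∣*∣ : ∀ x y → ∣ x * y ∣ ≤ ∣ x ∣ * ∣ y ∣
  ∣*∣ x y = ∣x∣≤
    (*-cancelˡ-≤ 0<2 (≤-by (*-nonNegative x⁻ y⁺ ⊕ *-nonNegative x⁺ y⁻)
        (solve 4 (λ x₀ x₁ x₂ x₃ → ((:1 :+ :1) :* (x₀ :* x₁) :- (:1 :+ :1) :* (x₂ :* x₃)) :=
              ((x₀ :- x₂) :* (x₁ :+ x₃) :+ (x₀ :+ x₂) :* (x₁ :- x₃) :- (:0 :+ :0))) refl
              (∣ x ∣) (∣ y ∣) x y)))
    (*-cancelˡ-≤ 0<2 (≤-by (*-nonNegative x⁺ y⁺ ⊕ *-nonNegative x⁻ y⁻)
        (solve 4 (λ x₀ x₁ x₂ x₃ → ((:1 :+ :1) :* (x₀ :* x₁) :- (:1 :+ :1) :* (:- (x₂ :* x₃))) :=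
              ((x₀ :+ x₂) :* (x₁ :+ x₃) :+ (x₀ :- x₂) :* (x₁ :- x₃) :- (:0 :+ :0))) refl
              (∣ x ∣) (∣ y ∣) x y)))
    where
    ⁺ : ∀ z → 0# ≤ ∣ z ∣ + z
    ⁺ z = ≤-by (-x≤∣x∣ z) (solve 2 (λ x₀ x₁ → (x₀ :+ x₁ :- :0) := (x₀ :- (:- x₁))) refl (∣ z ∣) z)
    ⁻ : ∀ z → 0# ≤ ∣ z ∣ - z
    ⁻ z = ≤-by (x≤∣x∣ z) (solve 2 (λ x₀ x₁ → (x₀ :- x₁ :- :0) := (x₀ :- x₁)) refl (∣ z ∣) z)
    x⁺ = ⁺ x
    x⁻ = ⁻ x
    y⁺ = ⁺ y
    y⁻ = ⁻ y

  minimum : ∀ x y → ∃[ m ] (m ≤ x × m ≤ y × (0# < x → 0# < y → 0# < m))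
  minimum x y with ≤-total x y
  ... | inj₁ x≤y = x , ≤-refl , x≤y , λ 0<x _ → 0<x
  ... | inj₂ y≤x = y , y≤x , ≤-refl , λ _ 0<y → 0<y

  lim-mono : ∀ {u v a b} N → (∀ n → N ℕ.≤ n → u n ≤ v n) → ConvergesTo u a → ConvergesTo v b → a ≤ b
  lim-mono {u} {v} {a} {b} N u≤v u→a v→b = ≮⇒≥ impossible
    where
    impossible : ¬ (b < a)
    impossible b<a = <⇒≱ contradictory ≤-refl
      where
      0<ε : 0# < (a - b) * ½
      0<ε = *-positive (<-by b<a (solve 2 (λ x₀ x₁ → (x₀ :- x₁ :- :0) := (x₀ :- x₁)) refl a b)) 0<½
      M₁ = proj₁ (u→a _ 0<ε)
      M₂ = proj₁ (v→b _ 0<ε)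
      n = N ℕ.+ (M₁ ℕ.+ M₂)
      N≤n : N ℕ.≤ n
      N≤n = ℕₚ.m≤m+n N _
      M₁≤n : M₁ ℕ.≤ n
      M₁≤n = ℕₚ.≤-trans (ℕₚ.m≤m+n M₁ M₂) (ℕₚ.m≤n+m _ N)
      M₂≤n : M₂ ℕ.≤ n
      M₂≤n = ℕₚ.≤-trans (ℕₚ.m≤n+m M₂ M₁) (ℕₚ.m≤n+m _ N)
      a-u<ε : a - u n < (a - b) * ½
      a-u<ε = ≤-<-trans (≤-by (-x≤∣x∣ (u n - a))
          (solve 3 (λ x₀ x₁ x₂ → (x₀ :- (x₁ :- x₂)) :=
                (x₀ :- (:- (x₂ :- x₁)))) refl (∣ u n - a ∣) a (u n))) (proj₂ (u→a _ 0<ε) n M₁≤n)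
      v-b<ε : v n - b < (a - b) * ½
      v-b<ε = ≤-<-trans (x≤∣x∣ (v n - b)) (proj₂ (v→b _ 0<ε) n M₂≤n)
      contradictory : a - b < a - b
      contradictory = ≤-<-trans (≤-by (u≤v n N≤n)
          (solve 4 (λ x₀ x₁ x₂ x₃ → (x₀ :- x₁ :+ (x₂ :- x₃) :- (x₀ :- x₃)) :=
                (x₂ :- x₁)) refl a (u n) (v n) b))
        (subst (a - u n + (v n - b) <_) (x*½+x*½≡x (a - b)) (<⇒≤ a-u<ε ⊕< v-b<ε))

  lim-unique : ∀ {u a b} → ConvergesTo u a → ConvergesTo u b → a ≡ b
  lim-unique u→a u→b = ≤-antisym (lim-mono 0 (λ _ _ → ≤-refl) u→a u→b) (lim-mono 0 (λ _ _ → ≤-refl) u→b u→a)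

  lim-const : ∀ c → ConvergesTo (λ _ → c) c
  lim-const c ε 0<ε = 0 , λ n _ → ∣x∣< (<-by 0<ε
      (solve 2 (λ x₀ x₁ → (x₀ :- (x₁ :- x₁)) :=
            (x₀ :- :0)) refl
            ε c)) (<-by 0<ε (solve 2 (λ x₀ x₁ → (x₀ :- (:- (x₁ :- x₁))) := (x₀ :- :0)) refl ε c))

  lim-- : ∀ {u v a b} → ConvergesTo u a → ConvergesTo v b → ConvergesTo (λ n → u n - v n) (a - b)
  lim-- {u} {v} {a} {b} u→a v→b ε 0<ε = M ℕ.+ N , λ n M+N≤n →
    subst (∣ u n - v n - (a - b) ∣ <_) (x*½+x*½≡x ε)
      (≤-<-trans (subst (λ z → ∣ z ∣ ≤ ∣ u n - a ∣ + ∣ b - v n ∣)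
          (solve 4 (λ x₀ x₁ x₂ x₃ → (x₀ :- x₁ :+ (x₂ :- x₃)) :=
                (x₀ :- x₃ :- (x₁ :- x₂))) refl (u n) a b (v n)) (∣+∣ (u n - a) (b - v n)))
        (<⇒≤ (proj₂ (u→a _ 0<ε½) n (ℕₚ.≤-trans (ℕₚ.m≤m+n M N) M+N≤n)) ⊕<
         ≤-<-trans (∣-∣-swap b (v n)) (proj₂ (v→b _ 0<ε½) n (ℕₚ.≤-trans (ℕₚ.m≤n+m N M) M+N≤n))))
    where
    0<ε½ : 0# < ε * ½
    0<ε½ = *-positive 0<ε 0<½
    M = proj₁ (u→a _ 0<ε½)
    N = proj₁ (v→b _ 0<ε½)

  -- u v - a b = (u - a)(v - b) + a (v - b) + b (u - a).
  lim-* : ∀ {u v a b} → ConvergesTo u a → ConvergesTo v b → ConvergesTo (λ n → u n * v n) (a * b)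
  lim-* {u} {v} {a} {b} u→a v→b ε 0<ε = close (minimum 1# (ε / c))
    where
    -- As δ is at most 1, the quadratic term `du * dv` is at most `du`, so the three terms together
    -- stay below c δ, and c δ is at most ε.
    c = 1# + ∣ a ∣ + ∣ b ∣
    0<c : 0# < c
    0<c = <-by (0≤∣x∣ a ⊕ 0≤∣x∣ b ⊕< 0<1)
        (solve 2 (λ x₀ x₁ → (:1 :+ x₀ :+ x₁ :- :0) :=
              (x₀ :+ x₁ :+ :1 :- (:0 :+ :0 :+ :0))) refl (∣ a ∣) (∣ b ∣))
    close : ∃[ m ] (m ≤ 1# × m ≤ ε / c × (0# < 1# → 0# < ε / c → 0# < m)) →
            ∃[ N ] ∀ n → N ℕ.≤ n → ∣ u n * v n - a * b ∣ < ε
    close (δ , δ≤1 , δ≤ε/c , δ-positive) = M ℕ.+ N , bound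
      where
      0<δ : 0# < δ
      0<δ = δ-positive 0<1 (*-positive 0<ε (⁻¹-positive 0<c))
      M = proj₁ (u→a δ 0<δ)
      N = proj₁ (v→b δ 0<δ)
      bound : ∀ n → M ℕ.+ N ℕ.≤ n → ∣ u n * v n - a * b ∣ < ε
      bound n M+N≤n = ≤-<-trans split (<-≤-trans strict (subst (c * δ ≤_) (y*[x/y]≡x 0<c) (<⇒≤ 0<c ⊗ δ≤ε/c)))
        where
        du = ∣ u n - a ∣
        dv = ∣ v n - b ∣
        du<δ : du < δ
        du<δ = proj₂ (u→a δ 0<δ) n (ℕₚ.≤-trans (ℕₚ.m≤m+n M N) M+N≤n)
        dv<δ : dv < δ
        dv<δ = proj₂ (v→b δ 0<δ) n (ℕₚ.≤-trans (ℕₚ.m≤n+m N M) M+N≤n)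
        split : ∣ u n * v n - a * b ∣ ≤ du * dv + ∣ a ∣ * dv + ∣ b ∣ * du
        split = subst (λ z → ∣ z ∣ ≤ du * dv + ∣ a ∣ * dv + ∣ b ∣ * du)
            (solve 4 (λ x₀ x₁ x₂ x₃ → ((x₀ :- x₁) :* (x₂ :- x₃) :+ x₁ :* (x₂ :- x₃) :+ x₃ :* (x₀ :- x₁)) :=
                  (x₀ :* x₂ :- x₁ :* x₃)) refl (u n) a (v n) b)
          (≤-trans (∣+∣ _ (b * (u n - a))) (≤-trans (∣+∣ ((u n - a) * (v n - b)) (a * (v n - b))) (∣*∣ _ _ ⊕ ∣*∣ _ _) ⊕ ∣*∣ b (u n - a)))
        strict : du * dv + ∣ a ∣ * dv + ∣ b ∣ * du < c * δ
        strict = <-by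
          (0≤∣x∣ (u n - a) ⊗ ≤-trans (<⇒≤ dv<δ) δ≤1 ⊕ 0≤∣x∣ a ⊗ <⇒≤ dv<δ ⊕ 0≤∣x∣ b ⊗ <⇒≤ du<δ ⊕< du<δ)
              (solve 5 (λ x₀ x₁ x₂ x₃ x₄ → ((:1 :+ x₀ :+ x₁) :* x₂ :- (x₃ :* x₄ :+ x₀ :* x₄ :+ x₁ :* x₃)) :=
                    (x₃ :* :1 :+ x₀ :* x₂ :+ x₁ :* x₂ :+ x₂ :- (x₃ :* x₄ :+ x₀ :* x₄ :+ x₁ :* x₃ :+ x₃))) refl
                    (∣ a ∣) (∣ b ∣) δ du dv)

  lim-subsequence : ∀ {u a} (φ : ℕ → ℕ) → (∀ n → n ℕ.≤ φ n) → ConvergesTo u a → ConvergesTo (λ n → u (φ n)) a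
  lim-subsequence φ n≤φn u→a ε 0<ε = proj₁ (u→a ε 0<ε) , λ n N≤n →
    proj₂ (u→a ε 0<ε) (φ n) (ℕₚ.≤-trans N≤n (n≤φn n))

  lim-squeeze : ∀ {u v} → (∀ n → ∣ u n ∣ ≤ v n) → ConvergesTo v 0# → ConvergesTo u 0#
  lim-squeeze {u} {v} ∣u∣≤v v→0 ε 0<ε = proj₁ (v→0 ε 0<ε) , λ n N≤n → ≤-<-trans
    (subst (λ z → ∣ z ∣ ≤ ∣ v n - 0# ∣)
        (solve 1 (λ x₀ → (x₀) :=
              (x₀ :- :0)) refl
              (u n)) (≤-trans (∣u∣≤v n) (≤-trans (≤-reflexive
                  (solve 1 (λ x₀ → (x₀) := (x₀ :- :0)) refl (v n))) (x≤∣x∣ (v n - 0#)))))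
    (proj₂ (v→0 ε 0<ε) n N≤n)

  -- Some term exceeds sup - ε, since otherwise sup - ε would be an upper bound; monotonicity keeps
  -- all later terms there.
  monotone-bounded⇒convergent : ∀ {u c} → (∀ n → u n ≤ u (suc n)) → (∀ n → u n ≤ c) → ∃ (ConvergesTo u)
  monotone-bounded⇒convergent {u} {c} increasing u≤c = sup IsTerm , converges
    where
    IsTerm : ℝ → Set
    IsTerm r = ∃[ n ] r ≡ u n
    nonempty : ∃ IsTerm
    nonempty = u 0 , 0 , refl
    bounded : ∃ (UpperBound IsTerm)
    bounded = c , λ { _ (n , refl) → u≤c n }
    mono : ∀ {m n} → m ℕ.≤′ n → u m ≤ u n
    mono ℕ.≤′-refl       = ≤-refl
    mono (ℕ.≤′-step m≤n) = ≤-trans (mono m≤n) (increasing _)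
    u≤sup : ∀ n → u n ≤ sup IsTerm
    u≤sup n = sup-upper IsTerm nonempty bounded (u n) (n , refl)
    converges : ConvergesTo u (sup IsTerm)
    converges ε 0<ε with em {P = ∃[ N ] sup IsTerm - ε < u N}
    ... | yes (N , close) = N , λ n N≤n → ∣x∣<
      (≤-<-trans (≤-by {u n - sup IsTerm} {0#} (u≤sup n)
          (solve 2 (λ x₀ x₁ → (:0 :- (x₀ :- x₁)) := (x₁ :- x₀)) refl (u n) (sup IsTerm))) 0<ε)
      (<-by { - (u n - sup IsTerm)} {ε} (<-≤-trans close (mono (ℕₚ.≤⇒≤′ N≤n)))
          (solve 3 (λ x₀ x₁ x₂ → (x₀ :- (:- (x₁ :- x₂))) :=
                (x₁ :- (x₂ :+ (:- x₀)))) refl ε (u n) (sup IsTerm)))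
    ... | no ¬close = contradiction
      (sup-least IsTerm nonempty bounded (sup IsTerm - ε) (λ { _ (n , refl) → ≮⇒≥ (λ close → ¬close (n , close)) }))
      (<⇒≱ (<-by 0<ε (solve 2 (λ x₀ x₁ → (x₀ :- (x₀ :- x₁)) := (x₁ :- :0)) refl (sup IsTerm) ε)))

-- The exponential series.

module Exponential (em : ExcludedMiddle 0ℓ) (R : Reals) where

  open Analysis R
  open OrderedField em R
  open FiniteSums em R
  open Limits em R
  open IntegerCoefficientSolver commutativeRing
  open CommutativeRing commutativeRing using (*-assoc)

  term : ℝ → ℕ → ℝ
  term x k = x ^ℕ k / fromℕ (k !)

  partialExp : ℝ → ℕ → ℝ
  partialExp x n = ∑ n (term x)

  0<k! : ∀ k → 0# < fromℕ (k !)
  0<k! k = 0<fromℕ (ℕₚ.1≤n! k)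

  -- The recurrence behind the halving of late terms, the binomial theorem and the comparison with a
  -- geometric series.
  term-suc : ∀ x k → fromℕ (suc k) * term x (suc k) ≡ x * term x k
  term-suc x k = *-cancelˡ-≡ (0<k! k) (begin
    f * (s * (x * p * r))
        ≡⟨ solve 5 (λ x₀ x₁ x₂ x₃ x₄ → (x₀ :* (x₁ :* (x₂ :* x₃ :* x₄))) :=
              (x₂ :* x₃ :* (x₁ :* x₀ :* x₄))) refl f s x p r ⟩
    x * p * (s * f * r)       ≡⟨ cong (λ z → x * p * (z * r)) (fromℕ-* (suc k) (k !)) ⟨
    x * p * (f′ * r)          ≡⟨ cong (x * p *_) (x*x⁻¹≡1 (0<k! (suc k))) ⟩
    x * p * 1#                ≡⟨ cong (x * p *_) (x*x⁻¹≡1 (0<k! k)) ⟨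
    x * p * (f * f ⁻¹)
        ≡⟨ solve 4 (λ x₀ x₁ x₂ x₃ → (x₀ :* x₁ :* (x₂ :* x₃)) :=
              (x₂ :* (x₀ :* (x₁ :* x₃)))) refl x p f (f ⁻¹) ⟩
    f * (x * (p * f ⁻¹))      ∎)
    where
    open ≡-Reasoning
    f = fromℕ (k !)
    f′ = fromℕ (suc k !)
    s = fromℕ (suc k)
    p = x ^ℕ k
    r = f′ ⁻¹

  ∣^∣ : ∀ x k → ∣ x ^ℕ k ∣ ≤ ∣ x ∣ ^ℕ k
  ∣^∣ x zero    = ∣x∣≤ ≤-refl (≤-by (0≤1 ⊕ 0≤1)
      (solve 0 ((:1 :- (:- :1)) := (:1 :+ :1 :- (:0 :+ :0))) refl))
  ∣^∣ x (suc k) = ≤-trans (∣*∣ x (x ^ℕ k)) (0≤∣x∣ x ⊗ ∣^∣ x k)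

  term-nonNegative : ∀ {x} → 0# ≤ x → ∀ k → 0# ≤ term x k
  term-nonNegative {x} 0≤x k = *-nonNegative (power k) (<⇒≤ (⁻¹-positive (0<k! k)))
    where
    power : ∀ k → 0# ≤ x ^ℕ k
    power zero    = 0≤1
    power (suc k) = *-nonNegative 0≤x (power k)

  term≤ : ∀ x k → term x k ≤ term ∣ x ∣ k
  term≤ x k = ≤-by (<⇒≤ (⁻¹-positive (0<k! k)) ⊗ ≤-trans (x≤∣x∣ (x ^ℕ k)) (∣^∣ x k))
      (solve 3 (λ x₀ x₁ x₂ → (x₀ :* x₁ :- x₂ :* x₁) :=
            (x₁ :* x₀ :- x₁ :* x₂)) refl ((∣ x ∣) ^ℕ k) ((fromℕ (k !)) ⁻¹) (x ^ℕ k))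

  -term≤ : ∀ x k → - term x k ≤ term ∣ x ∣ k
  -term≤ x k = ≤-by (<⇒≤ (⁻¹-positive (0<k! k)) ⊗ ≤-trans (-x≤∣x∣ (x ^ℕ k)) (∣^∣ x k))
      (solve 3 (λ x₀ x₁ x₂ → (x₀ :* x₁ :- (:- (x₂ :* x₁))) :=
            (x₁ :* x₀ :- x₁ :* (:- x₂))) refl ((∣ x ∣) ^ℕ k) ((fromℕ (k !)) ⁻¹) (x ^ℕ k))

  -- Once n exceeds 2 x the terms at least halve, so partialExp x n + 2 term x n decreases.
  partialExp-bounded : ∀ x → 0# ≤ x → ∃[ c ] ∀ n → partialExp x n ≤ c
  partialExp-bounded x 0≤x = bound N , λ n → ≤-trans
    (∑-mono-length (term-nonNegative 0≤x) (ℕₚ.m≤n+m n N))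
    (≤-trans (≤-by {a = partialExp x (N ℕ.+ n)} {b = bound (N ℕ.+ n)} (<⇒≤ 0<2 ⊗ term-nonNegative 0≤x (N ℕ.+ n))
        (solve 2 (λ x₀ x₁ → (x₀ :+ (:1 :+ :1) :* x₁ :- x₀) :=
              ((:1 :+ :1) :* x₁ :- (:1 :+ :1) :* :0)) refl
              (partialExp x (N ℕ.+ n)) (term x (N ℕ.+ n)))) (decreasing n))
    where
    N = proj₁ (archimedean (2# * x))
    bound : ℕ → ℝ
    bound n = partialExp x n + 2# * term x n
    halving : ∀ n → 2# * term x (suc (N ℕ.+ n)) ≤ term x (N ℕ.+ n)
    halving n = *-cancelˡ-≤ (0<fromℕ {suc (N ℕ.+ n)} (s≤s z≤n)) (begin
      s * (2# * t′)
          ≡⟨ solve 2 (λ x₀ x₁ → (x₀ :* ((:1 :+ :1) :* x₁)) :=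
                ((:1 :+ :1) :* (x₀ :* x₁))) refl s t′ ⟩
      2# * (s * t′)       ≡⟨ cong (2# *_) (term-suc x (N ℕ.+ n)) ⟩
      2# * (x * t)
          ≡⟨ solve 2 (λ x₀ x₁ → ((:1 :+ :1) :* (x₀ :* x₁)) := (x₁ :* ((:1 :+ :1) :* x₀))) refl x t ⟩
      t * (2# * x)        ≤⟨ term-nonNegative 0≤x (N ℕ.+ n) ⊗ 2x≤s ⟩
      t * s               ≡⟨ solve 2 (λ x₀ x₁ → (x₀ :* x₁) := (x₁ :* x₀)) refl t s ⟩
      s * t               ∎)
      where
      open ≤-Reasoning
      s = fromℕ (suc (N ℕ.+ n))
      t = term x (N ℕ.+ n)
      t′ = term x (suc (N ℕ.+ n))
      2x≤s : 2# * x ≤ s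
      2x≤s = ≤-trans (<⇒≤ (proj₂ (archimedean (2# * x)))) (fromℕ-mono-≤ (ℕₚ.≤-trans (ℕₚ.m≤m+n N n) (ℕₚ.n≤1+n _)))
    decreasing : ∀ n → bound (N ℕ.+ n) ≤ bound N
    decreasing zero    = ≤-reflexive (cong bound (ℕₚ.+-identityʳ N))
    decreasing (suc n) = ≤-trans (≤-reflexive (cong bound (ℕₚ.+-suc N n))) (≤-trans step (decreasing n))
      where
      step : bound (suc (N ℕ.+ n)) ≤ bound (N ℕ.+ n)
      step = subst (λ z → z + 2# * term x (suc (N ℕ.+ n)) ≤ bound (N ℕ.+ n)) (sym (∑-last (N ℕ.+ n) (term x)))
        (≤-by (halving n)
            (solve 3 (λ x₀ x₁ x₂ → (x₀ :+ (:1 :+ :1) :* x₁ :- (x₀ :+ x₁ :+ (:1 :+ :1) :* x₂)) :=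
                  (x₁ :- (:1 :+ :1) :* x₂)) refl
                  (partialExp x (N ℕ.+ n)) (term x (N ℕ.+ n)) (term x (suc (N ℕ.+ n)))))

  -- partialExp x n = ∑ (term x k + term ∣ x ∣ k) - ∑ term ∣ x ∣ k, a difference of two increasing sequences.
  partialExp-converges : ∀ x → ∃ (ConvergesTo (partialExp x))
  partialExp-converges x =
    proj₁ v-converges - proj₁ w-converges ,
    subst-lim (λ n →
        (solve 2 (λ x₀ x₁ → (x₀ :+ x₁ :- x₁) :=
              (x₀)) refl
              (partialExp x n) (partialExp (∣ x ∣) n))) (lim-- (proj₂ v-converges) (proj₂ w-converges))
    where
    subst-lim : ∀ {u u′ a} → (∀ n → u n ≡ u′ n) → ConvergesTo u a → ConvergesTo u′ a
    subst-lim {a = a} u≡u′ u→a ε 0<ε = proj₁ (u→a ε 0<ε) , λ n N≤n →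
      subst (λ z → ∣ z - a ∣ < ε) (u≡u′ n) (proj₂ (u→a ε 0<ε) n N≤n)
    w v : ℕ → ℝ
    w n = partialExp ∣ x ∣ n
    v n = partialExp x n + w n
    w-bounded = partialExp-bounded ∣ x ∣ (0≤∣x∣ x)
    w-increasing : ∀ n → w n ≤ w (suc n)
    w-increasing n = ∑-mono-length (term-nonNegative (0≤∣x∣ x)) (ℕₚ.n≤1+n n)
    w-converges : ∃ (ConvergesTo w)
    w-converges = monotone-bounded⇒convergent w-increasing (proj₂ w-bounded)
    v-increasing : ∀ n → v n ≤ v (suc n)
    v-increasing n = subst₂ (λ y z → v n ≤ y + z) (sym (∑-last n (term x))) (sym (∑-last n (term ∣ x ∣)))
      (≤-by (-term≤ x n)
          (solve 4 (λ x₀ x₁ x₂ x₃ → (x₀ :+ x₁ :+ (x₂ :+ x₃) :- (x₀ :+ x₂)) :=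
                (x₃ :- (:- x₁))) refl
                (∑ n (term x)) (term x n) (∑ n (term ∣ x ∣)) (term (∣ x ∣) n)))
    v-bounded : ∀ n → v n ≤ proj₁ w-bounded + proj₁ w-bounded
    v-bounded n = ≤-trans (∑-mono n (λ i _ → term≤ x i)) (proj₂ w-bounded n) ⊕ proj₂ w-bounded n
    v-converges : ∃ (ConvergesTo v)
    v-converges = monotone-bounded⇒convergent v-increasing v-bounded

  exp-converges : ∀ x → ConvergesTo (partialExp x) (exp x)
  exp-converges x = subst (ConvergesTo (partialExp x))
    (sym (sup-singleton (ConvergesTo (partialExp x)) (proj₂ (partialExp-converges x))
      (λ L u→L → lim-unique u→L (proj₂ (partialExp-converges x)))))
    (proj₂ (partialExp-converges x))

  -- The binomial theorem without binomial coefficients: after multiplication by n + 1 = i + j, each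
  -- factor i or j lowers the index of one term by `term-suc` and brings out x or y.
  term-+ : ∀ x y n → antidiagonal n (λ i j → term x i * term y j) ≡ term (x + y) n
  term-+ x y zero    = begin
    1# * f * (1# * f)      ≡⟨ solve 1 (λ x₀ → (:1 :* x₀ :* (:1 :* x₀)) := (:1 :* x₀ :* x₀)) refl f ⟩
    1# * f * f             ≡⟨ cong (λ z → 1# * f * z) f≡1 ⟩
    1# * f * 1#            ≡⟨ solve 1 (λ x₀ → (:1 :* x₀ :* :1) := (:1 :* x₀)) refl f ⟩
    1# * f                 ∎
    where
    open ≡-Reasoning
    f = fromℕ 1 ⁻¹
    f≡1 : f ≡ 1#
    f≡1 = begin
      f                    ≡⟨ solve 1 (λ x₀ → (x₀) := ((:1 :+ :0) :* x₀)) refl ((1# + 0#) ⁻¹) ⟩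
      fromℕ 1 * f          ≡⟨ x*x⁻¹≡1 (0<fromℕ {1} (s≤s z≤n)) ⟩
      1#                   ∎
  term-+ x y (suc n) = *-cancelˡ-≡ (0<fromℕ {suc n} (s≤s z≤n)) (begin
    fromℕ (suc n) * antidiagonal (suc n) p                        ≡⟨ antidiagonal-* (suc n) (fromℕ (suc n)) p ⟨
    antidiagonal (suc n) (λ i j → fromℕ (suc n) * p i j)          ≡⟨ antidiagonal-cong (suc n) split ⟩
    antidiagonal (suc n) (λ i j → fromℕ i * p i j + fromℕ j * p i j)
      ≡⟨ antidiagonal-+ (suc n) (λ i j → fromℕ i * p i j) (λ i j → fromℕ j * p i j) ⟩
    antidiagonal (suc n) (λ i j → fromℕ i * p i j) + antidiagonal (suc n) (λ i j → fromℕ j * p i j)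
      ≡⟨ cong₂ _+_ left right ⟩
    x * antidiagonal n p + y * antidiagonal n p
        ≡⟨ solve 3 (λ x₀ x₁ x₂ → (x₀ :* x₁ :+ x₂ :* x₁) :=
              ((x₀ :+ x₂) :* x₁)) refl x (antidiagonal n p) y ⟩
    (x + y) * antidiagonal n p                                    ≡⟨ cong ((x + y) *_) (term-+ x y n) ⟩
    (x + y) * term (x + y) n                                      ≡⟨ term-suc (x + y) n ⟨
    fromℕ (suc n) * term (x + y) (suc n)                          ∎)
    where
    open ≡-Reasoning
    p : ℕ → ℕ → ℝ
    p i j = term x i * term y j
    split : ∀ i j → i ℕ.+ j ≡ suc n → fromℕ (suc n) * p i j ≡ fromℕ i * p i j + fromℕ j * p i j
    split i j i+j≡1+n = begin
      fromℕ (suc n) * p i j             ≡⟨ cong (λ k → fromℕ k * p i j) i+j≡1+n ⟨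
      fromℕ (i ℕ.+ j) * p i j           ≡⟨ cong (_* p i j) (fromℕ-+ i j) ⟩
      (fromℕ i + fromℕ j) * p i j
          ≡⟨ solve 3 (λ x₀ x₁ x₂ → ((x₀ :+ x₁) :* x₂) :=
                (x₀ :* x₂ :+ x₁ :* x₂)) refl (fromℕ i) (fromℕ j) (p i j) ⟩
      fromℕ i * p i j + fromℕ j * p i j ∎
    left : antidiagonal (suc n) (λ i j → fromℕ i * p i j) ≡ x * antidiagonal n p
    left = begin
      0# * p 0 (suc n) + antidiagonal n (λ i j → fromℕ (suc i) * p (suc i) j)
          ≡⟨ solve 2 (λ x₀ x₁ → (:0 :* x₀ :+ x₁) :=
                (x₁)) refl (p 0 (suc n)) (antidiagonal n (λ i j → fromℕ (suc i) * p (suc i) j)) ⟩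
      antidiagonal n (λ i j → fromℕ (suc i) * p (suc i) j)   ≡⟨ antidiagonal-cong n (λ i j _ → step i j) ⟩
      antidiagonal n (λ i j → x * p i j)                     ≡⟨ antidiagonal-* n x p ⟩
      x * antidiagonal n p                                   ∎
      where
      step : ∀ i j → fromℕ (suc i) * p (suc i) j ≡ x * p i j
      step i j = begin
        fromℕ (suc i) * (term x (suc i) * term y j)   ≡⟨ *-assoc _ _ _ ⟨
        fromℕ (suc i) * term x (suc i) * term y j     ≡⟨ cong (_* term y j) (term-suc x i) ⟩
        x * term x i * term y j                       ≡⟨ *-assoc _ _ _ ⟩
        x * (term x i * term y j)                     ∎
    right : antidiagonal (suc n) (λ i j → fromℕ j * p i j) ≡ y * antidiagonal n p
    right = begin
      antidiagonal (suc n) (λ i j → fromℕ j * p i j)         ≡⟨ antidiagonal-last n (λ i j → fromℕ j * p i j) ⟩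
      antidiagonal n (λ i j → fromℕ (suc j) * p i (suc j)) + 0# * p (suc n) 0
          ≡⟨ solve 2 (λ x₀ x₁ → (x₀ :+ :0 :* x₁) :=
                (x₀)) refl (antidiagonal n (λ i j → fromℕ (suc j) * p i (suc j))) (p (suc n) 0) ⟩
      antidiagonal n (λ i j → fromℕ (suc j) * p i (suc j))   ≡⟨ antidiagonal-cong n (λ i j _ → step i j) ⟩
      antidiagonal n (λ i j → y * p i j)                     ≡⟨ antidiagonal-* n y p ⟩
      y * antidiagonal n p                                   ∎
      where
      step : ∀ i j → fromℕ (suc j) * p i (suc j) ≡ y * p i j
      step i j = begin
        fromℕ (suc j) * (term x i * term y (suc j))
            ≡⟨ solve 3 (λ x₀ x₁ x₂ → ((:1 :+ x₀) :* (x₁ :* x₂)) :=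
                  (x₁ :* ((:1 :+ x₀) :* x₂))) refl (fromℕ j) (term x i) (term y (suc j)) ⟩
        term x i * (fromℕ (suc j) * term y (suc j))   ≡⟨ cong (term x i *_) (term-suc y j) ⟩
        term x i * (y * term y j)
            ≡⟨ solve 3 (λ x₀ x₁ x₂ → (x₀ :* (x₁ :* x₂)) :=
                  (x₁ :* (x₀ :* x₂))) refl (term x i) y (term y j) ⟩
        y * (term x i * term y j)                     ∎

-- The functional equation, 1 + x ≤ exp x, and intermediate values.

module ExponentialLaws (em : ExcludedMiddle 0ℓ) (R : Reals) where

  open Analysis R
  open OrderedField em R
  open FiniteSums em R
  open Limits em R
  open Exponential em R
  open IntegerCoefficientSolver commutativeRing
  open CommutativeRing commutativeRing using (+-identityˡ; +-identityʳ; -‿inverseʳ)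

  -- The Cauchy product: partialExp x n * partialExp y n and partialExp (x + y) n are the sums of
  -- term x i * term y j over a square and a triangle, and passing to absolute values only
  -- increases their difference, which is then a Cauchy difference of partialExp (∣ x ∣ + ∣ y ∣).
  partialExp-product : ∀ x y n →
    ∣ partialExp x n * partialExp y n - partialExp (x + y) n ∣ ≤
    partialExp (∣ x ∣ + ∣ y ∣) (n ℕ.+ n) - partialExp (∣ x ∣ + ∣ y ∣) n
  partialExp-product x y n = ∣x∣≤
    (subst₂ (λ s t → s - t ≤ S (n ℕ.+ n) - S n) (rect x y) (tri x y n) (≤-by (difference (- 1#) p≤q ⊕ q-bound)
        (solve 6 (λ x₀ x₁ x₂ x₃ x₄ x₅ → (x₀ :- x₁ :- (x₂ :- x₃)) :=
              ((:- :1) :* x₂ :+ x₄ :+ (x₀ :- x₁) :- ((:- :1) :* x₃ :+ x₅ :+ (x₄ :- x₅)))) refl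
              (S (n ℕ.+ n)) (S n) (rectangle n n (λ i j → term x i * term y j)) (triangle n (λ i j → term x i * term y j)) (rectangle n n q) (triangle n q))))
    (subst₂ (λ s t → - (s - t) ≤ S (n ℕ.+ n) - S n) (rect x y) (tri x y n) (≤-by (difference 1# -p≤q ⊕ q-bound)
        (solve 6 (λ x₀ x₁ x₂ x₃ x₄ x₅ → (x₀ :- x₁ :- (:- (x₂ :- x₃))) :=
              (:1 :* x₂ :+ x₄ :+ (x₀ :- x₁) :- (:1 :* x₃ :+ x₅ :+ (x₄ :- x₅)))) refl
              (S (n ℕ.+ n)) (S n) (rectangle n n (λ i j → term x i * term y j)) (triangle n (λ i j → term x i * term y j)) (rectangle n n q) (triangle n q))))
    where
    S = partialExp (∣ x ∣ + ∣ y ∣)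
    p q : ℕ → ℕ → ℝ
    p i j = term x i * term y j
    q i j = (term ∣ x ∣ i) * (term ∣ y ∣ j)
    ∣p∣≤q : ∀ i j → ∣ p i j ∣ ≤ q i j
    ∣p∣≤q i j = ≤-trans (∣*∣ (term x i) (term y j))
      (*-mono-≤ (0≤∣x∣ _) (term-nonNegative (0≤∣x∣ y) j) (∣x∣≤ (term≤ x i) (-term≤ x i)) (∣x∣≤ (term≤ y j) (-term≤ y j)))
    p≤q : ∀ i j → 0# ≤ - 1# * p i j + q i j
    p≤q i j = ≤-by (≤-trans (x≤∣x∣ (p i j)) (∣p∣≤q i j))
        (solve 2 (λ x₀ x₁ → ((:- :1) :* x₀ :+ x₁ :- :0) := (x₁ :- x₀)) refl (p i j) (q i j))
    -p≤q : ∀ i j → 0# ≤ 1# * p i j + q i j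
    -p≤q i j = ≤-by (≤-trans (-x≤∣x∣ (p i j)) (∣p∣≤q i j))
        (solve 2 (λ x₀ x₁ → (:1 :* x₀ :+ x₁ :- :0) := (x₁ :- (:- x₀))) refl (p i j) (q i j))
    q-nonNegative : ∀ i j → 0# ≤ q i j
    q-nonNegative i j = *-nonNegative (term-nonNegative (0≤∣x∣ x) i) (term-nonNegative (0≤∣x∣ y) j)
    rect : ∀ x y → rectangle n n (λ i j → term x i * term y j) ≡ partialExp x n * partialExp y n
    rect x y = rectangle-product n n (term x) (term y)
    tri : ∀ x y n → triangle n (λ i j → term x i * term y j) ≡ partialExp (x + y) n
    tri x y n = ∑-cong n (term-+ x y)
    -- As c p + q is nonnegative for c = -1 and c = 1, its sum over the triangle is at most its sum
    -- over the square. The two signs bound both signs of the difference for p by the difference for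
    -- q.
    difference : ∀ c → (∀ i j → 0# ≤ c * p i j + q i j) →
      c * triangle n p + triangle n q ≤ c * rectangle n n p + rectangle n n q
    difference c 0≤cp+q = subst₂ _≤_ (triangle-linear n c p q) (rectangle-linear n n c p q)
      (triangle≤rectangle {n} {n} 0≤cp+q ℕₚ.≤-refl)
    -- The n by n square lies inside the triangle of size n + n, whose sum is a partial sum of the
    -- exponential series.
    q-bound : rectangle n n q - triangle n q ≤ S (n ℕ.+ n) - S n
    q-bound = subst₂ (λ s t → rectangle n n q - s ≤ t - S n) (sym (tri ∣ x ∣ ∣ y ∣ n)) (tri ∣ x ∣ ∣ y ∣ (n ℕ.+ n))
      (+-monoˡ-≤ (- S n) (rectangle≤triangle n n q-nonNegative))

  -- The bound in `partialExp-product` tends to 0, being the difference of a convergent sequence and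
  -- its subsequence at n + n.
  exp-+ : ∀ x y → exp (x + y) ≡ exp x * exp y
  exp-+ x y = ≡-by
    (lim-unique
      (lim-squeeze (partialExp-product x y) (subst (ConvergesTo (λ n → partialExp (∣ x ∣ + ∣ y ∣) (n ℕ.+ n) - partialExp (∣ x ∣ + ∣ y ∣) n)) (-‿inverseʳ (exp (∣ x ∣ + ∣ y ∣)))
        (lim-- (lim-subsequence {partialExp (∣ x ∣ + ∣ y ∣)} (λ n → n ℕ.+ n) (λ n → ℕₚ.m≤m+n n n) (exp-converges (∣ x ∣ + ∣ y ∣))) (exp-converges (∣ x ∣ + ∣ y ∣)))))
      (lim-- (lim-* (exp-converges x) (exp-converges y)) (exp-converges (x + y))))
    (solve 3 (λ x₀ x₁ x₂ → (x₀ :* x₁ :- x₂) :=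
          (x₀ :* x₁ :- x₂ :- :0)) refl (exp x) (exp y) (exp (x + y)))

  term-0 : ∀ x → term x 0 ≡ 1#
  term-0 x = trans (cong (_* fromℕ 1 ⁻¹) (sym (+-identityʳ 1#))) (x*x⁻¹≡1 (0<fromℕ {1} (s≤s z≤n)))

  term-1 : ∀ x → term x 1 ≡ x
  term-1 x = begin
    term x 1              ≡⟨ solve 1 (λ x₀ → (x₀) := ((:1 :+ :0) :* x₀)) refl (term x 1) ⟩
    fromℕ 1 * term x 1    ≡⟨ term-suc x 0 ⟩
    x * term x 0          ≡⟨ cong (x *_) (term-0 x) ⟩
    x * 1#                ≡⟨ solve 1 (λ x₀ → (x₀ :* :1) := (x₀)) refl x ⟩
    x                     ∎
    where open ≡-Reasoning

  1+x≤exp-nonNegative : ∀ {x} → 0# ≤ x → 1# + x ≤ exp x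
  1+x≤exp-nonNegative {x} 0≤x = lim-mono 2 first-two (lim-const (1# + x)) (exp-converges x)
    where
    first-two : ∀ n → 2 ℕ.≤ n → 1# + x ≤ partialExp x n
    first-two n 2≤n = subst (_≤ partialExp x n)
      (cong₂ _+_ (term-0 x) (trans (+-identityʳ _) (term-1 x))) (∑-mono-length (term-nonNegative 0≤x) 2≤n)

  exp-0 : exp 0# ≡ 1#
  exp-0 = *-cancelˡ-≡ {exp 0#} (<-≤-trans 0<1 1≤exp0) (begin
    exp 0# * exp 0#     ≡⟨ exp-+ 0# 0# ⟨
    exp (0# + 0#)       ≡⟨ cong exp (+-identityˡ 0#) ⟩
    exp 0#              ≡⟨ solve 1 (λ x₀ → (x₀) := (x₀ :* :1)) refl (exp 0#) ⟩
    exp 0# * 1#         ∎)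
    where
    open ≡-Reasoning
    1≤exp0 : 1# ≤ exp 0#
    1≤exp0 = subst (_≤ exp 0#) (+-identityʳ 1#) (1+x≤exp-nonNegative ≤-refl)

  exp-inverse : ∀ x → exp x * exp (- x) ≡ 1#
  exp-inverse x = trans (sym (exp-+ x (- x))) (trans (cong exp (-‿inverseʳ x)) exp-0)

  exp-half : ∀ x → exp (x * ½) * exp (x * ½) ≡ exp x
  exp-half x = trans (sym (exp-+ (x * ½) (x * ½))) (cong exp (x*½+x*½≡x x))

  -- A square, hence nonnegative, and invertible, hence nonzero.
  exp-positive : ∀ x → 0# < exp x
  exp-positive x = subst (0# ≤_) (exp-half x) (square-nonNegative (exp (x * ½))) , λ 0≡exp →
    0≢1 (begin
      0#                 ≡⟨ solve 1 (λ x₀ → (:0) := (:0 :* x₀)) refl (exp (- x)) ⟩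
      0# * exp (- x)     ≡⟨ cong (_* exp (- x)) 0≡exp ⟩
      exp x * exp (- x)  ≡⟨ exp-inverse x ⟩
      1#                 ∎)
    where open ≡-Reasoning

  -- The partial sums are below those of the geometric series.
  partialExp-geometric : ∀ {u} → 0# ≤ u → ∀ n → partialExp u (suc n) * (1# - u) ≤ 1# - fromℕ (suc n) * term u (suc n)
  partialExp-geometric {u} 0≤u zero = ≤-reflexive (begin
    (term u 0 + 0#) * (1# - u)       ≡⟨ cong (λ z → (z + 0#) * (1# - u)) (term-0 u) ⟩
    (1# + 0#) * (1# - u)
        ≡⟨ solve 1 (λ x₀ → ((:1 :+ :0) :* (:1 :- x₀)) := (:1 :- x₀ :* :1)) refl u ⟩
    1# - u * 1#                      ≡⟨ cong (λ z → 1# - u * z) (term-0 u) ⟨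
    1# - u * term u 0                ≡⟨ cong (λ z → 1# - z) (term-suc u 0) ⟨
    1# - fromℕ 1 * term u 1          ∎)
    where open ≡-Reasoning
  partialExp-geometric {u} 0≤u (suc n) = begin
    partialExp u (suc (suc n)) * (1# - u)             ≡⟨ cong (_* (1# - u)) (∑-last (suc n) (term u)) ⟩
    (S + t) * (1# - u)
        ≡⟨ solve 3 (λ x₀ x₁ x₂ → ((x₀ :+ x₁) :* (:1 :- x₂)) :=
              (x₀ :* (:1 :- x₂) :+ (x₁ :- x₂ :* x₁))) refl S t u ⟩
    S * (1# - u) + (t - u * t)                        ≡⟨ cong (λ z → S * (1# - u) + (t - z)) (term-suc u (suc n)) ⟨
    -- The induction hypothesis bounds S (1 - u) + t by 1 - n t, and n t is nonnegative.
    S * (1# - u) + (t - t′)                           ≤⟨ ≤-by (partialExp-geometric 0≤u n ⊕ *-nonNegative (0≤fromℕ n) (term-nonNegative 0≤u (suc n)))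
        (solve 5 (λ x₀ x₁ x₂ x₃ x₄ → (:1 :- x₀ :- (x₁ :* (:1 :- x₂) :+ (x₃ :- x₀))) :=
              (:1 :- (:1 :+ x₄) :* x₃ :+ x₄ :* x₃ :- (x₁ :* (:1 :- x₂) :+ :0))) refl
              t′ (partialExp u (suc n)) u (term u (suc n)) (fromℕ n)) ⟩
    1# - t′                                           ∎
    where
    open ≤-Reasoning
    S = partialExp u (suc n)
    t = term u (suc n)
    t′ = fromℕ (suc (suc n)) * term u (suc (suc n))

  -- For x ≤ 0 the geometric bound at u = -x gives exp (-x) (1 + x) ≤ 1 in the limit; multiplying by
  -- exp x finishes, whatever the sign of 1 + x.
  1+x≤exp : ∀ x → 1# + x ≤ exp x
  1+x≤exp x = [ 1+x≤exp-nonNegative , nonPositive ]′ (≤-total 0# x)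
    where
    nonPositive : x ≤ 0# → 1# + x ≤ exp x
    nonPositive x≤0 = ≤-by (<⇒≤ (exp-positive x) ⊗ reciprocal)
      (trans
          (solve 2 (λ x₀ x₁ → (x₀ :- (:1 :+ x₁)) :=
                (x₀ :* :1 :- :1 :* (:1 :+ x₁))) refl
                (exp x) x) (trans (cong (λ z → exp x * 1# - z * (1# + x)) (sym (exp-inverse x)))
                    (solve 3 (λ x₀ x₁ x₂ → (x₀ :* :1 :- x₀ :* x₁ :* (:1 :+ x₂)) :=
                          (x₀ :* :1 :- x₀ :* (x₁ :* (:1 :- (:- x₂))))) refl (exp x) (exp (- x)) x)))
      where
      0≤-x : 0# ≤ - x
      0≤-x = ≤-by x≤0 (solve 1 (λ x₀ → ((:- x₀) :- :0) := (:0 :- x₀)) refl x)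
      reciprocal : exp (- x) * (1# - - x) ≤ 1#
      reciprocal = lim-mono 1
        (λ { (suc n) _ → ≤-trans (partialExp-geometric 0≤-x n)
             (≤-by (*-nonNegative (0≤fromℕ (suc n)) (term-nonNegative 0≤-x (suc n)))
                 (solve 2 (λ x₀ x₁ → (:1 :- (:1 :- (:1 :+ x₀) :* x₁)) :=
                       ((:1 :+ x₀) :* x₁ :- :0)) refl (fromℕ n) (term (- x) (suc n)))) })
        (lim-* (exp-converges (- x)) (lim-const (1# - - x))) (lim-const 1#)

  -- With h = x / 2, squaring 1 + h ≤ exp h gains the positive term h^2. Squaring is legitimate for
  -- 1 + h ≥ 0; otherwise 1 + x is already negative.
  1+x<exp : ∀ {x} → x ≢ 0# → 1# + x < exp x
  1+x<exp {x} x≢0 = [ nonNegative , negative ]′ (≤⊎> 0# (1# + h))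
    where
    h = x * ½
    h≢0 : h ≢ 0#
    h≢0 h≡0 = x≢0 (trans (sym (x*½+x*½≡x x)) (trans (cong₂ _+_ h≡0 h≡0) (+-identityˡ 0#)))
    nonNegative : 0# ≤ 1# + h → 1# + x < exp x
    nonNegative 0≤1+h = <-≤-trans
      (<-by {x = 0#} {y = h * h} (square-nonNegative h , λ 0≡h² → h≢0 (*-cancel-0 h≢0 (sym 0≡h²)))
        (trans (cong (λ z → (1# + h) * (1# + h) - (1# + z)) (sym (x*½+x*½≡x x)))
            (solve 1 (λ x₀ → ((:1 :+ x₀) :* (:1 :+ x₀) :- (:1 :+ (x₀ :+ x₀))) :=
                  (x₀ :* x₀ :- :0)) refl h)))
      (≤-trans (*-mono-≤ 0≤1+h (<⇒≤ (exp-positive h)) (1+x≤exp h) (1+x≤exp h)) (≤-reflexive (exp-half x)))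
    negative : 1# + h < 0# → 1# + x < exp x
    negative 1+h<0 = <-trans
      (<-by (<⇒≤ 1+h<0 ⊕ <⇒≤ 1+h<0 ⊕< 0<1) (trans (cong (λ z → 0# - (1# + z)) (sym (x*½+x*½≡x x)))
          (solve 1 (λ x₀ → (:0 :- (:1 :+ (x₀ :+ x₀))) :=
                (:0 :+ :0 :+ :1 :- (:1 :+ x₀ :+ (:1 :+ x₀) :+ :0))) refl h)))
      (exp-positive x)

  exp-shift : ∀ x y → exp y ≡ exp x * exp (y - x)
  exp-shift x y = trans (cong exp
      (solve 2 (λ x₀ x₁ → (x₀) := (x₁ :+ (x₀ :- x₁))) refl y x)) (exp-+ x (y - x))

  exp-mono-< : ∀ {x y} → x < y → exp x < exp y
  exp-mono-< {x} {y} x<y = <-by (_⊗<_ {exp x} {1#} {exp (y - x)} (exp-positive x) (<-≤-trans (<-by {1#} x<y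
      (solve 2 (λ x₀ x₁ → (:1 :+ (x₀ :- x₁) :- :1) := (x₀ :- x₁)) refl y x)) (1+x≤exp (y - x))))
    (trans (cong (λ z → z - exp x) (exp-shift x y))
        (solve 2 (λ x₀ x₁ → (x₀ :* x₁ :- x₀) := (x₀ :* x₁ :- x₀ :* :1)) refl (exp x) (exp (y - x))))

  exp-mono-≤ : ∀ {x y} → x ≤ y → exp x ≤ exp y
  exp-mono-≤ {x} {y} x≤y = [ (λ y≤x → ≤-reflexive (cong exp (≤-antisym x≤y y≤x))) , (λ x<y → <⇒≤ (exp-mono-< x<y)) ]′ (≤⊎> y x)

  exp-cancel-≤ : ∀ {x y} → exp x ≤ exp y → x ≤ y
  exp-cancel-≤ ex≤ey = ≮⇒≥ (λ y<x → <⇒≱ (exp-mono-< y<x) ex≤ey)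

  exp-cancel-< : ∀ {x y} → exp x < exp y → x < y
  exp-cancel-< ex<ey = ≰⇒> (λ y≤x → <⇒≱ ex<ey (exp-mono-≤ y≤x))

  exp-injective : ∀ {x y} → exp x ≡ exp y → x ≡ y
  exp-injective ex≡ey = ≤-antisym (exp-cancel-≤ (≤-reflexive ex≡ey)) (exp-cancel-≤ (≤-reflexive (sym ex≡ey)))

  -- The graph lies above the tangent at t: 1 + (s - t) ≤ exp (s - t), multiplied by exp t.
  exp-slope : ∀ s t → exp t - exp s ≤ exp t * (t - s)
  exp-slope s t = ≤-by (<⇒≤ (exp-positive t) ⊗ 1+x≤exp (s - t))
    (trans (cong (λ z → exp t * (t - s) - (exp t - z)) (exp-shift t s))
        (solve 4 (λ x₀ x₁ x₂ x₃ → (x₀ :* (x₁ :- x₂) :- (x₀ :- x₀ :* x₃)) :=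
              (x₀ :* x₃ :- x₀ :* (:1 :+ (x₂ :- x₁)))) refl (exp t) t s (exp (s - t))))

  -- The root is the supremum of the points where f is at most 0.
  intermediate-value : ∀ (f : ℝ → ℝ) {a c K} → a ≤ c → 0# < K → f a ≤ 0# → 0# ≤ f c →
    (∀ s t → a ≤ s → s ≤ t → t ≤ c → f t - f s ≤ K * (t - s)) →
    ∃[ x ] (a ≤ x × x ≤ c × f x ≡ 0#)
  intermediate-value f {a} {c} {K} a≤c 0<K fa≤0 0≤fc slope =
    r , a≤r , r≤c , ≤-antisym (≮⇒≥ ¬0<fr) (≮⇒≥ ¬fr<0)
    where
    P : ℝ → Set
    P x = a ≤ x × x ≤ c × f x ≤ 0#
    Pa : P a
    Pa = ≤-refl , a≤c , fa≤0
    bounded : ∃ (UpperBound P)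
    bounded = c , λ { _ (_ , x≤c , _) → x≤c }
    r : ℝ
    r = sup P
    a≤r : a ≤ r
    a≤r = sup-upper P (a , Pa) bounded a Pa
    r≤c : r ≤ c
    r≤c = sup-least P (a , Pa) bounded c (proj₂ bounded)
    K*[y/K]≡y : ∀ y → K * (y / K) ≡ y
    K*[y/K]≡y y = y*[x/y]≡x 0<K
    -- Every x in P has f r ≤ f r - f x ≤ K (r - x), so it lies at least f r / K below r, against
    -- the choice of r as supremum.
    ¬0<fr : ¬ (0# < f r)
    ¬0<fr 0<fr = <⇒≱ (<-by 0<δ
        (solve 2 (λ x₀ x₁ → (x₀ :- (x₀ :- x₁)) :=
              (x₁ :- :0)) refl r δ)) (sup-least P (a , Pa) bounded (r - δ) below)
      where
      δ = f r / K
      0<δ : 0# < δ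
      0<δ = *-positive 0<fr (⁻¹-positive 0<K)
      below : UpperBound P (r - δ)
      below x Px@(a≤x , x≤c , fx≤0) = ≤-by {x = δ} {y = r - x} (*-cancelˡ-≤ 0<K
        (subst (_≤ K * (r - x)) (sym (K*[y/K]≡y (f r)))
          (≤-trans (≤-by fx≤0
              (solve 2 (λ x₀ x₁ → (x₀ :- x₁ :- x₀) :=
                    (:0 :- x₁)) refl
                    (f r) (f x))) (slope x r a≤x (sup-upper P (a , Pa) bounded x Px) r≤c))))
                        (solve 3 (λ x₀ x₁ x₂ → (x₀ :- x₁ :- x₂) := (x₀ :- x₂ :- x₁)) refl r δ x)
    -- Up to the distance -f r / K beyond r the value stays at most 0. This gives a point of P
    -- beyond r or, if c comes first, f c < 0.
    ¬fr<0 : ¬ (f r < 0#)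
    ¬fr<0 fr<0 = [ inside , outside ]′ (≤⊎> (r + δ) c)
      where
      δ = - f r / K
      0<δ : 0# < δ
      0<δ = *-positive (<-by {0#} { - f r} fr<0
          (solve 1 (λ x₀ → ((:- x₀) :- :0) := (:0 :- x₀)) refl (f r))) (⁻¹-positive 0<K)
      r≤r+δ : r ≤ r + δ
      r≤r+δ = ≤-by (<⇒≤ 0<δ) (solve 2 (λ x₀ x₁ → (x₀ :+ x₁ :- x₀) := (x₁ :- :0)) refl r δ)
      inside : ¬ (r + δ ≤ c)
      inside r+δ≤c = <⇒≱ (<-by {r} {r + δ} 0<δ
          (solve 2 (λ x₀ x₁ → (x₀ :+ x₁ :- x₀) :=
                (x₁ :- :0)) refl r δ)) (sup-upper P (a , Pa) bounded (r + δ)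
        (≤-trans a≤r r≤r+δ , r+δ≤c , ≤-by (slope r (r + δ) a≤r r≤r+δ r+δ≤c)
          (trans
              (solve 2 (λ x₀ x₁ → (:0 :- x₀) :=
                    ((:- x₁) :- x₀ :+ x₁)) refl
                    (f (r + δ)) (f r)) (trans (cong (λ z → z - f (r + δ) + f r) (sym (K*[y/K]≡y (- f r))))
                        (solve 5 (λ x₀ x₁ x₂ x₃ x₄ → (x₀ :* x₁ :- x₂ :+ x₃) :=
                              (x₀ :* (x₄ :+ x₁ :- x₄) :- (x₂ :- x₃))) refl
                              K δ (f (r + δ)) (f r) r)))))
      outside : ¬ (c < r + δ)
      outside c<r+δ = <⇒≱ (≤-<-trans (slope r c a≤r r≤c ≤-refl)
        (subst (K * (c - r) <_) (K*[y/K]≡y (- f r)) (0<K ⊗< <-by {c - r} {δ} c<r+δ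
            (solve 3 (λ x₀ x₁ x₂ → (x₀ :- (x₁ :- x₂)) := (x₂ :+ x₀ :- x₁)) refl δ c r))))
        (≤-by 0≤fc (solve 2 (λ x₀ x₁ → (x₀ :- x₁ :- (:- x₁)) := (x₀ :- :0)) refl (f c) (f r)))

-- Logarithms and difference quotients.

module Logarithm (em : ExcludedMiddle 0ℓ) (R : Reals) where

  open Analysis R
  open OrderedField em R
  open Limits em R
  open ExponentialLaws em R
  open IntegerCoefficientSolver commutativeRing
  open CommutativeRing commutativeRing using (*-comm)

  -- The interval from -1/y to y brackets the root: exp y ≥ 1 + y, and exp (-1/y) = 1 / exp (1/y) ≤
  -- y because exp (1/y) ≥ 1/y. On it `exp` rises at most at the rate exp y.
  exp-surjective : ∀ {y} → 0# < y → ∃[ x ] exp x ≡ y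
  exp-surjective {y} 0<y = root (intermediate-value (λ x → exp x - y) {K = exp y} -y⁻¹≤y (exp-positive y) below above slope)
    where
    root : ∃[ x ] (- y ⁻¹ ≤ x × x ≤ y × exp x - y ≡ 0#) → ∃[ x ] exp x ≡ y
    root (x , _ , _ , root) = x , ≡-by root
        (solve 2 (λ x₀ x₁ → (x₀ :- x₁) := (:0 :- (x₁ :- x₀))) refl y (exp x))
    0<y⁻¹ : 0# < y ⁻¹
    0<y⁻¹ = ⁻¹-positive 0<y
    -y⁻¹≤y : - y ⁻¹ ≤ y
    -y⁻¹≤y = ≤-by (<⇒≤ 0<y ⊕ <⇒≤ 0<y⁻¹)
        (solve 2 (λ x₀ x₁ → (x₀ :- (:- x₁)) := (x₀ :+ x₁ :- (:0 :+ :0))) refl y (y ⁻¹))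
    y⁻¹≤exp : y ⁻¹ ≤ exp (y ⁻¹)
    y⁻¹≤exp = ≤-trans (≤-by 0≤1
        (solve 1 (λ x₀ → (:1 :+ x₀ :- x₀) := (:1 :- :0)) refl (y ⁻¹))) (1+x≤exp (y ⁻¹))
    below : exp (- y ⁻¹) - y ≤ 0#
    below = ≤-by (*-nonNegative (<⇒≤ 0<y) (<⇒≤ (exp-positive (- y ⁻¹))) ⊗ y⁻¹≤exp) (begin
      0# - (e′ - y)
          ≡⟨ solve 2 (λ x₀ x₁ → (:0 :- (x₀ :- x₁)) := (x₁ :* :1 :- :1 :* x₀)) refl e′ y ⟩
      y * 1# - 1# * e′                    ≡⟨ cong₂ (λ s t → y * s - t * e′) (exp-inverse (y ⁻¹)) (x*x⁻¹≡1 0<y) ⟨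
      y * (e * e′) - y * y ⁻¹ * e′
          ≡⟨ solve 4 (λ x₀ x₁ x₂ x₃ → (x₀ :* (x₁ :* x₂) :- x₀ :* x₃ :* x₂) :=
                (x₀ :* x₂ :* x₁ :- x₀ :* x₂ :* x₃)) refl y e e′ (y ⁻¹) ⟩
      y * e′ * e - y * e′ * y ⁻¹          ∎)
      where
      open ≡-Reasoning
      e = exp (y ⁻¹)
      e′ = exp (- y ⁻¹)
    above : 0# ≤ exp y - y
    above = ≤-by (1+x≤exp y ⊕ 0≤1)
        (solve 2 (λ x₀ x₁ → (x₀ :- x₁ :- :0) := (x₀ :+ :1 :- (:1 :+ x₁ :+ :0))) refl (exp y) y)
    slope : ∀ s t → - y ⁻¹ ≤ s → s ≤ t → t ≤ y → exp t - y - (exp s - y) ≤ exp y * (t - s)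
    slope s t _ s≤t t≤y = ≤-trans (≤-by {b = exp t * (t - s)} (exp-slope s t)
        (solve 5 (λ x₀ x₁ x₂ x₃ x₄ → (x₀ :* (x₁ :- x₂) :- (x₀ :- x₃ :- (x₄ :- x₃))) :=
              (x₀ :* (x₁ :- x₂) :- (x₀ :- x₄))) refl (exp t) t s y (exp s)))
      (≤-trans (≤-reflexive (*-comm _ _)) (≤-trans ((≤-by s≤t
          (solve 2 (λ x₀ x₁ → (x₀ :- x₁ :- :0) :=
                (x₀ :- x₁)) refl t s)) ⊗ exp-mono-≤ t≤y) (≤-reflexive (*-comm _ _))))

  log-unique : ∀ {x y} → exp x ≡ y → log y ≡ x
  log-unique {x} {y} expx≡y = sup-singleton (λ z → exp z ≡ y) expx≡y
    (λ z expz≡y → exp-injective (trans expz≡y (sym expx≡y)))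

  exp-log : ∀ {y} → 0# < y → exp (log y) ≡ y
  exp-log 0<y = trans (cong exp (log-unique (proj₂ (exp-surjective 0<y)))) (proj₂ (exp-surjective 0<y))

  log-* : ∀ {x y} → 0# < x → 0# < y → log (x * y) ≡ log x + log y
  log-* {x} {y} 0<x 0<y = log-unique (trans (exp-+ (log x) (log y)) (cong₂ _*_ (exp-log 0<x) (exp-log 0<y)))

  log-/ : ∀ {x y} → 0# < x → 0# < y → log (x / y) ≡ log x - log y
  log-/ {x} {y} 0<x 0<y = ≡-by (sym (trans (cong log (sym (y*[x/y]≡x 0<y))) (log-* 0<y (*-positive 0<x (⁻¹-positive 0<y)))))
      (solve 3 (λ x₀ x₁ x₂ → (x₀ :- x₁ :- x₂) :=
            (x₀ :- (x₁ :+ x₂))) refl (log x) (log y) (log (x / y)))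

  log-mono-< : ∀ {x y} → 0# < x → x < y → log x < log y
  log-mono-< 0<x x<y = exp-cancel-< (subst₂ _<_ (sym (exp-log 0<x)) (sym (exp-log (<-trans 0<x x<y))) x<y)

  log-mono-≤ : ∀ {x y} → 0# < x → x ≤ y → log x ≤ log y
  log-mono-≤ 0<x x≤y = exp-cancel-≤ (subst₂ _≤_ (sym (exp-log 0<x)) (sym (exp-log (<-≤-trans 0<x x≤y))) x≤y)

  log-1 : log 1# ≡ 0#
  log-1 = log-unique exp-0

  0<log : ∀ {x} → 1# < x → 0# < log x
  0<log 1<x = subst (_< log _) log-1 (log-mono-< 0<1 1<x)

  -- This is 1 + u ≤ exp u at u = log c + log x. Small c shows that `log` grows slower than any
  -- linear function, as the error term requires.
  log-≤-linear : ∀ {c x} → 0# < c → 0# < x → 1# + (log c + log x) ≤ c * x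
  log-≤-linear {c} {x} 0<c 0<x = subst (1# + (log c + log x) ≤_)
    (trans (exp-+ (log c) (log x)) (cong₂ _*_ (exp-log 0<c) (exp-log 0<x))) (1+x≤exp (log c + log x))

  -- With A = exp u - 1 - u, both 0 ≤ A and A (1 - u) ≤ u² come from 1 + x ≤ exp x at x = ± u.
  exp-quadratic : ∀ {u} → u ≤ ½ → exp u - (1# + u) ≤ 2# * (u * u)
  -- Since 2 A u ≤ A, the quantity A is at most 2 A (1 - u).
  exp-quadratic {u} u≤½ = ≤-by (<⇒≤ 0<2 ⊗ A[1-u]≤u² ⊕ <⇒≤ 0<2 ⊗ (0≤A ⊗ u≤½))
    (≡-by (cong (A *_) (sym 2*½≡1))
        (solve 3 (λ x₀ x₁ x₂ → ((:1 :+ :1) :* (x₀ :* x₀) :+ (:1 :+ :1) :* ((x₁ :- (:1 :+ x₀)) :* x₂) :- ((:1 :+ :1) :* ((x₁ :- (:1 :+ x₀)) :* (:1 :- x₀)) :+ (:1 :+ :1) :* ((x₁ :- (:1 :+ x₀)) :* x₀)) :- ((:1 :+ :1) :* (x₀ :* x₀) :- (x₁ :- (:1 :+ x₀)))) :=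
              ((x₁ :- (:1 :+ x₀)) :* ((:1 :+ :1) :* x₂) :- (x₁ :- (:1 :+ x₀)) :* :1)) refl
              u (exp u) ½))
    where
    A = exp u - (1# + u)
    0≤A : 0# ≤ A
    0≤A = ≤-by (1+x≤exp u)
        (solve 2 (λ x₀ x₁ → (x₀ :- (:1 :+ x₁) :- :0) := (x₀ :- (:1 :+ x₁))) refl (exp u) u)
    A[1-u]≤u² : A * (1# - u) ≤ u * u
    A[1-u]≤u² = ≤-by (<⇒≤ (exp-positive u) ⊗ 1+x≤exp (- u)) (≡-by (sym (exp-inverse u))
        (solve 3 (λ x₀ x₁ x₂ → (x₀ :* x₁ :- x₀ :* (:1 :+ (:- x₂)) :- (x₂ :* x₂ :- (x₀ :- (:1 :+ x₂)) :* (:1 :- x₂))) :=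
              (x₀ :* x₁ :- :1)) refl (exp u) (exp (- u)) u))

  -- Stated through t h, because convexity gives the error of a difference quotient, multiplied by
  -- h, a fixed sign. The cases for the sign of h are settled here once.
  ∣quotient∣≤ : ∀ {t h C} → h ≢ 0# → 0# ≤ t * h → t * h ≤ C * (h * h) → ∣ t ∣ ≤ C * ∣ h ∣
  ∣quotient∣≤ {t} {h} {C} h≢0 0≤th th≤Ch² = [ positive , negative ]′ (≤-total 0# h)
    where
    t≤∣ : ∀ {k} → 0# ≤ C → k ≤ ∣ h ∣ → C * k ≤ C * ∣ h ∣
    t≤∣ 0≤C k≤∣h∣ = 0≤C ⊗ k≤∣h∣
    0≤C : 0# ≤ C
    0≤C = *-cancelˡ-≤ {h * h} (square-nonNegative h , λ 0≡h² → h≢0 (*-cancel-0 h≢0 (sym 0≡h²)))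
      (≤-by (≤-trans 0≤th th≤Ch²)
          (solve 2 (λ x₀ x₁ → (x₀ :* x₀ :* x₁ :- x₀ :* x₀ :* :0) :=
                (x₁ :* (x₀ :* x₀) :- :0)) refl h C))
    positive : 0# ≤ h → ∣ t ∣ ≤ C * ∣ h ∣
    positive 0≤h = ≤-trans (∣x∣≤
      (*-cancelˡ-≤ 0<h (≤-by th≤Ch²
          (solve 3 (λ x₀ x₁ x₂ → (x₀ :* (x₁ :* x₀) :- x₀ :* x₂) :=
                (x₁ :* (x₀ :* x₀) :- x₂ :* x₀)) refl h C t)))
      (≤-trans (*-cancelˡ-≤ 0<h (≤-by {y = t * h} 0≤th
          (solve 2 (λ x₀ x₁ → (x₀ :* :0 :- x₀ :* (:- x₁)) :=
                (x₁ :* x₀ :- :0)) refl h t))) (*-nonNegative 0≤C 0≤h))) (t≤∣ 0≤C (x≤∣x∣ h))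
      where
      0<h : 0# < h
      0<h = 0≤h , λ 0≡h → h≢0 (sym 0≡h)
    negative : h ≤ 0# → ∣ t ∣ ≤ C * ∣ h ∣
    negative h≤0 = ≤-trans (∣x∣≤
      (≤-trans (*-cancelˡ-≤ 0<-h (≤-by {y = t * h} 0≤th
          (solve 2 (λ x₀ x₁ → ((:- x₀) :* :0 :- (:- x₀) :* x₁) :=
                (x₁ :* x₀ :- :0)) refl h t))) (*-nonNegative 0≤C (<⇒≤ 0<-h)))
      (*-cancelˡ-≤ 0<-h (≤-by th≤Ch²
          (solve 3 (λ x₀ x₁ x₂ → ((:- x₀) :* (x₁ :* (:- x₀)) :- (:- x₀) :* (:- x₂)) :=
                (x₁ :* (x₀ :* x₀) :- x₂ :* x₀)) refl h C t)))) (t≤∣ 0≤C (-x≤∣x∣ h))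
      where
      0<-h : 0# < - h
      0<-h = <-by {0#} { - h} {h} {0#} (h≤0 , h≢0)
          (solve 1 (λ x₀ → ((:- x₀) :- :0) := (:0 :- x₀)) refl h)

  -- Both candidates would lie within half of ∣ L - L′ ∣ of the same quotient, taken at half of the
  -- smaller δ.
  derivative-unique : ∀ {f x L L′} → HasDerivativeAt f x L → HasDerivativeAt f x L′ → L ≡ L′
  derivative-unique {f} {x} {L} {L′} f→L f→L′ = ≡-by L-L′≡0
      (solve 2 (λ x₀ x₁ → (x₀ :- x₁) := (:0 :- (x₁ :- x₀))) refl L′ L)
    where
    d = ∣ L - L′ ∣
    ¬0<d : ¬ (0# < d)
    ¬0<d 0<d = <⇒≱ too-close ≤-refl
      where
      0<ε : 0# < d * ½
      0<ε = *-positive 0<d 0<½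
      δ₁ = f→L (d * ½) 0<ε
      δ₂ = f→L′ (d * ½) 0<ε
      δ = minimum (proj₁ δ₁) (proj₁ δ₂)
      0<δ : 0# < proj₁ δ
      0<δ = proj₂ (proj₂ (proj₂ δ)) (proj₁ (proj₂ δ₁)) (proj₁ (proj₂ δ₂))
      h = proj₁ δ * ½
      0<h : 0# < h
      0<h = *-positive 0<δ 0<½
      h<δ : h < proj₁ δ
      h<δ = <-by 0<h (≡-by (sym (x*½+x*½≡x (proj₁ δ)))
          (solve 2 (λ x₀ x₁ → (x₀ :* x₁ :- :0 :- (x₀ :- x₀ :* x₁)) :=
                (x₀ :* x₁ :+ x₀ :* x₁ :- x₀)) refl (proj₁ δ) ½))
      ∣h∣<δ : ∣ h ∣ < proj₁ δ
      ∣h∣<δ = ∣x∣< h<δ (<-by (<⇒≤ 0<δ ⊕< 0<h)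
          (solve 2 (λ x₀ x₁ → (x₀ :- (:- x₁)) := (x₀ :+ x₁ :- (:0 :+ :0))) refl (proj₁ δ) h))
      q = (f (x + h) - f x) / h
      q-L : ∣ q - L ∣ < d * ½
      q-L = proj₂ (proj₂ δ₁) h (0<⇒≢0 0<h) (<-≤-trans ∣h∣<δ (proj₁ (proj₂ δ)))
      q-L′ : ∣ q - L′ ∣ < d * ½
      q-L′ = proj₂ (proj₂ δ₂) h (0<⇒≢0 0<h) (<-≤-trans ∣h∣<δ (proj₁ (proj₂ (proj₂ δ))))
      triangle-inequality : d ≤ ∣ q - L ∣ + ∣ q - L′ ∣
      triangle-inequality = ∣x∣≤ (≤-by (-x≤∣x∣ (q - L) ⊕ x≤∣x∣ (q - L′))
          (solve 5 (λ x₀ x₁ x₂ x₃ x₄ → (x₀ :+ x₁ :- (x₂ :- x₃)) :=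
                (x₀ :+ x₁ :- ((:- (x₄ :- x₂)) :+ (x₄ :- x₃)))) refl
                (∣ q - L ∣) (∣ q - L′ ∣) L L′ q)) (≤-by (x≤∣x∣ (q - L) ⊕ -x≤∣x∣ (q - L′))
                    (solve 5 (λ x₀ x₁ x₂ x₃ x₄ → (x₀ :+ x₁ :- (:- (x₂ :- x₃))) :=
                          (x₀ :+ x₁ :- (x₄ :- x₂ :+ (:- (x₄ :- x₃))))) refl
                          (∣ q - L ∣) (∣ q - L′ ∣) L L′ q))
      too-close : d < d
      too-close = ≤-<-trans triangle-inequality (subst (∣ q - L ∣ + ∣ q - L′ ∣ <_) (x*½+x*½≡x d) (<⇒≤ q-L ⊕< q-L′))
    d≤0 : d ≤ 0#
    d≤0 = ≮⇒≥ ¬0<d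
    L-L′≡0 : L - L′ ≡ 0#
    L-L′≡0 = ≤-antisym (≤-trans (x≤∣x∣ (L - L′)) d≤0) (≤-by (≤-trans (-x≤∣x∣ (L - L′)) d≤0)
        (solve 2 (λ x₀ x₁ → (x₀ :- x₁ :- :0) := (:0 :- (:- (x₀ :- x₁)))) refl L L′))

  deriv-≡ : ∀ {f x L} → HasDerivativeAt f x L → deriv f x ≡ L
  deriv-≡ {f} {x} f→L = sup-singleton (HasDerivativeAt f x) f→L (λ _ f→L′ → derivative-unique {f} {x} f→L′ f→L)

-- Convexity of the logarithm of a Dirichlet sum.

module DirichletSum (em : ExcludedMiddle 0ℓ) (R : Reals)
  (k : ℕ) (L : ℕ → Reals.ℝ R) (0<L : ∀ i → Analysis._<_ R (Reals.0# R) (L i)) where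

  open Analysis R
  open OrderedField em R
  open FiniteSums em R
  open ExponentialLaws em R
  open Logarithm em R
  open IntegerCoefficientSolver commutativeRing

  n : ℕ
  n = suc k

  e : ℝ → ℕ → ℝ
  e s i = exp (- s * L i)

  -- When L i = log (i + 2), W is 1 + ζ, the digits 0 and 1 contributing 2#; m is minus the derivative of g.
  E D W m g : ℝ → ℝ
  E s = ∑ n (e s)
  D s = ∑ n (λ i → L i * e s i)
  W s = 2# + E s
  m s = D s / W s
  g s = log (W s)

  0≤L : ∀ i → 0# ≤ L i
  0≤L i = <⇒≤ (0<L i)

  0<e : ∀ s i → 0# < e s i
  0<e s i = exp-positive (- s * L i)

  -- Expresses the value at t from s, so that 1 + x ≤ exp x can be applied to the increment.
  e-shift : ∀ s t i → e t i ≡ e s i * exp (- (t - s) * L i)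
  e-shift s t i = trans (cong exp
      (solve 3 (λ x₀ x₁ x₂ → ((:- x₀) :* x₁) :=
            ((:- x₂) :* x₁ :+ (:- (x₀ :- x₂)) :* x₁)) refl
            t (L i) s)) (exp-+ (- s * L i) (- (t - s) * L i))

  e-antitone : ∀ {s t} → s ≤ t → ∀ i → e t i ≤ e s i
  e-antitone {s} {t} s≤t i = exp-mono-≤ (≤-by (0≤L i ⊗ s≤t)
      (solve 3 (λ x₀ x₁ x₂ → ((:- x₀) :* x₁ :- (:- x₂) :* x₁) :=
            (x₁ :* x₂ :- x₁ :* x₀)) refl s (L i) t))

  e-0 : ∀ i → e 0# i ≡ 1#
  e-0 i = trans (cong exp (solve 1 (λ x₀ → ((:- :0) :* x₀) := (:0)) refl (L i))) exp-0

  e≤1 : ∀ {s} → 0# ≤ s → ∀ i → e s i ≤ 1#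
  e≤1 {s} 0≤s i = subst (e s i ≤_) (e-0 i) (e-antitone 0≤s i)

  0≤E : ∀ s → 0# ≤ E s
  0≤E s = ∑-nonNegative n (λ i → <⇒≤ (0<e s i))

  0<D : ∀ s → 0# < D s
  0<D s = ∑-positive k (λ i → *-positive (0<L i) (0<e s i))

  1≤W : ∀ s → 1# ≤ W s
  1≤W s = ≤-by (0≤1 ⊕ 0≤E s)
      (solve 1 (λ x₀ → (:1 :+ :1 :+ x₀ :- :1) := (:1 :+ x₀ :- (:0 :+ :0))) refl (E s))

  1<W : ∀ s → 1# < W s
  1<W s = <-by (0≤E s ⊕< 0<1)
      (solve 1 (λ x₀ → (:1 :+ :1 :+ x₀ :- :1) := (x₀ :+ :1 :- (:0 :+ :0))) refl (E s))

  0<W : ∀ s → 0# < W s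
  0<W s = <-≤-trans 0<1 (1≤W s)

  W-antitone : ∀ {s t} → s ≤ t → W t ≤ W s
  W-antitone s≤t = ≤-refl {2#} ⊕ ∑-mono n (λ i _ → e-antitone s≤t i)

  W*m≡D : ∀ s → W s * m s ≡ D s
  W*m≡D s = y*[x/y]≡x (0<W s)

  0<m : ∀ s → 0# < m s
  0<m s = *-positive (0<D s) (⁻¹-positive (0<W s))

  -- Jensen's inequality for exp, from 1 + x ≤ exp x around the weighted mean c.
  W-convex : ∀ {s t} → s ≢ t → W t < exp ((s - t) * m t) * W s
  W-convex {s} {t} s≢t = <-by
    -- Strictness comes from the constant term `2#` of W, whose exponent is c itself and thus
    -- nonzero.
    (∑-mono n {λ i → (1# + c) * e t i + (t - s) * (L i * e t i)} {λ i → exp c * e s i} termwise ⊕< 0<2 ⊗< 1+x<exp c≢0)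
    (begin
      exp c * W s - W t
          ≡⟨ solve 3 (λ x₀ x₁ x₂ → (x₀ :* (:1 :+ :1 :+ x₁) :- (:1 :+ :1 :+ x₂)) :=
                (x₀ :* x₁ :+ (:1 :+ :1) :* x₀ :- (:1 :+ :1 :+ x₂))) refl (exp c) (E s) (E t) ⟩
      exp c * E s + 2# * exp c - (2# + E t)                                   ≡⟨ cong₂ (λ x y → x + 2# * exp c - y) (sym (∑-* n (exp c) (e s))) mean ⟩
      ∑ n (λ i → exp c * e s i) + 2# * exp c - (∑ n (λ i → (1# + c) * e t i + (t - s) * (L i * e t i)) + 2# * (1# + c))  ∎)
    where
    open ≡-Reasoning
    -- Chosen so that the exponents c - (s - t) L i, and c for the constant term, have mean 0 with
    -- the weights `e t i` and `2#`. The linear lower bounds therefore add up to exactly W t.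
    c = (s - t) * m t
    c≢0 : c ≢ 0#
    c≢0 c≡0 = 0<⇒≢0 (0<m t) (*-cancel-0 (λ s-t≡0 → s≢t (≡-by s-t≡0
        (solve 2 (λ x₀ x₁ → (x₀ :- x₁) := (:0 :- (x₁ :- x₀))) refl t s))) c≡0)
    termwise : ∀ i → i ℕ.< n → (1# + c) * e t i + (t - s) * (L i * e t i) ≤ exp c * e s i
    termwise i _ = ≤-by (<⇒≤ (0<e t i) ⊗ 1+x≤exp (c + - (s - t) * L i)) (begin
      exp c * e s i - ((1# + c) * e t i + (t - s) * (L i * e t i))
        ≡⟨ cong (λ z → exp c * z - ((1# + c) * e t i + (t - s) * (L i * e t i))) (e-shift t s i) ⟩
      exp c * (e t i * exp (- (s - t) * L i)) - ((1# + c) * e t i + (t - s) * (L i * e t i))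
        ≡⟨ solve 7 (λ x₀ x₁ x₂ x₃ x₄ x₅ x₆ → (x₀ :* (x₁ :* x₂) :- ((:1 :+ x₃) :* x₁ :+ (x₄ :- x₅) :* (x₆ :* x₁))) :=
              (x₁ :* (x₀ :* x₂) :- x₁ :* (:1 :+ (x₃ :+ (:- (x₅ :- x₄)) :* x₆)))) refl
              (exp c) (e t i) (exp (- (s - t) * L i)) c t s (L i) ⟩
      e t i * (exp c * exp (- (s - t) * L i)) - e t i * (1# + (c + - (s - t) * L i))
        ≡⟨ cong (λ z → e t i * z - e t i * (1# + (c + - (s - t) * L i))) (exp-+ c (- (s - t) * L i)) ⟨
      e t i * exp (c + - (s - t) * L i) - e t i * (1# + (c + - (s - t) * L i))   ∎)
    mean : 2# + E t ≡ ∑ n (λ i → (1# + c) * e t i + (t - s) * (L i * e t i)) + 2# * (1# + c)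
    mean = sym (begin
      ∑ n (λ i → (1# + c) * e t i + (t - s) * (L i * e t i)) + 2# * (1# + c)
        ≡⟨ cong (_+ 2# * (1# + c)) (∑-linear n (1# + c) (e t) (t - s) (λ i → L i * e t i)) ⟩
      (1# + c) * E t + (t - s) * D t + 2# * (1# + c)
        ≡⟨ cong (λ z → (1# + c) * E t + (t - s) * z + 2# * (1# + c)) (W*m≡D t) ⟨
      (1# + c) * E t + (t - s) * (W t * m t) + 2# * (1# + c)
        ≡⟨ solve 4 (λ x₀ x₁ x₂ x₃ → ((:1 :+ (x₀ :- x₁) :* x₂) :* x₃ :+ (x₁ :- x₀) :* ((:1 :+ :1 :+ x₃) :* x₂) :+ (:1 :+ :1) :* (:1 :+ (x₀ :- x₁) :* x₂)) :=
              (:1 :+ :1 :+ x₃)) refl s t (m t) (E t) ⟩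
      2# + E t   ∎)

  -- The logarithm of `W-convex`. As `m t` is minus the slope of g at t, the left side is the height
  -- at s of the tangent at t.
  tangent : ∀ {s t} → s ≢ t → g t - (s - t) * m t < g s
  tangent {s} {t} s≢t = <-by
    (subst (g t <_) (trans (log-* (exp-positive ((s - t) * m t)) (0<W s)) (cong (_+ g s) (log-unique refl)))
      (log-mono-< (0<W t) (W-convex s≢t)))
    (solve 5 (λ x₀ x₁ x₂ x₃ x₄ → (x₀ :- (x₁ :- (x₂ :- x₃) :* x₄)) :=
          ((x₂ :- x₃) :* x₄ :+ x₀ :- x₁)) refl (g s) (g t) s t (m t))

  -- Adding the tangent inequalities at s and at t cancels the values of g.
  m-antitone : ∀ {s t} → s < t → m t < m s
  m-antitone {s} {t} s<t@(_ , s≢t) = *-cancelˡ-< {t - s} (<-by s<t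
      (solve 2 (λ x₀ x₁ → (x₀ :- x₁ :- :0) := (x₀ :- x₁)) refl t s))
    (<-by (<⇒≤ (tangent s≢t) ⊕< tangent (λ t≡s → s≢t (sym t≡s)))
        (solve 6 (λ x₀ x₁ x₂ x₃ x₄ x₅ → ((x₀ :- x₁) :* x₂ :- (x₀ :- x₁) :* x₃) :=
              (x₄ :+ x₅ :- (x₅ :- (x₁ :- x₀) :* x₃ :+ (x₄ :- (x₀ :- x₁) :* x₂)))) refl
              t s (m s) (m t) (g s) (g t)))

  -- Termwise, 1 + x ≤ exp x gives e s i - e t i ≤ (t - s) L i e s i, and e s i ≤ 1 because s ≥ 0.
  D-lipschitz : ∀ {s t} → 0# ≤ s → s ≤ t → D s - D t ≤ (t - s) * ∑ n (λ i → L i * L i)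
  D-lipschitz {s} {t} 0≤s s≤t = ≤-by
    (∑-mono n {λ i → 1# * (L i * e s i) + - 1# * (L i * e t i)} {λ i → (t - s) * (L i * L i)} termwise)
    (cong₂ _-_ (sym (∑-* n (t - s) (λ i → L i * L i)))
      (trans
          (solve 2 (λ x₀ x₁ → (x₀ :- x₁) :=
                (:1 :* x₀ :+ (:- :1) :* x₁)) refl
                (∑ n (λ i → L i * e s i)) (∑ n (λ i → L i * e t i))) (sym (∑-linear n 1# (λ i → L i * e s i) (- 1#) (λ i → L i * e t i)))))
    where
    0≤t-s : 0# ≤ t - s
    0≤t-s = ≤-by s≤t (solve 2 (λ x₀ x₁ → (x₀ :- x₁ :- :0) := (x₀ :- x₁)) refl t s)
    termwise : ∀ i → i ℕ.< n → 1# * (L i * e s i) + - 1# * (L i * e t i) ≤ (t - s) * (L i * L i)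
    termwise i _ = ≤-by
      (*-nonNegative (0≤L i) (<⇒≤ (0<e s i)) ⊗ 1+x≤exp (- (t - s) * L i) ⊕
       *-nonNegative (*-nonNegative 0≤t-s (0≤L i)) (0≤L i) ⊗ e≤1 0≤s i)
      (begin
        (t - s) * (L i * L i) - (1# * (L i * e s i) + - 1# * (L i * e t i))
          ≡⟨ cong (λ z → (t - s) * (L i * L i) - (1# * (L i * e s i) + - 1# * (L i * z))) (e-shift s t i) ⟩
        (t - s) * (L i * L i) - (1# * (L i * e s i) + - 1# * (L i * (e s i * exp (- (t - s) * L i))))
          ≡⟨ solve 5 (λ x₀ x₁ x₂ x₃ x₄ → ((x₀ :- x₁) :* (x₂ :* x₂) :- (:1 :* (x₂ :* x₃) :+ (:- :1) :* (x₂ :* (x₃ :* x₄)))) :=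
                (x₂ :* x₃ :* x₄ :+ (x₀ :- x₁) :* x₂ :* x₂ :* :1 :- (x₂ :* x₃ :* (:1 :+ (:- (x₀ :- x₁)) :* x₂) :+ (x₀ :- x₁) :* x₂ :* x₂ :* x₃))) refl
                t s (L i) (e s i) (exp (- (t - s) * L i)) ⟩
        L i * e s i * exp (- (t - s) * L i) + (t - s) * L i * L i * 1# -
          (L i * e s i * (1# + - (t - s) * L i) + (t - s) * L i * L i * e s i)   ∎)
      where open ≡-Reasoning

  -- Multiplied by W s, the difference is at most D s - D t, since W decreases; dividing by W s ≥ 1
  -- does not enlarge the bound.
  m-lipschitz : ∀ {s t} → 0# ≤ s → s ≤ t → m s - m t ≤ (t - s) * ∑ n (λ i → L i * L i)
  m-lipschitz {s} {t} 0≤s s≤t = *-cancelˡ-≤ (0<W s) (begin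
    W s * (m s - m t)
        ≡⟨ solve 3 (λ x₀ x₁ x₂ → (x₀ :* (x₁ :- x₂)) :=
              (x₀ :* x₁ :- x₂ :* x₀)) refl (W s) (m s) (m t) ⟩
    W s * m s - m t * W s        ≤⟨ ≤-by (<⇒≤ (0<m t) ⊗ W-antitone s≤t)
        (solve 4 (λ x₀ x₁ x₂ x₃ → (x₀ :* x₁ :- x₂ :* x₃ :- (x₀ :* x₁ :- x₃ :* x₀)) :=
              (x₃ :* x₀ :- x₃ :* x₂)) refl (W s) (m s) (W t) (m t)) ⟩
    W s * m s - W t * m t        ≡⟨ cong₂ _-_ (W*m≡D s) (W*m≡D t) ⟩
    D s - D t                    ≤⟨ D-lipschitz 0≤s s≤t ⟩
    (t - s) * Q                  ≤⟨ ≤-by (*-nonNegative 0≤t-s 0≤Q ⊗ 1≤W s)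
        (solve 4 (λ x₀ x₁ x₂ x₃ → (x₀ :* ((x₁ :- x₂) :* x₃) :- (x₁ :- x₂) :* x₃) :=
              ((x₁ :- x₂) :* x₃ :* x₀ :- (x₁ :- x₂) :* x₃ :* :1)) refl (W s) t s Q) ⟩
    W s * ((t - s) * Q)          ∎)
    where
    open ≤-Reasoning
    Q = ∑ n (λ i → L i * L i)
    0≤t-s : 0# ≤ t - s
    0≤t-s = ≤-by s≤t (solve 2 (λ x₀ x₁ → (x₀ :- x₁ :- :0) := (x₀ :- x₁)) refl t s)
    0≤Q : 0# ≤ Q
    0≤Q = ∑-nonNegative n (λ i → square-nonNegative (L i))

-- The critical point and the exponent.

module CriticalPoint (em : ExcludedMiddle 0ℓ) (R : Reals)
  (k : ℕ) (L : ℕ → Reals.ℝ R) (0<L : ∀ i → Analysis._<_ R (Reals.0# R) (L i)) where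

  open Analysis R
  open OrderedField em R
  open FiniteSums em R
  open Limits em R
  open ExponentialLaws em R
  open Logarithm em R
  open DirichletSum em R k L 0<L
  open IntegerCoefficientSolver commutativeRing
  open CommutativeRing commutativeRing using (+-identityʳ)

  B ℓ : ℝ
  B = fromℕ (2 ℕ.+ n)
  ℓ = log B

  -- The left-hand side of the equation, with -D for the derivative of ζ; mathematically, (1 + s)^2
  -- ℓ times the derivative of `η`.
  F : ℝ → ℝ
  F s = ((1# + s) * - D s) / W s - log (W s / B)

  1<B : 1# < B
  1<B = subst (_< B) (+-identityʳ 1#) (fromℕ-mono-< {1} {2 ℕ.+ n} (s≤s (s≤s z≤n)))

  0<B : 0# < B
  0<B = <-trans 0<1 1<B

  0<ℓ : 0# < ℓ
  0<ℓ = 0<log 1<B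

  log[W/B] : ∀ s → log (W s / B) ≡ g s - ℓ
  log[W/B] s = log-/ (0<W s) 0<B

  F≡ : ∀ s → F s ≡ ℓ - g s - (1# + s) * m s
  F≡ s = trans (cong (λ z → ((1# + s) * - D s) / W s - z) (log[W/B] s))
      (solve 5 (λ x₀ x₁ x₂ x₃ x₄ → ((:1 :+ x₀) :* (:- x₁) :* x₂ :- (x₃ :- x₄)) :=
            (x₄ :- x₃ :- (:1 :+ x₀) :* (x₁ :* x₂))) refl s (D s) ((W s) ⁻¹) (g s) ℓ)

  -- The heights at -1 of the tangents at s and t differ by the gap at s between g and the tangent
  -- at t, plus the drop m s - m t over the length 1 + s.
  F-increasing : ∀ {s t} → 0# ≤ s → s < t → F s < F t
  F-increasing {s} {t} 0≤s s<t@(_ , s≢t) = subst₂ _<_ (sym (F≡ s)) (sym (F≡ t))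
    (<-by (*-nonNegative {1# + s} {m s - m t} (≤-trans 0≤1 (≤-by 0≤s
        (solve 1 (λ x₀ → (:1 :+ x₀ :- :1) :=
              (x₀ :- :0)) refl
              s))) (<⇒≤ (<-by {0#} {m s - m t} (m-antitone s<t)
                  (solve 2 (λ x₀ x₁ → (x₀ :- x₁ :- :0) :=
                        (x₀ :- x₁)) refl
                        (m s) (m t)))) ⊕< tangent s≢t)
                            (solve 7 (λ x₀ x₁ x₂ x₃ x₄ x₅ x₆ → (x₀ :- x₁ :- (:1 :+ x₂) :* x₃ :- (x₀ :- x₄ :- (:1 :+ x₅) :* x₆)) :=
                                  ((:1 :+ x₅) :* (x₆ :- x₃) :+ x₄ :- (:0 :+ (x₁ :- (x₅ :- x₂) :* x₃)))) refl
                                  ℓ (g t) t (m t) (g s) s (m s)))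

  Q : ℝ
  Q = ∑ n (λ i → L i * L i)

  -- By the tangent at s, the fall of g is at most (t - s) m s. Rewriting (1 + s) m s with 1 + t
  -- cancels exactly this, and (1 + t) (m s - m t) remains.
  F-lipschitz : ∀ {s t T} → 0# ≤ s → s ≤ t → t ≤ T → F t - F s ≤ (1# + T) * Q * (t - s)
  F-lipschitz {s} {t} {T} 0≤s s≤t t≤T = subst₂ (λ x y → x - y ≤ (1# + T) * Q * (t - s)) (sym (F≡ t)) (sym (F≡ s))
    (≤-by (tangent-weak ⊕ 0≤1+t ⊗ m-lipschitz 0≤s s≤t ⊕ *-nonNegative 0≤t-s 0≤Q ⊗ t≤T)
        (solve 9 (λ x₀ x₁ x₂ x₃ x₄ x₅ x₆ x₇ x₈ → ((:1 :+ x₀) :* x₁ :* (x₂ :- x₃) :- (x₄ :- x₅ :- (:1 :+ x₂) :* x₆ :- (x₄ :- x₇ :- (:1 :+ x₃) :* x₈))) :=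
              (x₅ :+ (:1 :+ x₂) :* ((x₂ :- x₃) :* x₁) :+ (x₂ :- x₃) :* x₁ :* x₀ :- (x₇ :- (x₂ :- x₃) :* x₈ :+ (:1 :+ x₂) :* (x₈ :- x₆) :+ (x₂ :- x₃) :* x₁ :* x₂))) refl
              T Q t s ℓ (g t) (m t) (g s) (m s)))
    where
    0≤t-s : 0# ≤ t - s
    0≤t-s = ≤-by s≤t (solve 2 (λ x₀ x₁ → (x₀ :- x₁ :- :0) := (x₀ :- x₁)) refl t s)
    0≤1+t : 0# ≤ 1# + t
    0≤1+t = ≤-trans 0≤1 (≤-by (≤-trans 0≤s s≤t)
        (solve 1 (λ x₀ → (:1 :+ x₀ :- :1) := (x₀ :- :0)) refl t))
    0≤Q : 0# ≤ Q
    0≤Q = ∑-nonNegative n (λ i → square-nonNegative (L i))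
    tangent-weak : g s - (t - s) * m s ≤ g t
    tangent-weak = ≮⇒≥ (λ lt → <⇒≱ lt (from-dec (≤⊎> t s) ))
      where
      from-dec : t ≤ s ⊎ s < t → g s - (t - s) * m s ≤ g t
      from-dec (inj₂ (_ , s≢t)) = <⇒≤ (tangent (λ t≡s → s≢t (sym t≡s)))
      from-dec (inj₁ t≤s) = ≤-reflexive (trans (cong (λ z → g s - (z - s) * m s) (≤-antisym t≤s s≤t))
        (trans
            (solve 3 (λ x₀ x₁ x₂ → (x₀ :- (x₁ :- x₁) :* x₂) :=
                  (x₀)) refl (g s) s (m s)) (cong g (≤-antisym s≤t t≤s))))

  ∑-one : ∀ n → ∑ n (λ _ → 1#) ≡ fromℕ n
  ∑-one zero    = refl
  ∑-one (suc n) = cong (1# +_) (∑-one n)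

  -- At 0 every digit weighs 1, so g 0 = ℓ. This makes F 0 = -m 0 negative and also yields η < 1.
  W-0 : W 0# ≡ B
  W-0 = trans (cong (2# +_) (trans (∑-cong n e-0) (∑-one n)))
      (solve 1 (λ x₀ → (:1 :+ :1 :+ x₀) := (:1 :+ (:1 :+ x₀))) refl (fromℕ n))

  F-0 : F 0# < 0#
  F-0 = subst (_< 0#) (sym (F≡ 0#)) (<-by (0<m 0#)
    (trans (cong (λ z → 0# - (ℓ - log z - (1# + 0#) * m 0#)) W-0)
        (solve 2 (λ x₀ x₁ → (:0 :- (x₀ :- x₀ :- (:1 :+ :0) :* x₁)) := (x₁ :- :0)) refl ℓ (m 0#))))

  x*exp[-x]≤1 : ∀ x → x * exp (- x) ≤ 1#
  x*exp[-x]≤1 x = ≤-by (<⇒≤ (exp-positive (- x)) ⊗ 1+x≤exp x ⊕ <⇒≤ (exp-positive (- x)))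
    (≡-by (sym (exp-inverse x))
        (solve 3 (λ x₀ x₁ x₂ → (x₀ :* x₁ :+ x₀ :- (x₀ :* (:1 :+ x₂) :+ :0) :- (:1 :- x₂ :* x₀)) :=
              (x₁ :* x₀ :- :1)) refl (exp (- x)) (exp x) x))

  -- The square of x exp (-x) ≤ 1, taken at x / 2.
  x*x*exp[-x]≤4 : ∀ {x} → 0# ≤ x → x * x * exp (- x) ≤ 2# * 2#
  x*x*exp[-x]≤4 {x} 0≤x = ≤-by (<⇒≤ 0<2 ⊗ (<⇒≤ 0<2 ⊗ *-mono-≤ 0≤p 0≤1 (x*exp[-x]≤1 v) (x*exp[-x]≤1 v)))
    (trans (cong₂ (λ y z → 2# * 2# - y * y * z) (sym (x*½+x*½≡x x)) (trans (sym (exp-half (- x))) (cong (λ z → exp z * exp z) -x*½≡-v)))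
        (solve 2 (λ x₀ x₁ → ((:1 :+ :1) :* (:1 :+ :1) :- (x₀ :+ x₀) :* (x₀ :+ x₀) :* (x₁ :* x₁)) :=
              ((:1 :+ :1) :* ((:1 :+ :1) :* (:1 :* :1)) :- (:1 :+ :1) :* ((:1 :+ :1) :* (x₀ :* x₁ :* (x₀ :* x₁))))) refl
              v (exp (- v))))
    where
    v = x * ½
    -x*½≡-v : - x * ½ ≡ - v
    -x*½≡-v = solve 2 (λ x₀ x₁ → ((:- x₀) :* x₁) := (:- (x₀ :* x₁))) refl x ½
    0≤p : 0# ≤ v * exp (- v)
    0≤p = *-nonNegative (*-nonNegative 0≤x (<⇒≤ 0<½)) (<⇒≤ (exp-positive (- v)))

  -- The bounds below give E T ≤ C / T and D T ≤ 4 C / T^2. Hence B T (1 + T) m T ≤ 2 B T^2 D T ≤ 8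
  -- B C, while B T (ℓ - g T) ≥ T - C. So F T ≥ 0 once T - C ≥ 8 B C, and T = 1 + 9 B C suffices
  -- because B > 1.
  C T : ℝ
  C = ∑ n (λ i → L i ⁻¹)
  T = 1# + (B + B + B) * (C + C + C)

  0<C : 0# < C
  0<C = ∑-positive k (λ i → ⁻¹-positive (0<L i))

  1≤T : 1# ≤ T
  1≤T = ≤-by (*-nonNegative (<⇒≤ 0<B) (<⇒≤ 0<C) ⊕ <⇒≤ (*-positive (*-positive 0<2 (*-positive 0<2 0<2)) (*-positive 0<B 0<C)))
      (solve 2 (λ x₀ x₁ → (:1 :+ (x₀ :+ x₀ :+ x₀) :* (x₁ :+ x₁ :+ x₁) :- :1) :=
            (x₀ :* x₁ :+ (:1 :+ :1) :* ((:1 :+ :1) :* (:1 :+ :1)) :* (x₀ :* x₁) :- (:0 :+ :0))) refl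
            B C)

  0<T : 0# < T
  0<T = <-≤-trans 0<1 1≤T

  T*E≤C : T * E T ≤ C
  T*E≤C = subst (_≤ C) (∑-* n T (e T)) (∑-mono n {λ i → T * e T i} {λ i → L i ⁻¹} λ i _ →
    *-cancelˡ-≤ (0<L i) (≤-trans (≤-reflexive (trans
        (solve 3 (λ x₀ x₁ x₂ → (x₀ :* (x₁ :* x₂)) :=
              (x₁ :* x₀ :* x₂)) refl
              (L i) T (exp (- T * L i))) (cong (λ z → T * L i * exp z) -T*L)))
      (≤-trans (x*exp[-x]≤1 (T * L i)) (≤-reflexive (sym (x*x⁻¹≡1 (0<L i)))))))
    where
    -T*L : ∀ {i} → - T * L i ≡ - (T * L i)
    -T*L {i} = solve 2 (λ x₀ x₁ → ((:- x₀) :* x₁) := (:- (x₀ :* x₁))) refl T (L i)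

  T²*D≤4C : T * T * D T ≤ 2# * 2# * C
  T²*D≤4C = subst₂ _≤_ (∑-* n (T * T) (λ i → L i * e T i)) (∑-* n (2# * 2#) (λ i → L i ⁻¹))
    (∑-mono n {λ i → T * T * (L i * e T i)} {λ i → 2# * 2# * L i ⁻¹} λ i _ →
      *-cancelˡ-≤ (0<L i) (≤-trans (≤-reflexive (trans
          (solve 3 (λ x₀ x₁ x₂ → (x₀ :* (x₁ :* x₁ :* (x₀ :* x₂))) :=
                (x₁ :* x₀ :* (x₁ :* x₀) :* x₂)) refl
                (L i) T (exp (- T * L i))) (cong (λ z → T * L i * (T * L i) * exp z) -T*L)))
        (≤-trans (x*x*exp[-x]≤4 (*-nonNegative (<⇒≤ 0<T) (0≤L i)))
          (≤-reflexive (≡-by (cong (2# * 2# *_) (sym (x*x⁻¹≡1 (0<L i))))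
              (solve 2 (λ x₀ x₁ → (x₀ :* ((:1 :+ :1) :* (:1 :+ :1) :* x₁) :- (:1 :+ :1) :* (:1 :+ :1)) :=
                    ((:1 :+ :1) :* (:1 :+ :1) :* (x₀ :* x₁) :- (:1 :+ :1) :* (:1 :+ :1) :* :1)) refl
                    (L i) ((L i) ⁻¹)))))))
    where
    -T*L : ∀ {i} → - T * L i ≡ - (T * L i)
    -T*L {i} = solve 2 (λ x₀ x₁ → ((:- x₀) :* x₁) := (:- (x₀ :* x₁))) refl T (L i)

  m≤D : ∀ s → m s ≤ D s
  m≤D s = ≤-by (<⇒≤ (0<m s) ⊗ 1≤W s) (trans (cong (_- m s) (sym (W*m≡D s)))
      (solve 2 (λ x₀ x₁ → (x₀ :* x₁ :- x₁) := (x₁ :* x₀ :- x₁ :* :1)) refl (W s) (m s)))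

  -- From 1 + (g - ℓ) ≤ exp (g - ℓ) = W / B follows B (ℓ - g) ≥ B - W = n - E, and n ≥ 1.
  1-E≤B*y : 1# - E T ≤ B * (ℓ - g T)
  1-E≤B*y = ≤-by (<⇒≤ 0<B ⊗ 1+x≤exp (g T - ℓ) ⊕ fromℕ-mono-≤ {1} {n} (s≤s z≤n))
    (trans
        (solve 4 (λ x₀ x₁ x₂ x₃ → ((:1 :+ (:1 :+ x₀)) :* (x₁ :- x₂) :- (:1 :- x₃)) :=
              (:1 :+ :1 :+ x₃ :+ x₀ :- ((:1 :+ (:1 :+ x₀)) :* (:1 :+ (x₂ :- x₁)) :+ (:1 :+ :0)))) refl
              (fromℕ n) ℓ (g T) (E T)) (cong (λ z → z + fromℕ n - (B * (1# + (g T - ℓ)) + fromℕ 1)) B*exp))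
    where
    B*exp : W T ≡ B * exp (g T - ℓ)
    B*exp = trans (sym (y*[x/y]≡x 0<B)) (cong (B *_)
      (trans (sym (exp-log (*-positive (0<W T) (⁻¹-positive 0<B)))) (cong exp (log[W/B] T))))

  0≤F-T : 0# ≤ F T
  0≤F-T = subst (0# ≤_) (sym (F≡ T)) (≤-by (*-cancelˡ-≤ (*-positive 0<B 0<T) (begin
    B * T * ((1# + T) * m T)              ≤⟨ ≤-by (*-nonNegative (<⇒≤ 0<B) (*-nonNegative (<⇒≤ 0<T) (<⇒≤ (0<m T))) ⊗ 1≤T)
        (solve 3 (λ x₀ x₁ x₂ → (x₀ :* x₁ :* x₁ :* x₂ :+ x₀ :* x₁ :* x₁ :* x₂ :- x₀ :* x₁ :* ((:1 :+ x₁) :* x₂)) :=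
              (x₀ :* (x₁ :* x₂) :* x₁ :- x₀ :* (x₁ :* x₂) :* :1)) refl B T (m T)) ⟩
    B * T * T * m T + B * T * T * m T     ≤⟨ B*T²≥0 ⊗ m≤D T ⊕ B*T²≥0 ⊗ m≤D T ⟩
    B * T * T * D T + B * T * T * D T     ≤⟨ ≤-by (<⇒≤ 0<B ⊗ T²*D≤4C ⊕ <⇒≤ 0<B ⊗ T²*D≤4C)
        (solve 4 (λ x₀ x₁ x₂ x₃ → (x₀ :* x₁ :* ((:1 :+ :1) :* (:1 :+ :1) :* (:1 :+ :1)) :- (x₀ :* x₂ :* x₂ :* x₃ :+ x₀ :* x₂ :* x₂ :* x₃)) :=
              (x₀ :* ((:1 :+ :1) :* (:1 :+ :1) :* x₁) :+ x₀ :* ((:1 :+ :1) :* (:1 :+ :1) :* x₁) :- (x₀ :* (x₂ :* x₂ :* x₃) :+ x₀ :* (x₂ :* x₂ :* x₃)))) refl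
              B C T (D T)) ⟩
    B * C * (2# * 2# * 2#)                ≤⟨ ≤-by (<⇒≤ 0<C ⊗ <⇒≤ 1<B ⊕ 0≤1)
        (solve 2 (λ x₀ x₁ → (:1 :+ (x₀ :+ x₀ :+ x₀) :* (x₁ :+ x₁ :+ x₁) :- x₁ :- x₀ :* x₁ :* ((:1 :+ :1) :* (:1 :+ :1) :* (:1 :+ :1))) :=
              (x₁ :* x₀ :+ :1 :- (x₁ :* :1 :+ :0))) refl B C) ⟩
    T - C                                 ≤⟨ ≤-by T*E≤C
        (solve 3 (λ x₀ x₁ x₂ → (x₀ :* (:1 :- x₁) :- (x₀ :- x₂)) :=
              (x₂ :- x₀ :* x₁)) refl T (E T) C) ⟩
    T * (1# - E T)                        ≤⟨ <⇒≤ 0<T ⊗ 1-E≤B*y ⟩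
    T * (B * (ℓ - g T))
        ≡⟨ solve 4 (λ x₀ x₁ x₂ x₃ → (x₀ :* (x₁ :* (x₂ :- x₃))) :=
              (x₁ :* x₀ :* (x₂ :- x₃))) refl T B ℓ (g T) ⟩
    B * T * (ℓ - g T)                     ∎))
        (solve 4 (λ x₀ x₁ x₂ x₃ → (x₀ :- x₁ :- (:1 :+ x₂) :* x₃ :- :0) :=
              (x₀ :- x₁ :- (:1 :+ x₂) :* x₃)) refl ℓ (g T) T (m T)))
    where
    open ≤-Reasoning
    B*T²≥0 : 0# ≤ B * T * T
    B*T²≥0 = *-nonNegative (*-nonNegative (<⇒≤ 0<B) (<⇒≤ 0<T)) (<⇒≤ 0<T)

  critical-point : ∃[ s ] (0# < s × F s ≡ 0#)
  critical-point = positive (intermediate-value F {0#} {T} {(1# + T) * Q} (<⇒≤ 0<T) 0<K (<⇒≤ F-0) 0≤F-T (λ s t → F-lipschitz))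
    where
    0<K : 0# < (1# + T) * Q
    0<K = *-positive (<-by (<⇒≤ 0<T ⊕< 0<1)
        (solve 1 (λ x₀ → (:1 :+ x₀ :- :0) :=
              (x₀ :+ :1 :- (:0 :+ :0))) refl T)) (∑-positive k (λ i → *-positive (0<L i) (0<L i)))
    positive : ∃[ s ] (0# ≤ s × s ≤ T × F s ≡ 0#) → ∃[ s ] (0# < s × F s ≡ 0#)
    positive (s , 0≤s , _ , Fs≡0) = s , (0≤s , λ 0≡s → proj₂ F-0 (trans (cong F 0≡s) Fs≡0)) , Fs≡0

  critical-point-unique : ∀ {s t} → 0# < s → 0# < t → F s ≡ 0# → F t ≡ 0# → s ≡ t
  critical-point-unique {s} {t} 0<s 0<t Fs≡0 Ft≡0 = ≤-antisym
    (≮⇒≥ λ t<s → proj₂ (F-increasing (<⇒≤ 0<t) t<s) (trans Ft≡0 (sym Fs≡0)))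
    (≮⇒≥ λ s<t → proj₂ (F-increasing (<⇒≤ 0<s) s<t) (trans Fs≡0 (sym Ft≡0)))

  η : ℝ → ℝ
  η s = 1# + 1# / ((1# + s) * ℓ) * log (W s / B)

  0<[1+s]ℓ : ∀ {s} → 0# < s → 0# < (1# + s) * ℓ
  0<[1+s]ℓ {s} 0<s = *-positive (<-by (<⇒≤ 0<s ⊕< 0<1)
      (solve 1 (λ x₀ → (:1 :+ x₀ :- :0) := (x₀ :+ :1 :- (:0 :+ :0))) refl s)) 0<ℓ

  -- The form of η without division: the weights s and 1 of the geometric mean, applied to log x and
  -- to log x / ℓ digits, give (s ℓ + g) log x / ((1 + s) ℓ).
  [1+s]ℓη≡sℓ+g : ∀ {s} → 0# < s → (1# + s) * ℓ * η s ≡ s * ℓ + g s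
  [1+s]ℓη≡sℓ+g {s} 0<s = begin
    q * (1# + 1# / q * log (W s / B))      ≡⟨ cong (λ z → q * (1# + 1# / q * z)) (log[W/B] s) ⟩
    q * (1# + 1# / q * (g s - ℓ))
        ≡⟨ solve 4 (λ x₀ x₁ x₂ x₃ → (x₀ :* (:1 :+ :1 :* x₁ :* (x₂ :- x₃))) :=
              (x₀ :+ x₀ :* x₁ :* (x₂ :- x₃))) refl q (q ⁻¹) (g s) ℓ ⟩
    q + (q * q ⁻¹) * (g s - ℓ)             ≡⟨ cong (λ z → q + z * (g s - ℓ)) (x*x⁻¹≡1 (0<[1+s]ℓ 0<s)) ⟩
    q + 1# * (g s - ℓ)
        ≡⟨ solve 3 (λ x₀ x₁ x₂ → ((:1 :+ x₀) :* x₁ :+ :1 :* (x₂ :- x₁)) :=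
              (x₀ :* x₁ :+ x₂)) refl s ℓ (g s) ⟩
    s * ℓ + g s                            ∎
    where
    open ≡-Reasoning
    q = (1# + s) * ℓ

  0<η : ∀ {s} → 0# < s → 0# < η s
  0<η {s} 0<s = *-cancelˡ-< (0<[1+s]ℓ 0<s) (subst ((1# + s) * ℓ * 0# <_) (sym ([1+s]ℓη≡sℓ+g 0<s))
    (<-by (*-nonNegative (<⇒≤ 0<s) (<⇒≤ 0<ℓ) ⊕< 0<log (1<W s))
        (solve 3 (λ x₀ x₁ x₂ → (x₀ :* x₁ :+ x₂ :- (:1 :+ x₀) :* x₁ :* :0) :=
              (x₀ :* x₁ :+ x₂ :- (:0 :+ :0))) refl s ℓ (g s))))

  -- At 0 the tangent at s lies below g 0 = ℓ, so g s + s m s < ℓ and s ℓ + g s < (1 + s) ℓ.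
  η<1 : ∀ {s} → 0# < s → η s < 1#
  η<1 {s} 0<s@(_ , 0≢s) = *-cancelˡ-< (0<[1+s]ℓ 0<s) (subst (_< (1# + s) * ℓ * 1#) (sym ([1+s]ℓη≡sℓ+g 0<s))
    (<-by (*-nonNegative (<⇒≤ 0<s) (<⇒≤ (0<m s)) ⊕< tangent 0≢s)
      (trans
          (solve 4 (λ x₀ x₁ x₂ x₃ → ((:1 :+ x₀) :* x₁ :* :1 :- (x₀ :* x₁ :+ x₂)) :=
                (x₀ :* x₃ :+ x₁ :- (:0 :+ (x₂ :- (:0 :- x₀) :* x₃)))) refl
                s ℓ (g s) (m s)) (cong (λ z → s * m s + log z - (0# + (g s - (0# - s) * m s))) (sym W-0)))))

-- The derivative of the Dirichlet sum.

module DirichletDerivative (em : ExcludedMiddle 0ℓ) (R : Reals)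
  (k : ℕ) (L : ℕ → Reals.ℝ R) (0<L : ∀ i → Analysis._<_ R (Reals.0# R) (L i)) where

  open Analysis R
  open OrderedField em R
  open FiniteSums em R
  open Limits em R
  open ExponentialLaws em R
  open Logarithm em R
  open DirichletSum em R k L 0<L
  open IntegerCoefficientSolver commutativeRing

  remainder : ℝ → ℝ → ℕ → ℝ
  remainder s h i = e s i * (exp (- h * L i) - (1# + - h * L i))

  E-expansion : ∀ s h → E (s + h) - E s + h * D s ≡ ∑ n (remainder s h)
  E-expansion s h = sym (begin
    ∑ n (remainder s h)
      ≡⟨ ∑-cong n termwise ⟩
    ∑ n (λ i → 1# * e (s + h) i + 1# * (- 1# * e s i + h * (L i * e s i)))
      ≡⟨ ∑-linear n 1# (e (s + h)) 1# (λ i → - 1# * e s i + h * (L i * e s i)) ⟩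
    1# * E (s + h) + 1# * ∑ n (λ i → - 1# * e s i + h * (L i * e s i))
      ≡⟨ cong (λ z → 1# * E (s + h) + 1# * z) (∑-linear n (- 1#) (e s) h (λ i → L i * e s i)) ⟩
    1# * E (s + h) + 1# * (- 1# * E s + h * D s)
      ≡⟨ solve 4 (λ x₀ x₁ x₂ x₃ → (:1 :* x₀ :+ :1 :* ((:- :1) :* x₁ :+ x₂ :* x₃)) :=
            (x₀ :- x₁ :+ x₂ :* x₃)) refl (E (s + h)) (E s) h (D s) ⟩
    E (s + h) - E s + h * D s   ∎)
    where
    open ≡-Reasoning
    termwise : ∀ i → remainder s h i ≡ 1# * e (s + h) i + 1# * (- 1# * e s i + h * (L i * e s i))
    termwise i = begin
      e s i * (exp (- h * L i) - (1# + - h * L i))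
        ≡⟨ solve 4 (λ x₀ x₁ x₂ x₃ → (x₀ :* (x₁ :- (:1 :+ (:- x₂) :* x₃))) :=
              (x₀ :* x₁ :+ ((:- :1) :* x₀ :+ x₂ :* (x₃ :* x₀)))) refl
              (e s i) (exp (- h * L i)) h (L i) ⟩
      e s i * exp (- h * L i) + (- 1# * e s i + h * (L i * e s i))
        ≡⟨ cong (_+ (- 1# * e s i + h * (L i * e s i))) (trans (cong exp
            (solve 3 (λ x₀ x₁ x₂ → ((:- (x₀ :+ x₁)) :* x₂) :=
                  ((:- x₀) :* x₂ :+ (:- x₁) :* x₂)) refl
                  s h (L i))) (exp-+ (- s * L i) (- h * L i))) ⟨
      e (s + h) i + (- 1# * e s i + h * (L i * e s i))
        ≡⟨ solve 4 (λ x₀ x₁ x₂ x₃ → (x₀ :+ ((:- :1) :* x₁ :+ x₂ :* (x₃ :* x₁))) :=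
              (:1 :* x₀ :+ :1 :* ((:- :1) :* x₁ :+ x₂ :* (x₃ :* x₁)))) refl
              (e (s + h) i) (e s i) h (L i) ⟩
      1# * e (s + h) i + 1# * (- 1# * e s i + h * (L i * e s i))   ∎

  -- Each remainder lies between 0 and 2 h^2 (L i)^2 e s i once -h L i ≤ ½, so the quotient misses
  -- -D by at most C ∣ h ∣. The first bound on δ secures this condition, the second makes the error
  -- smaller than ε.
  E-derivative : ∀ s → HasDerivativeAt E s (- D s)
  E-derivative s ε 0<ε = proj₁ δ , 0<δ , close
    where
    C M : ℝ
    C = ∑ n (λ i → 2# * (e s i * (L i * L i)))
    M = 1# + ∑ n L
    0≤C : 0# ≤ C
    0≤C = ∑-nonNegative n (λ i → *-nonNegative (<⇒≤ 0<2) (*-nonNegative (<⇒≤ (0<e s i)) (square-nonNegative (L i))))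
    0<1+C : 0# < 1# + C
    0<1+C = <-by (0≤C ⊕< 0<1) (solve 1 (λ x₀ → (:1 :+ x₀ :- :0) := (x₀ :+ :1 :- (:0 :+ :0))) refl C)
    0<M : 0# < M
    0<M = <-by (∑-nonNegative n 0≤L ⊕< 0<1)
        (solve 1 (λ x₀ → (:1 :+ x₀ :- :0) := (x₀ :+ :1 :- (:0 :+ :0))) refl (∑ n L))
    δ = minimum (½ / M) (ε / (1# + C))
    0<δ : 0# < proj₁ δ
    0<δ = proj₂ (proj₂ (proj₂ δ)) (*-positive 0<½ (⁻¹-positive 0<M)) (*-positive 0<ε (⁻¹-positive 0<1+C))
    close : ∀ h → h ≢ 0# → ∣ h ∣ < proj₁ δ → ∣ (E (s + h) - E s) / h - - D s ∣ < ε
    close h h≢0 ∣h∣<δ = ≤-<-trans (∣quotient∣≤ {t} h≢0 (subst (0# ≤_) (sym t*h≡) 0≤rest) (subst (_≤ C * (h * h)) (sym t*h≡) rest≤))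
      (<-≤-trans (≤-<-trans (≤-by (0≤∣x∣ h)
          (solve 2 (λ x₀ x₁ → ((:1 :+ x₀) :* x₁ :- x₀ :* x₁) :=
                (x₁ :- :0)) refl C (∣ h ∣))) (0<1+C ⊗< ∣h∣<δ))
        (≤-trans (<⇒≤ 0<1+C ⊗ proj₁ (proj₂ (proj₂ δ))) (≤-reflexive (y*[x/y]≡x 0<1+C))))
      where
      t : ℝ
      t = (E (s + h) - E s) / h - - D s
      t*h≡ : t * h ≡ ∑ n (remainder s h)
      t*h≡ = begin
        ((E (s + h) - E s) / h - - D s) * h
            ≡⟨ solve 5 (λ x₀ x₁ x₂ x₃ x₄ → (((x₀ :- x₁) :* x₂ :- (:- x₃)) :* x₄) :=
                  ((x₀ :- x₁) :* (x₄ :* x₂) :+ x₄ :* x₃)) refl (E (s + h)) (E s) (h ⁻¹) (D s) h ⟩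
        (E (s + h) - E s) * (h * h ⁻¹) + h * D s    ≡⟨ cong (λ z → (E (s + h) - E s) * z + h * D s) (*-inverseʳ h h≢0) ⟩
        (E (s + h) - E s) * 1# + h * D s
            ≡⟨ solve 4 (λ x₀ x₁ x₂ x₃ → ((x₀ :- x₁) :* :1 :+ x₂ :* x₃) :=
                  (x₀ :- x₁ :+ x₂ :* x₃)) refl (E (s + h)) (E s) h (D s) ⟩
        E (s + h) - E s + h * D s                   ≡⟨ E-expansion s h ⟩
        ∑ n (remainder s h)                         ∎
        where open ≡-Reasoning
      0≤rest : 0# ≤ ∑ n (remainder s h)
      0≤rest = ∑-nonNegative n {remainder s h} (λ i → *-nonNegative (<⇒≤ (0<e s i))
        (≤-by {0#} {exp (- h * L i) - (1# + - h * L i)} (1+x≤exp (- h * L i))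
            (solve 3 (λ x₀ x₁ x₂ → (x₀ :- (:1 :+ (:- x₁) :* x₂) :- :0) :=
                  (x₀ :- (:1 :+ (:- x₁) :* x₂))) refl (exp (- h * L i)) h (L i))))
      small : ∀ i → i ℕ.< n → - h * L i ≤ ½
      small i i<n = begin
        - h * L i         ≤⟨ ≤-by (0≤L i ⊗ -x≤∣x∣ h)
            (solve 3 (λ x₀ x₁ x₂ → (x₀ :* x₁ :- (:- x₂) :* x₁) :=
                  (x₁ :* x₀ :- x₁ :* (:- x₂))) refl (∣ h ∣) (L i) h) ⟩
        ∣ h ∣ * L i       ≤⟨ 0≤∣x∣ h ⊗ ≤-trans (∑-member {n} {i} {L} 0≤L i<n) (≤-by 0≤1
            (solve 1 (λ x₀ → (:1 :+ x₀ :- x₀) := (:1 :- :0)) refl (∑ n L))) ⟩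
        ∣ h ∣ * M         ≤⟨ ≤-by (<⇒≤ 0<M ⊗ ≤-trans (<⇒≤ ∣h∣<δ) (proj₁ (proj₂ δ)))
            (solve 4 (λ x₀ x₁ x₂ x₃ → (x₀ :* (x₁ :* x₂) :- x₃ :* x₀) :=
                  (x₀ :* (x₁ :* x₂) :- x₀ :* x₃)) refl M ½ (M ⁻¹) (∣ h ∣)) ⟩
        M * (½ / M)       ≡⟨ y*[x/y]≡x 0<M ⟩
        ½                 ∎
        where open ≤-Reasoning
      rest≤ : ∑ n (remainder s h) ≤ C * (h * h)
      rest≤ = ≤-trans
        (∑-mono n {remainder s h} {λ i → h * h * (2# * (e s i * (L i * L i)))}
          (λ i i<n → ≤-by (<⇒≤ (0<e s i) ⊗ exp-quadratic (small i i<n))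
              (solve 4 (λ x₀ x₁ x₂ x₃ → (x₀ :* x₀ :* ((:1 :+ :1) :* (x₁ :* (x₂ :* x₂))) :- x₁ :* (x₃ :- (:1 :+ (:- x₀) :* x₂))) :=
                    (x₁ :* ((:1 :+ :1) :* ((:- x₀) :* x₂ :* ((:- x₀) :* x₂))) :- x₁ :* (x₃ :- (:1 :+ (:- x₀) :* x₂)))) refl
                    h (e s i) (L i) (exp (- h * L i)))))
        (≤-reflexive (trans (∑-* n (h * h) (λ i → 2# * (e s i * (L i * L i))))
            (solve 2 (λ x₀ x₁ → (x₀ :* x₀ :* x₁) :=
                  (x₁ :* (x₀ :* x₀))) refl h (∑ n (λ i → 2# * (e s i * (L i * L i)))))))

  -- Only differences of values matter, so the constant 1 in ζ = 1 + E drops out.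
  HasDerivativeAt-cong : ∀ {f f′ x L} → (∀ y z → f y - f z ≡ f′ y - f′ z) → HasDerivativeAt f x L → HasDerivativeAt f′ x L
  HasDerivativeAt-cong {f} {f′} {x} {L} same f→L ε 0<ε = proj₁ (f→L ε 0<ε) , proj₁ (proj₂ (f→L ε 0<ε)) , λ h h≢0 ∣h∣<δ →
    subst (λ z → ∣ z / h - L ∣ < ε) (same (x + h) x) (proj₂ (proj₂ (f→L ε 0<ε)) h h≢0 ∣h∣<δ)

-- Products of nonzero digits and the values they take.

module NonzeroDigits where

  open import Data.Nat.Base using (_+_; _*_; _<_; _≤_; _/_; _%_; _^_; NonZero; s<s)

  nonzeroProduct : List ℕ → ℕ
  nonzeroProduct ds = product (filter (λ d → ¬? (d ℕₚ.≟ 0)) ds)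

  factor : ℕ → ℕ
  factor zero    = 1
  factor (suc d) = suc d

  nonzeroProduct-∷ : ∀ d ds → nonzeroProduct (d ∷ ds) ≡ factor d * nonzeroProduct ds
  nonzeroProduct-∷ zero    ds = sym (ℕₚ.*-identityˡ _)
  nonzeroProduct-∷ (suc d) ds = refl

  digits-unique : ∀ {b} .{{_ : NonZero b}} {d e D E} → d < b → e < b → d + D * b ≡ e + E * b → d ≡ e × D ≡ E
  digits-unique {b} {d} {e} {D} {E} d<b e<b eq = d≡e , ℕₚ.*-cancelʳ-≡ D E b (ℕₚ.+-cancelˡ-≡ e _ _ (trans (cong (_+ D * b) (sym d≡e)) eq))
    where
    open ≡-Reasoning
    d≡e : d ≡ e
    d≡e = begin
      d                 ≡⟨ m<n⇒m%n≡m d<b ⟨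
      d % b             ≡⟨ [m+kn]%n≡m%n d D b ⟨
      (d + D * b) % b   ≡⟨ cong (_% b) eq ⟩
      (e + E * b) % b   ≡⟨ [m+kn]%n≡m%n e E b ⟩
      e % b             ≡⟨ m<n⇒m%n≡m e<b ⟩
      e                 ∎

  expansionProduct : ∀ {b} → Expansion b → ℕ
  expansionProduct ds = nonzeroProduct (map toℕ ds)

  expansionProduct-zero : ∀ {b} .{{_ : NonZero b}} (ds : Expansion b) → fromDigits ds ≡ 0 → expansionProduct ds ≡ 1
  expansionProduct-zero []       _  = refl
  expansionProduct-zero {b} (d ∷ ds) eq = begin
    nonzeroProduct (toℕ d ∷ map toℕ ds)        ≡⟨ nonzeroProduct-∷ (toℕ d) (map toℕ ds) ⟩
    factor (toℕ d) * expansionProduct ds       ≡⟨ cong₂ (λ d p → factor d * p) d≡0 (expansionProduct-zero ds (ℕₚ.m*n≡0⇒m≡0 (fromDigits ds) b (ℕₚ.m+n≡0⇒n≡0 (toℕ d) eq))) ⟩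
    1                                          ∎
    where
    open ≡-Reasoning
    d≡0 : toℕ d ≡ 0
    d≡0 = ℕₚ.m+n≡0⇒m≡0 (toℕ d) eq

  -- Zeros at the high end contribute the factor 1, so any expansion of n computes `p₀` and the
  -- algorithm of `toDigits` is never unfolded.
  expansionProduct-unique : ∀ {b} .{{_ : NonZero b}} (ds es : Expansion b) →
    fromDigits ds ≡ fromDigits es → expansionProduct ds ≡ expansionProduct es
  expansionProduct-unique []       es       eq = sym (expansionProduct-zero es (sym eq))
  expansionProduct-unique (d ∷ ds) []       eq = expansionProduct-zero (d ∷ ds) eq
  expansionProduct-unique (d ∷ ds) (e ∷ es) eq = begin
    nonzeroProduct (toℕ d ∷ map toℕ ds)        ≡⟨ nonzeroProduct-∷ (toℕ d) (map toℕ ds) ⟩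
    factor (toℕ d) * expansionProduct ds       ≡⟨ cong₂ (λ d p → factor d * p) (proj₁ same) (expansionProduct-unique ds es (proj₂ same)) ⟩
    factor (toℕ e) * expansionProduct es       ≡⟨ nonzeroProduct-∷ (toℕ e) (map toℕ es) ⟨
    nonzeroProduct (toℕ e ∷ map toℕ es)        ∎
    where
    open ≡-Reasoning
    same = digits-unique (toℕ<n d) (toℕ<n e) eq

  0<factor : ∀ d → 0 < factor d
  0<factor zero    = s≤s z≤n
  0<factor (suc d) = s≤s z≤n

  0<nonzeroProduct : ∀ ds → 0 < nonzeroProduct ds
  0<nonzeroProduct []       = s≤s z≤n
  0<nonzeroProduct (d ∷ ds) = subst (0 <_) (sym (nonzeroProduct-∷ d ds)) (ℕₚ.*-mono-< (0<factor d) (0<nonzeroProduct ds))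

  0<p₀ : ∀ b (b≥2 : 2 ≤ b) n → 0 < p₀ b b≥2 n
  0<p₀ b b≥2 n = 0<nonzeroProduct (map toℕ (proj₁ (toDigits b {fromWitness b≥2} n)))

  p₀-0 : ∀ b (b≥2 : 2 ≤ b) → p₀ b b≥2 0 ≡ 1
  p₀-0 b@(suc _) b≥2 = expansionProduct-zero (proj₁ digits) (proj₂ digits)
    where digits = toDigits b {fromWitness b≥2} 0

  -- The digits of q with r put before them form an expansion of r + q b, though perhaps not the one
  -- `toDigits` returns.
  p₀-+* : ∀ b (b≥2 : 2 ≤ b) {r} q → r < b → p₀ b b≥2 (r + q * b) ≡ factor r * p₀ b b≥2 q
  p₀-+* b@(suc _) b≥2 {r} q r<b = begin
    p₀ b b≥2 (r + q * b)                            ≡⟨ expansionProduct-unique (proj₁ n-digits) (fromℕ< r<b ∷ proj₁ q-digits) same ⟩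
    expansionProduct (fromℕ< r<b ∷ proj₁ q-digits)  ≡⟨ nonzeroProduct-∷ (toℕ (fromℕ< r<b)) (map toℕ (proj₁ q-digits)) ⟩
    factor (toℕ (fromℕ< r<b)) * p₀ b b≥2 q          ≡⟨ cong (λ d → factor d * p₀ b b≥2 q) (toℕ-fromℕ< r<b) ⟩
    factor r * p₀ b b≥2 q                           ∎
    where
    open ≡-Reasoning
    n-digits = toDigits b {fromWitness b≥2} (r + q * b)
    q-digits = toDigits b {fromWitness b≥2} q
    same : fromDigits (proj₁ n-digits) ≡ fromDigits (fromℕ< r<b ∷ proj₁ q-digits)
    same = trans (proj₂ n-digits) (sym (cong₂ (λ d D → d + D * b) (toℕ-fromℕ< r<b) (proj₂ q-digits)))

  -- The products of the powers i ^ e with 1 ≤ i ≤ d and 0 ≤ e ≤ N, one exponent for each i. The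
  -- factor 1 is left out, and entries may repeat: only the length (N + 1) ^ d matters.
  values : ℕ → ℕ → List ℕ
  -- Base case `d = 0`, the empty product; the clause below also treats i = 1, at the cost of a
  -- factor N + 1 in the length.
  values zero    N = 1 ∷ []
  values (suc d) N = cartesianProductWith (λ e v → suc d ^ e * v) (upTo (suc N)) (values d N)

  length-cartesianProductWith : ∀ (f : ℕ → ℕ → ℕ) xs ys → length (cartesianProductWith f xs ys) ≡ length xs * length ys
  length-cartesianProductWith f []       ys = refl
  length-cartesianProductWith f (x ∷ xs) ys = trans (length-++ (map (f x) ys))
    (cong₂ _+_ (length-map (f x) ys) (length-cartesianProductWith f xs ys))

  length-values : ∀ d N → length (values d N) ≡ suc N ^ d
  length-values zero    N = refl
  length-values (suc d) N = trans (length-cartesianProductWith _ (upTo (suc N)) (values d N))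
    (cong₂ _*_ (length-upTo (suc N)) (length-values d N))

  power*value∈values : ∀ {d N e v} → e < suc N → v ∈ values d N → suc d ^ e * v ∈ values (suc d) N
  power*value∈values {d} e≤N v∈ = ∈-cartesianProductWith⁺ (λ e v → suc d ^ e * v) (∈-upTo⁺ e≤N) v∈

  1∈values : ∀ d N → 1 ∈ values d N
  1∈values zero    N = here refl
  1∈values (suc d) N = power*value∈values {d} {N} {0} {1} (s≤s z≤n) (1∈values d N)

  values-mono : ∀ d {N m} → m ∈ values d N → m ∈ values d (suc N)
  values-mono zero    m∈ = m∈
  values-mono (suc d) {N} m∈ with ∈-cartesianProductWith⁻ (λ e v → suc d ^ e * v) (upTo (suc N)) (values d N) m∈
  ... | e , v , e∈ , v∈ , refl = power*value∈values {d} (ℕₚ.m<n⇒m<1+n (∈-upTo⁻ e∈)) (values-mono d v∈)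

  -- A nonzero digit r raises its own exponent by 1. The recursion on d walks down to it; the other
  -- exponents only get a larger range.
  factor*value∈values : ∀ d {N r m} → r ≤ d → m ∈ values d N → factor r * m ∈ values d (suc N)
  factor*value∈values d {N} {zero} {m} _ m∈ = subst (_∈ values d (suc N)) (sym (ℕₚ.*-identityˡ m)) (values-mono d m∈)
  factor*value∈values (suc d) {N} {suc r} (s≤s r≤d) m∈
    with ∈-cartesianProductWith⁻ (λ e v → suc d ^ e * v) (upTo (suc N)) (values d N) m∈
  ... | e , v , e∈ , v∈ , refl with ℕₚ.m≤n⇒m<n∨m≡n r≤d
  ...   | inj₂ refl = subst (_∈ values (suc d) (suc N)) (ℕₚ.*-assoc (suc d) (suc d ^ e) v)
    (power*value∈values {d} (s<s (∈-upTo⁻ e∈)) (values-mono d v∈))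
  ...   | inj₁ r<d  = subst (_∈ values (suc d) (suc N)) (swap (suc d ^ e) (suc r) v)
    (power*value∈values {d} (ℕₚ.m<n⇒m<1+n (∈-upTo⁻ e∈)) (factor*value∈values d r<d v∈))
    where
    swap : ∀ x y z → x * (y * z) ≡ y * (x * z)
    swap x y z = trans (sym (ℕₚ.*-assoc x y z)) (trans (cong (_* z) (ℕₚ.*-comm x y)) (ℕₚ.*-assoc y x z))

  p₀∈values : ∀ d (b≥2 : 2 ≤ suc d) N {n} → n < suc d ^ N → p₀ (suc d) b≥2 n ∈ values d N
  p₀∈values d b≥2 zero    {zero}  _ = subst (_∈ values d 0) (sym (p₀-0 (suc d) b≥2)) (1∈values d 0)
  p₀∈values d b≥2 zero    {suc n} (s≤s ())
  p₀∈values d b≥2 (suc N) {n} n<b^1+N = subst (λ k → p₀ (suc d) b≥2 k ∈ values d (suc N)) (sym (m≡m%n+[m/n]*n n (suc d)))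
    (subst (_∈ values d (suc N)) (sym (p₀-+* (suc d) b≥2 (n / suc d) (m%n<n n (suc d))))
      (factor*value∈values d (ℕₚ.≤-pred (m%n<n n (suc d))) (p₀∈values d b≥2 N
        (m<n*o⇒m/o<n {n} {suc d ^ N} (subst (n <_) (ℕₚ.*-comm (suc d) (suc d ^ N)) n<b^1+N)))))

-- Counting by sums of indicators.

module Counting (em : ExcludedMiddle 0ℓ) (R : Reals) where

  open Analysis R
  open OrderedField em R
  open FiniteSums em R
  open IntegerCoefficientSolver commutativeRing
  open CommutativeRing commutativeRing using (+-comm; *-comm; +-identityˡ; +-identityʳ; *-identityˡ; *-identityʳ; zeroˡ; zeroʳ)

  HasCardinality-unique : ∀ {P j k} → HasCardinality P j → HasCardinality P k → j ≡ k
  HasCardinality-unique (xs , xs! , xs⇔P , refl) (ys , ys! , ys⇔P , refl) =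
    ↭-length (∼bag⇒↭ (unique∧set⇒bag xs! ys! (λ {n} → Composition._⇔-∘_ (Symmetry.⇔-sym (ys⇔P n)) (xs⇔P n))))

  #≡ : ∀ {P k} → HasCardinality P k → # P ≡ fromℕ k
  #≡ {P} {k} P-k = sup-singleton _ (k , P-k , refl) (λ { _ (j , P-j , refl) → cong fromℕ (HasCardinality-unique P-j P-k) })

  indicator : {P : Set} → Dec P → ℝ
  indicator (yes _) = 1#
  indicator (no _)  = 0#

  -- Excluded middle turns any predicate into a real weight, so that counts are instances of `∑`.
  χ : Set → ℝ
  χ P = indicator (em {P})

  0≤χ : ∀ P → 0# ≤ χ P
  0≤χ P with em {P}
  ... | yes _ = 0≤1
  ... | no _  = ≤-refl

  χ-yes : ∀ {P} → P → χ P ≡ 1#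
  χ-yes {P} p with em {P}
  ... | yes _ = refl
  ... | no ¬p = contradiction p ¬p

  χ-no : ∀ {P} → ¬ P → χ P ≡ 0#
  χ-no {P} ¬p with em {P}
  ... | yes p = contradiction p ¬p
  ... | no _  = refl

  χ-elim : ∀ P {y z} → 0# ≤ z → (P → y ≤ z) → χ P * y ≤ z
  χ-elim P {y} {z} 0≤z y≤z with em {P}
  ... | yes p = subst (_≤ z) (sym (*-identityˡ y)) (y≤z p)
  ... | no _  = subst (_≤ z) (sym (zeroˡ y)) 0≤z

  χ-mono : ∀ {P Q} → (P → Q) → χ P ≤ χ Q
  χ-mono {P} {Q} P⇒Q = subst (_≤ χ Q) (*-identityʳ (χ P)) (χ-elim P (0≤χ Q) (λ p → ≤-reflexive (sym (χ-yes (P⇒Q p)))))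

  χ-⊎ : ∀ {P Q S} → (P → Q ⊎ S) → χ P ≤ χ Q + χ S
  χ-⊎ {P} {Q} {S} P⇒Q⊎S = subst (_≤ χ Q + χ S) (*-identityʳ (χ P)) (χ-elim P (subst (_≤ χ Q + χ S) (+-identityˡ 0#) (0≤χ Q ⊕ 0≤χ S))
    (λ p → [ (λ q → ≤-by (0≤χ S) (trans (cong (λ z → z + χ S - 1#) (χ-yes q))
        (solve 1 (λ x₀ → (:1 :+ x₀ :- :1) := (x₀ :- :0)) refl (χ S))))
           , (λ s → ≤-by (0≤χ Q) (trans (cong (λ z → χ Q + z - 1#) (χ-yes s))
               (solve 1 (λ x₀ → (x₀ :+ :1 :- :1) := (x₀ :- :0)) refl (χ Q)))) ]′ (P⇒Q⊎S p)))

  -- `downFrom` lists the largest number first, which matches `∑-last`.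
  length-filter : ∀ (P : ℕ → Set) K → fromℕ (length (filter (λ n → em {P n}) (downFrom K))) ≡ ∑ K (λ n → χ (P n))
  length-filter P zero    = refl
  length-filter P (suc K) = trans (step (length-filter P K)) (sym (∑-last K (λ n → χ (P n))))
    where
    step : fromℕ (length (filter (λ n → em {P n}) (downFrom K))) ≡ ∑ K (λ n → χ (P n)) →
           fromℕ (length (filter (λ n → em {P n}) (downFrom (suc K)))) ≡ ∑ K (λ n → χ (P n)) + χ (P K)
    step ih with em {P K}
    ... | yes _ = trans (cong (1# +_) ih) (+-comm 1# _)
    ... | no _  = trans ih (sym (+-identityʳ _))

  #≡∑ : ∀ (P : ℕ → Set) K → (∀ n → P n → n ℕ.< K) → # P ≡ ∑ K (λ n → χ (P n))
  #≡∑ P K bounded = trans (#≡ cardinality) (length-filter P K)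
    where
    P? = λ n → em {P n}
    cardinality : HasCardinality P (length (filter P? (downFrom K)))
    cardinality = filter P? (downFrom K) , Unique.filter⁺ P? (Unique.downFrom⁺ K) ,
      (λ n → mk⇔ (λ n∈ → proj₂ (∈-filter⁻ P? {xs = downFrom K} n∈)) (λ Pn → ∈-filter⁺ P? (∈-downFrom⁺ (bounded n Pn)) Pn)) , refl

  -- Carries quotient c and remainder r of T by m + 1, so that the induction on T knows whether the
  -- next number is a multiple: exactly when r = m.
  count-multiples : ∀ m T → ∃[ c ] ∃[ r ] (∑ (suc T) (λ n → χ (0 ℕ.< n × suc m ∣ n)) ≡ fromℕ c × c ℕ.* suc m ℕ.+ r ≡ T × r ℕ.≤ m)
  count-multiples m zero    = 0 , 0 , trans (+-identityʳ _) (χ-no (λ ())) , refl , z≤n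
  count-multiples m (suc T) = step (count-multiples m T)
    where
    χₙ : ℕ → ℝ
    χₙ n = χ (0 ℕ.< n × suc m ∣ n)
    step : ∃[ c ] ∃[ r ] (∑ (suc T) χₙ ≡ fromℕ c × c ℕ.* suc m ℕ.+ r ≡ T × r ℕ.≤ m) →
           ∃[ c ] ∃[ r ] (∑ (suc (suc T)) χₙ ≡ fromℕ c × c ℕ.* suc m ℕ.+ r ≡ suc T × r ℕ.≤ m)
    step (c , r , ∑≡c , refl , r≤m) with ℕₚ.m≤n⇒m<n∨m≡n r≤m
    ... | inj₁ r<m = c , suc r , trans (∑-last (suc T) χₙ) (trans (cong₂ _+_ ∑≡c (χ-no no-multiple)) (+-identityʳ _)) ,
      ℕₚ.+-suc (c ℕ.* suc m) r , r<m
      where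
      no-multiple : ¬ (0 ℕ.< suc T × suc m ∣ suc T)
      no-multiple (_ , m∣T) = ℕₚ.<⇒≱ (s≤s r<m) (∣⇒≤ (∣m+n∣m⇒∣n (subst (suc m ∣_) (sym (ℕₚ.+-suc (c ℕ.* suc m) r)) m∣T) (n∣m*n c)))
    ... | inj₂ refl = suc c , 0 , trans (∑-last (suc T) χₙ) (trans (cong₂ _+_ ∑≡c (χ-yes (s≤s z≤n , divides (suc c) multiple))) (+-comm _ _)) ,
      trans (ℕₚ.+-identityʳ _) (sym multiple) , z≤n
      where
      multiple : suc (c ℕ.* suc m ℕ.+ m) ≡ suc c ℕ.* suc m
      multiple = cong suc (ℕₚ.+-comm (c ℕ.* suc m) m)

  multiples-bound : ∀ m T → ∑ (suc T) (λ n → χ (0 ℕ.< n × suc m ∣ n)) * fromℕ (suc m) ≤ fromℕ T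
  multiples-bound m T = bound (count-multiples m T)
    where
    bound : ∃[ c ] ∃[ r ] (∑ (suc T) (λ n → χ (0 ℕ.< n × suc m ∣ n)) ≡ fromℕ c × c ℕ.* suc m ℕ.+ r ≡ T × r ℕ.≤ m) →
            ∑ (suc T) (λ n → χ (0 ℕ.< n × suc m ∣ n)) * fromℕ (suc m) ≤ fromℕ T
    bound (c , r , ∑≡c , eq , _) = ≤-trans (≤-reflexive (trans (cong (_* fromℕ (suc m)) ∑≡c) (sym (fromℕ-* c (suc m)))))
      (fromℕ-mono-≤ (ℕₚ.m+n≤o⇒m≤o (c ℕ.* suc m) (ℕₚ.≤-reflexive eq)))

  -- The union bound over the possible values of p.
  count-by-value : ∀ K (A : ℕ → Set) (p : ℕ → ℕ) M → (∀ m → ∑ K (λ n → χ (A n × p n ≡ m)) ≤ M) →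
    ∀ vs → ∑ K (λ n → χ (A n × p n ∈ vs)) ≤ fromℕ (length vs) * M
  count-by-value K A p M each []       = ≤-trans
    (∑-mono K {λ n → χ (A n × p n ∈ [])} {λ _ → 0#} (λ n _ → ≤-reflexive (χ-no (λ { (_ , ()) }))))
    (≤-reflexive (trans (∑-zero K) (sym (zeroˡ M))))
  count-by-value K A p M each (v ∷ vs) = ≤-trans
    (∑-mono K {λ n → χ (A n × p n ∈ v ∷ vs)} {λ n → χ (A n × p n ≡ v) + χ (A n × p n ∈ vs)}
      (λ n _ → χ-⊎ (λ { (a , here p≡v) → inj₁ (a , p≡v) ; (a , there p∈vs) → inj₂ (a , p∈vs) })))
    (≤-trans (≤-reflexive (∑-+ K (λ n → χ (A n × p n ≡ v)) (λ n → χ (A n × p n ∈ vs))))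
      (≤-trans (each v ⊕ count-by-value K A p M each vs) (≤-reflexive
          (solve 2 (λ x₀ x₁ → (x₀ :+ x₁ :* x₀) := ((:1 :+ x₁) :* x₀)) refl M (fromℕ (length vs))))))

  -- Summation by blocks: over q b, ..., q b + b - 1 the sum of f is f q times the sum of w.
  ∑-digits : ∀ b f w → (∀ r q → r ℕ.< b → f (r ℕ.+ q ℕ.* b) ≡ w r * f q) → ∀ M → ∑ (M ℕ.* b) f ≡ ∑ b w * ∑ M f
  ∑-digits b f w step zero    = sym (zeroʳ _)
  ∑-digits b f w step (suc M) = begin
    ∑ (b ℕ.+ M ℕ.* b) f                                  ≡⟨ cong (λ n → ∑ n f) (ℕₚ.+-comm b (M ℕ.* b)) ⟩
    ∑ (M ℕ.* b ℕ.+ b) f                                  ≡⟨ ∑-concat (M ℕ.* b) b f ⟩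
    ∑ (M ℕ.* b) f + ∑ b (λ r → f (M ℕ.* b ℕ.+ r))        ≡⟨ cong₂ _+_ (∑-digits b f w step M) block ⟩
    ∑ b w * ∑ M f + f M * ∑ b w
        ≡⟨ solve 3 (λ x₀ x₁ x₂ → (x₀ :* x₁ :+ x₂ :* x₀) :=
              (x₀ :* (x₁ :+ x₂))) refl (∑ b w) (∑ M f) (f M) ⟩
    ∑ b w * (∑ M f + f M)                                ≡⟨ cong (∑ b w *_) (∑-last M f) ⟨
    ∑ b w * ∑ (suc M) f                                  ∎
    where
    open ≡-Reasoning
    block : ∑ b (λ r → f (M ℕ.* b ℕ.+ r)) ≡ f M * ∑ b w
    block = trans (∑-cong-< b (λ r r<b → trans (cong f (ℕₚ.+-comm (M ℕ.* b) r)) (trans (step r M r<b) (*-comm _ _)))) (∑-* b (f M) w)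
      where
      ∑-cong-< : ∀ n {f g} → (∀ i → i ℕ.< n → f i ≡ g i) → ∑ n f ≡ ∑ n g
      ∑-cong-< zero    f≡g = refl
      ∑-cong-< (suc n) f≡g = cong₂ _+_ (f≡g 0 (s≤s z≤n)) (∑-cong-< n (λ i i<n → f≡g (suc i) (s≤s i<n)))

  -- Numbers below b ^ N are words of N digits. The step at r = q = 0 forces w 0 = 1, so leading
  -- zeros have no effect.
  ∑-digits-power : ∀ b f w → f 0 ≡ 1# → (∀ r q → r ℕ.< b → f (r ℕ.+ q ℕ.* b) ≡ w r * f q) →
    ∀ N → ∑ (b ℕ.^ N) f ≡ ∑ b w ^ℕ N
  ∑-digits-power b f w f0≡1 step zero    = trans (+-identityʳ _) f0≡1
  ∑-digits-power b f w f0≡1 step (suc N) = begin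
    ∑ (b ℕ.* b ℕ.^ N) f        ≡⟨ cong (λ n → ∑ n f) (ℕₚ.*-comm b (b ℕ.^ N)) ⟩
    ∑ (b ℕ.^ N ℕ.* b) f        ≡⟨ ∑-digits b f w step (b ℕ.^ N) ⟩
    ∑ b w * ∑ (b ℕ.^ N) f      ≡⟨ cong (∑ b w *_) (∑-digits-power b f w f0≡1 step N) ⟩
    ∑ b w * ∑ b w ^ℕ N         ∎
    where open ≡-Reasoning

-- The counting bound and its error term.

module DigitProducts (em : ExcludedMiddle 0ℓ) (R : Reals) (k : ℕ) where

  open Analysis R
  open OrderedField em R
  open FiniteSums em R
  open Limits em R
  open ExponentialLaws em R
  open Logarithm em R
  open Counting em R
  open NonzeroDigits
  open IntegerCoefficientSolver commutativeRing
  open CommutativeRing commutativeRing using (*-comm; +-identityʳ; zeroˡ)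

  -- The largest digit and the base. The digits from 2 to d number k + 1, so `B` computes to
  -- `fromℕ b`, and `L i` is the logarithm of the digit i + 2.
  d b : ℕ
  d = suc (suc k)
  b = suc d

  L : ℕ → ℝ
  L i = log (fromℕ (2 ℕ.+ i))

  0<L : ∀ i → 0# < L i
  0<L i = 0<log (subst (_< fromℕ (2 ℕ.+ i)) (+-identityʳ 1#) (fromℕ-mono-< {1} {2 ℕ.+ i} (s≤s (s≤s z≤n))))

  open DirichletSum em R k L 0<L
  open CriticalPoint em R k L 0<L

  exp-fromℕ* : ∀ N {y} → 0# < y → exp (fromℕ N * log y) ≡ y ^ℕ N
  exp-fromℕ* zero    {y} 0<y = trans (cong exp (zeroˡ (log y))) exp-0
  exp-fromℕ* (suc N) {y} 0<y = begin
    exp ((1# + fromℕ N) * log y)              ≡⟨ cong exp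
        (solve 2 (λ x₀ x₁ → ((:1 :+ x₀) :* x₁) := (x₁ :+ x₀ :* x₁)) refl (fromℕ N) (log y)) ⟩
    exp (log y + fromℕ N * log y)             ≡⟨ exp-+ (log y) (fromℕ N * log y) ⟩
    exp (log y) * exp (fromℕ N * log y)       ≡⟨ cong₂ _*_ (exp-log 0<y) (exp-fromℕ* N 0<y) ⟩
    y * y ^ℕ N                                ∎
    where open ≡-Reasoning

  fromℕ-^ : ∀ m N → fromℕ (m ℕ.^ N) ≡ fromℕ m ^ℕ N
  fromℕ-^ m zero    = +-identityʳ 1#
  fromℕ-^ m (suc N) = trans (fromℕ-* m (m ℕ.^ N)) (cong (fromℕ m *_) (fromℕ-^ m N))

  exp-fromℕ*log : ∀ m N → 0 ℕ.< m → exp (fromℕ N * log (fromℕ m)) ≡ fromℕ (m ℕ.^ N)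
  exp-fromℕ*log m N 0<m = trans (exp-fromℕ* N (0<fromℕ {m} 0<m)) (sym (fromℕ-^ m N))

  -- The power m ^ (-s), already unfolded to `exp` and `log`.
  power : ℝ → ℕ → ℝ
  power s m = exp (- s * log (fromℕ m))

  power-1 : ∀ s → power s 1 ≡ 1#
  power-1 s = trans (cong exp (trans (cong (- s *_) (trans (cong log (+-identityʳ 1#)) log-1))
      (solve 1 (λ x₀ → ((:- x₀) :* :0) := (:0)) refl s))) exp-0

  power-* : ∀ s m n → 0 ℕ.< m → 0 ℕ.< n → power s (m ℕ.* n) ≡ power s m * power s n
  power-* s m n 0<m 0<n = trans (cong exp (begin
    - s * log (fromℕ (m ℕ.* n))                     ≡⟨ cong (λ z → - s * log z) (fromℕ-* m n) ⟩
    - s * log (fromℕ m * fromℕ n)                   ≡⟨ cong (- s *_) (log-* (0<fromℕ {m} 0<m) (0<fromℕ {n} 0<n)) ⟩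
    - s * (log (fromℕ m) + log (fromℕ n))
        ≡⟨ solve 3 (λ x₀ x₁ x₂ → ((:- x₀) :* (x₁ :+ x₂)) :=
              ((:- x₀) :* x₁ :+ (:- x₀) :* x₂)) refl s (log (fromℕ m)) (log (fromℕ n)) ⟩
    - s * log (fromℕ m) + - s * log (fromℕ n)       ∎)) (exp-+ (- s * log (fromℕ m)) (- s * log (fromℕ n)))
    where open ≡-Reasoning

  ∑-factor : ∀ s → ∑ b (λ r → power s (factor r)) ≡ W s
  ∑-factor s = trans (cong (λ z → z + (z + E s)) (power-1 s))
      (solve 1 (λ x₀ → (:1 :+ (:1 :+ x₀)) := (:1 :+ :1 :+ x₀)) refl (E s))

  module _ (b≥2 : 2 ℕ.≤ b) where

    p : ℕ → ℕ
    p = p₀ b b≥2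

    ∑-power : ∀ s N → ∑ (b ℕ.^ N) (λ n → power s (p n)) ≡ exp (fromℕ N * g s)
    ∑-power s N = begin
      ∑ (b ℕ.^ N) (λ n → power s (p n))            ≡⟨ ∑-digits-power b (λ n → power s (p n)) (λ r → power s (factor r)) at-0 step N ⟩
      ∑ b (λ r → power s (factor r)) ^ℕ N          ≡⟨ cong (_^ℕ N) (∑-factor s) ⟩
      W s ^ℕ N                                     ≡⟨ exp-fromℕ* N (0<W s) ⟨
      exp (fromℕ N * g s)                          ∎
      where
      open ≡-Reasoning
      at-0 : power s (p 0) ≡ 1#
      at-0 = trans (cong (power s) (p₀-0 b b≥2)) (power-1 s)
      step : ∀ r q → r ℕ.< b → power s (p (r ℕ.+ q ℕ.* b)) ≡ power s (factor r) * power s (p q)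
      step r q r<b = trans (cong (power s) (p₀-+* b b≥2 q r<b)) (power-* s (factor r) (p q) (0<factor r) (0<p₀ b b≥2 q))

    module _ {s : ℝ} (0<s : 0# < s) (x : ℝ) (1≤x : 1# ≤ x) where

      X : ℝ
      X = log x

      0<x : 0# < x
      0<x = <-≤-trans 0<1 1≤x

      0≤X : 0# ≤ X
      0≤X = subst (_≤ X) log-1 (log-mono-≤ 0<1 1≤x)

      T-floor : ∃[ m ] (fromℕ m ≤ x × x < fromℕ (suc m))
      T-floor = floor x (<⇒≤ 0<x)

      ⌊x⌋ : ℕ
      ⌊x⌋ = proj₁ T-floor

      N-floor : ∃[ m ] (fromℕ m ≤ X / ℓ × X / ℓ < fromℕ (suc m))
      N-floor = floor (X / ℓ) (*-nonNegative 0≤X (<⇒≤ (⁻¹-positive 0<ℓ)))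

      -- The number of base b digits of ⌊x⌋.
      N : ℕ
      N = suc (proj₁ N-floor)

      N≤ : fromℕ N ≤ X / ℓ + 1#
      N≤ = ≤-by (proj₁ (proj₂ N-floor))
          (solve 3 (λ x₀ x₁ x₂ → (x₀ :* x₁ :+ :1 :- (:1 :+ x₂)) :=
                (x₀ :* x₁ :- x₂)) refl X (ℓ ⁻¹) (fromℕ (N-floor .proj₁)))

      x<b^N : x < fromℕ (b ℕ.^ N)
      x<b^N = subst₂ _<_ (exp-log 0<x) (exp-fromℕ*log b N (s≤s z≤n))
        (exp-mono-< (subst (_< fromℕ N * ℓ) (y*[x/y]≡x 0<ℓ) (subst (ℓ * (X / ℓ) <_) (*-comm ℓ (fromℕ N)) (0<ℓ ⊗< proj₂ (proj₂ N-floor)))))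

      1+⌊x⌋≤b^N : suc ⌊x⌋ ℕ.≤ b ℕ.^ N
      1+⌊x⌋≤b^N = ℕₚ.≰⇒> (λ b^N≤⌊x⌋ → <⇒≱ x<b^N (≤-trans (fromℕ-mono-≤ b^N≤⌊x⌋) (proj₁ (proj₂ T-floor))))

      𝒩 : ℕ → Set
      𝒩 = 𝒩₀ b b≥2 x

      𝒩-bounded : ∀ n → 𝒩 n → n ℕ.< suc ⌊x⌋
      𝒩-bounded n (_ , n≤x , _) = ℕₚ.≰⇒> (λ 1+⌊x⌋≤n → <⇒≱ (proj₂ (proj₂ T-floor)) (≤-trans (fromℕ-mono-≤ 1+⌊x⌋≤n) n≤x))

      -- The logarithm of the geometric mean of x and W ^ N with weights s / (1 + s) and 1 / (1 +
      -- s).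
      μ : ℝ
      μ = (s * X + fromℕ N * g s) / (1# + s)

      0<1+s : 0# < 1# + s
      0<1+s = <-by (<⇒≤ 0<s ⊕< 0<1)
          (solve 1 (λ x₀ → (:1 :+ x₀ :- :0) := (x₀ :+ :1 :- (:0 :+ :0))) refl s)

      count : ℕ → ℝ
      count m = ∑ (suc ⌊x⌋) (λ n → χ (𝒩 n × p n ≡ m))

      count*m≤x : ∀ m → count (suc m) * fromℕ (suc m) ≤ x
      count*m≤x m = begin
        count (suc m) * fromℕ (suc m)
          ≡⟨ *-comm (count (suc m)) (fromℕ (suc m)) ⟩
        fromℕ (suc m) * count (suc m)
          ≤⟨ 0≤fromℕ (suc m) ⊗ ∑-mono (suc ⌊x⌋) {λ n → χ (𝒩 n × p n ≡ suc m)} {λ n → χ (0 ℕ.< n × suc m ∣ n)}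
               (λ n _ → χ-mono (λ { ((0<n , _ , pn∣n) , pn≡m) → 0<n , subst (_∣ n) pn≡m pn∣n })) ⟩
        fromℕ (suc m) * ∑ (suc ⌊x⌋) (λ n → χ (0 ℕ.< n × suc m ∣ n))
          ≡⟨ *-comm (fromℕ (suc m)) _ ⟩
        ∑ (suc ⌊x⌋) (λ n → χ (0 ℕ.< n × suc m ∣ n)) * fromℕ (suc m)
          ≤⟨ multiples-bound m ⌊x⌋ ⟩
        fromℕ ⌊x⌋
          ≤⟨ proj₁ (proj₂ T-floor) ⟩
        x ∎
        where open ≤-Reasoning

      count*power≤ : ∀ m → count m * power s m ≤ exp (fromℕ N * g s)
      count*power≤ m = begin
        count m * power s m
          ≡⟨ trans (*-comm (count m) (power s m)) (sym (∑-* (suc ⌊x⌋) (power s m) (λ n → χ (𝒩 n × p n ≡ m)))) ⟩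
        ∑ (suc ⌊x⌋) (λ n → power s m * χ (𝒩 n × p n ≡ m))
          ≤⟨ ∑-mono (suc ⌊x⌋) {λ n → power s m * χ (𝒩 n × p n ≡ m)} {λ n → power s (p n)} (λ n _ →
               subst (_≤ power s (p n)) (*-comm (χ (𝒩 n × p n ≡ m)) (power s m))
                 (χ-elim (𝒩 n × p n ≡ m) (<⇒≤ (exp-positive _)) (λ { (_ , pn≡m) → ≤-reflexive (cong (power s) (sym pn≡m)) }))) ⟩
        ∑ (suc ⌊x⌋) (λ n → power s (p n))
          ≤⟨ ∑-mono-length {f = λ n → power s (p n)} (λ n → <⇒≤ (exp-positive _)) 1+⌊x⌋≤b^N ⟩
        ∑ (b ℕ.^ N) (λ n → power s (p n))
          ≡⟨ ∑-power s N ⟩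
        exp (fromℕ N * g s) ∎
        where open ≤-Reasoning

      -- Interpolates: count ≤ x / m to the power s / (1 + s), times count ≤ m ^ s W ^ N to the power 1 / (1 + s).
      count≤ : ∀ m → count m ≤ exp μ
      count≤ zero = ≤-trans
        (∑-mono (suc ⌊x⌋) {λ n → χ (𝒩 n × p n ≡ 0)} {λ _ → 0#}
          (λ n _ → ≤-reflexive (χ-no (λ { (_ , pn≡0) → ℕₚ.<⇒≢ (0<p₀ b b≥2 n) (sym pn≡0) }))))
        (≤-trans (≤-reflexive (∑-zero (suc ⌊x⌋))) (<⇒≤ (exp-positive μ)))
      -- A logarithm of the count is available only when the count is positive.
      count≤ (suc m) = [ (λ c≤0 → ≤-trans c≤0 (<⇒≤ (exp-positive μ))) , positive ]′ (≤⊎> (count (suc m)) 0#)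
        where
        lm = log (fromℕ (suc m))
        positive : 0# < count (suc m) → count (suc m) ≤ exp μ
        positive 0<c = subst (_≤ exp μ) (exp-log 0<c) (exp-mono-≤ (*-cancelˡ-≤ 0<1+s (begin
          (1# + s) * lc
              ≡⟨ solve 3 (λ x₀ x₁ x₂ → ((:1 :+ x₀) :* x₁) :=
                    (x₀ :* (x₁ :+ x₂) :+ (x₁ :+ (:- x₀) :* x₂))) refl s lc lm ⟩
          -- The weights s and 1 are those for which log m cancels.
          s * (lc + lm) + (lc + - s * lm)  ≤⟨ (<⇒≤ 0<s ⊗ by-multiples) ⊕ by-power ⟩
          s * X + fromℕ N * g s            ≡⟨ y*[x/y]≡x 0<1+s ⟨
          (1# + s) * μ                     ∎)))
          where
          open ≤-Reasoning
          lc = log (count (suc m))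
          by-multiples : lc + lm ≤ X
          by-multiples = subst (_≤ X) (log-* 0<c (0<fromℕ {suc m} (s≤s z≤n)))
            (log-mono-≤ (*-positive 0<c (0<fromℕ {suc m} (s≤s z≤n))) (count*m≤x m))
          by-power : lc + - s * lm ≤ fromℕ N * g s
          by-power = exp-cancel-≤ (subst (_≤ exp (fromℕ N * g s))
            (trans (cong (_* power s (suc m)) (sym (exp-log 0<c))) (sym (exp-+ lc (- s * lm)))) (count*power≤ (suc m)))

      #𝒩≤ : # 𝒩 ≤ exp (fromℕ d * log (fromℕ (suc N)) + μ)
      #𝒩≤ = begin
        # 𝒩
          ≡⟨ #≡∑ 𝒩 (suc ⌊x⌋) 𝒩-bounded ⟩
        ∑ (suc ⌊x⌋) (λ n → χ (𝒩 n))
          ≤⟨ ∑-mono (suc ⌊x⌋) {λ n → χ (𝒩 n)} {λ n → χ (𝒩 n × p n ∈ values d N)}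
               (λ n n<K → χ-mono (λ n∈𝒩 → n∈𝒩 , p₀∈values d b≥2 N (ℕₚ.<-≤-trans n<K 1+⌊x⌋≤b^N))) ⟩
        ∑ (suc ⌊x⌋) (λ n → χ (𝒩 n × p n ∈ values d N))
          ≤⟨ count-by-value (suc ⌊x⌋) 𝒩 p (exp μ) count≤ (values d N) ⟩
        fromℕ (length (values d N)) * exp μ
          ≡⟨ cong (λ l → fromℕ l * exp μ) (length-values d N) ⟩
        fromℕ (suc N ℕ.^ d) * exp μ
          ≡⟨ cong (_* exp μ) (exp-fromℕ*log (suc N) d (s≤s z≤n)) ⟨
        exp (fromℕ d * log (fromℕ (suc N))) * exp μ
          ≡⟨ exp-+ (fromℕ d * log (fromℕ (suc N))) μ ⟨
        exp (fromℕ d * log (fromℕ (suc N)) + μ) ∎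
        where open ≤-Reasoning

    -- error s x * log x exceeds what the bound #𝒩≤ has in its exponent beyond η s * log x.
    error : ℝ → ℝ → ℝ
    error s x = (fromℕ d * log (log x / ℓ + 2#) + g s / (1# + s) + 1#) / log x

    #𝒩< : ∀ {s} → 0# < s → ∀ x → exp 1# ≤ x → # (𝒩₀ b b≥2 x) < x ^ (η s + error s x)
    #𝒩< {s} 0<s x e≤x = ≤-<-trans (#𝒩≤ 0<s x 1≤x) (exp-mono-< (begin-strict
      fromℕ d * log (fromℕ (suc N′)) + μ′                        ≤⟨ 0≤fromℕ d ⊗ log-mono-≤ (0<fromℕ {suc N′} (s≤s z≤n)) N+1≤ ⊕ μ≤ ⟩
      -- The summand 1 in the numerator of `error` makes the inequality strict.
      fromℕ d * log (y + 2#) + (η s * X′ + g s / (1# + s))       <⟨ <-by 0<1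
          (solve 6 (λ x₀ x₁ x₂ x₃ x₄ x₅ → (x₀ :* x₁ :+ (x₂ :* x₃ :+ x₄ :* x₅ :+ :1) :- (x₂ :* x₃ :+ (x₀ :* x₁ :+ x₄ :* x₅))) :=
                (:1 :- :0)) refl (η s) X′ (fromℕ d) (log (y + 2#)) (g s) ((1# + s) ⁻¹)) ⟩
      η s * X′ + (fromℕ d * log (y + 2#) + g s / (1# + s) + 1#)  ≡⟨ cong (η s * X′ +_) (y*[x/y]≡x 0<X) ⟨
      η s * X′ + X′ * error s x
          ≡⟨ solve 3 (λ x₀ x₁ x₂ → (x₀ :* x₁ :+ x₁ :* x₂) :=
                ((x₀ :+ x₂) :* x₁)) refl (η s) X′ (error s x) ⟩
      (η s + error s x) * X′                                     ∎))
      where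
      open ≤-Reasoning
      1≤e : 1# ≤ exp 1#
      1≤e = subst (_≤ exp 1#) exp-0 (exp-mono-≤ 0≤1)
      1≤x : 1# ≤ x
      1≤x = ≤-trans 1≤e e≤x
      X′ y μ′ : ℝ
      X′ = X 0<s x 1≤x
      y = X′ / ℓ
      μ′ = μ 0<s x 1≤x
      N′ : ℕ
      N′ = N 0<s x 1≤x
      -- From x ≥ exp 1 follows log x ≥ 1, so division by log x in `error` is legitimate.
      0<X : 0# < X′
      0<X = <-≤-trans 0<1 (exp-cancel-≤ (subst (exp 1# ≤_) (sym (exp-log (<-≤-trans 0<1 1≤x))) e≤x))
      N+1≤ : fromℕ (suc N′) ≤ y + 2#
      N+1≤ = ≤-by (N≤ 0<s x 1≤x)
          (solve 3 (λ x₀ x₁ x₂ → (x₀ :* x₁ :+ (:1 :+ :1) :- (:1 :+ x₂)) :=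
                (x₀ :* x₁ :+ :1 :- x₂)) refl (X 0<s x 1≤x) (ℓ ⁻¹) (fromℕ (N 0<s x 1≤x)))
      0<1+s′ : 0# < 1# + s
      0<1+s′ = 0<1+s 0<s x 1≤x
      -- Replacing N by X / ℓ + 1 turns the exponent into exactly η X, plus g / (1 + s) for the
      -- extra digit.
      μ≤ : μ′ ≤ η s * X′ + g s / (1# + s)
      μ≤ = *-cancelˡ-≤ 0<1+s′ (begin
        (1# + s) * μ′                                   ≡⟨ y*[x/y]≡x 0<1+s′ ⟩
        s * X′ + fromℕ N′ * g s                         ≤⟨ ≤-by (<⇒≤ (0<log (1<W s)) ⊗ N≤ 0<s x 1≤x)
            (solve 5 (λ x₀ x₁ x₂ x₃ x₄ → (x₀ :* x₁ :+ (x₁ :* x₂ :+ :1) :* x₃ :- (x₀ :* x₁ :+ x₄ :* x₃)) :=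
                  (x₃ :* (x₁ :* x₂ :+ :1) :- x₃ :* x₄)) refl
                  s (X 0<s x 1≤x) (ℓ ⁻¹) (g s) (fromℕ (N 0<s x 1≤x))) ⟩
        s * X′ + (y + 1#) * g s                         ≡⟨ cong (λ z → s * z + (y + 1#) * g s) (y*[x/y]≡x 0<ℓ) ⟨
        s * (ℓ * y) + (y + 1#) * g s
            ≡⟨ solve 4 (λ x₀ x₁ x₂ x₃ → (x₀ :* (x₁ :* x₂) :+ (x₂ :+ :1) :* x₃) :=
                  ((x₀ :* x₁ :+ x₃) :* x₂ :+ x₃)) refl s ℓ y (g s) ⟩
        (s * ℓ + g s) * y + g s                         ≡⟨ cong (λ z → z * y + g s) ([1+s]ℓη≡sℓ+g 0<s) ⟨
        (1# + s) * ℓ * η s * y + g s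
            ≡⟨ solve 5 (λ x₀ x₁ x₂ x₃ x₄ → ((:1 :+ x₀) :* x₁ :* x₂ :* x₃ :+ x₄) :=
                  ((:1 :+ x₀) :* x₂ :* (x₁ :* x₃) :+ x₄)) refl s ℓ (η s) y (g s) ⟩
        (1# + s) * η s * (ℓ * y) + g s                  ≡⟨ cong₂ (λ z w → (1# + s) * η s * z + w) (y*[x/y]≡x 0<ℓ) (sym (y*[x/y]≡x 0<1+s′)) ⟩
        (1# + s) * η s * X′ + (1# + s) * (g s / (1# + s))
            ≡⟨ solve 5 (λ x₀ x₁ x₂ x₃ x₄ → ((:1 :+ x₀) :* x₁ :* x₂ :+ (:1 :+ x₀) :* (x₃ :* x₄)) :=
                  ((:1 :+ x₀) :* (x₁ :* x₂ :+ x₃ :* x₄))) refl s (η s) X′ (g s) ((1# + s) ⁻¹) ⟩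
        (1# + s) * (η s * X′ + g s / (1# + s))          ∎)

    -- Bounds log (y + 2) by a line of slope κ, chosen so that d κ y is half of ε log x. The
    -- constants collected in c₀ stay below the other half once log x ≥ X₀.
    error-tends-to-0 : ∀ {s} → 0# < s → TendsTo0AtInfinity (error s)
    error-tends-to-0 {s} 0<s ε 0<ε = exp X₀ , bound
      where
      q κ c₀ X₀ : ℝ
      q = g s / (1# + s)
      κ = ε * ½ * ℓ / fromℕ d
      c₀ = fromℕ d * (2# * κ - log κ) + q + 1#
      X₀ = 1# + ∣ c₀ / (ε * ½) ∣
      0<d : 0# < fromℕ d
      0<d = 0<fromℕ {d} (s≤s z≤n)
      0<ε½ : 0# < ε * ½
      0<ε½ = *-positive 0<ε 0<½
      0<κ : 0# < κ
      0<κ = *-positive (*-positive 0<ε½ 0<ℓ) (⁻¹-positive 0<d)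
      0<q : 0# < q
      0<q = *-positive (0<log (1<W s)) (⁻¹-positive (<-by {0#} {1# + s} (<⇒≤ 0<s ⊕< 0<1)
          (solve 1 (λ x₀ → (:1 :+ x₀ :- :0) := (x₀ :+ :1 :- (:0 :+ :0))) refl s)))
      bound : ∀ x → exp X₀ ≤ x → ∣ error s x ∣ < ε
      bound x eX₀≤x = ∣x∣< error<ε (≤-<-trans (≤-by 0≤error
          (solve 1 (λ x₀ → (:0 :- (:- x₀)) := (x₀ :- :0)) refl (error s x))) 0<ε)
        where
        X₁ y num : ℝ
        X₁ = log x
        y = X₁ / ℓ
        num = fromℕ d * log (y + 2#) + q + 1#
        0<x′ : 0# < x
        0<x′ = <-≤-trans (exp-positive X₀) eX₀≤x
        X₀≤X₁ : X₀ ≤ X₁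
        X₀≤X₁ = exp-cancel-≤ (subst (exp X₀ ≤_) (sym (exp-log 0<x′)) eX₀≤x)
        0<X₁ : 0# < X₁
        0<X₁ = <-≤-trans (<-by (0≤∣x∣ (c₀ / (ε * ½)) ⊕< 0<1)
            (solve 1 (λ x₀ → (:1 :+ x₀ :- :0) :=
                  (x₀ :+ :1 :- (:0 :+ :0))) refl (∣ c₀ / (ε * ½) ∣))) X₀≤X₁
        1<y+2 : 1# < y + 2#
        1<y+2 = <-by (*-nonNegative (<⇒≤ 0<X₁) (<⇒≤ (⁻¹-positive 0<ℓ)) ⊕< 0<1)
            (solve 2 (λ x₀ x₁ → (x₀ :* x₁ :+ (:1 :+ :1) :- :1) :=
                  (x₀ :* x₁ :+ :1 :- (:0 :+ :0))) refl X₁ (ℓ ⁻¹))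
        0≤num : 0# ≤ num
        0≤num = ≤-by (*-nonNegative (<⇒≤ 0<d) (<⇒≤ (0<log 1<y+2)) ⊕ <⇒≤ 0<q ⊕ 0≤1)
            (solve 3 (λ x₀ x₁ x₂ → (x₀ :* x₁ :+ x₂ :+ :1 :- :0) :=
                  (x₀ :* x₁ :+ x₂ :+ :1 :- (:0 :+ :0 :+ :0))) refl (fromℕ d) (log (y + 2#)) q)
        0≤error : 0# ≤ error s x
        0≤error = *-nonNegative 0≤num (<⇒≤ (⁻¹-positive 0<X₁))
        c₀<ε½X₁ : c₀ < ε * ½ * X₁
        c₀<ε½X₁ = subst (_< ε * ½ * X₁) (y*[x/y]≡x 0<ε½) (0<ε½ ⊗< <-≤-trans
          (≤-<-trans (x≤∣x∣ (c₀ / (ε * ½))) (<-by 0<1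
              (solve 1 (λ x₀ → (:1 :+ x₀ :- x₀) := (:1 :- :0)) refl (∣ c₀ / (ε * ½) ∣)))) X₀≤X₁)
        dκy≡ : fromℕ d * κ * y ≡ ε * ½ * X₁
        dκy≡ = trans (cong (_* y) (y*[x/y]≡x 0<d)) (trans
            (solve 5 (λ x₀ x₁ x₂ x₃ x₄ → (x₀ :* x₁ :* x₂ :* (x₃ :* x₄)) :=
                  (x₀ :* x₁ :* (x₂ :* (x₃ :* x₄)))) refl
                  ε ½ ℓ X₁ (ℓ ⁻¹)) (cong (ε * ½ *_) (y*[x/y]≡x 0<ℓ)))
        num< : num < X₁ * ε
        num< = begin-strict
          fromℕ d * log (y + 2#) + q + 1#                          ≤⟨ ≤-by (<⇒≤ 0<d ⊗ (log-≤-linear 0<κ (<-trans 0<1 1<y+2) ⊕ 0≤1))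
              (solve 6 (λ x₀ x₁ x₂ x₃ x₄ x₅ → (x₀ :* (x₁ :* (x₂ :+ (:1 :+ :1)) :- x₃) :+ x₄ :+ :1 :- (x₀ :* x₅ :+ x₄ :+ :1)) :=
                    (x₀ :* (x₁ :* (x₂ :+ (:1 :+ :1)) :+ :1) :- x₀ :* (:1 :+ (x₃ :+ x₅) :+ :0))) refl
                    (fromℕ d) κ y (log κ) q (log (y + 2#))) ⟩
          fromℕ d * (κ * (y + 2#) - log κ) + q + 1#
              ≡⟨ solve 5 (λ x₀ x₁ x₂ x₃ x₄ → (x₀ :* (x₁ :* (x₂ :+ (:1 :+ :1)) :- x₃) :+ x₄ :+ :1) :=
                    (x₀ :* x₁ :* x₂ :+ (x₀ :* ((:1 :+ :1) :* x₁ :- x₃) :+ x₄ :+ :1))) refl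
                    (fromℕ d) κ y (log κ) q ⟩
          fromℕ d * κ * y + c₀                                     ≡⟨ cong (_+ c₀) dκy≡ ⟩
          ε * ½ * X₁ + c₀                                          <⟨ ≤-refl ⊕< c₀<ε½X₁ ⟩
          ε * ½ * X₁ + ε * ½ * X₁
              ≡⟨ solve 3 (λ x₀ x₁ x₂ → (x₀ :* x₁ :* x₂ :+ x₀ :* x₁ :* x₂) :=
                    (x₂ :* (x₀ :* x₁ :+ x₀ :* x₁))) refl ε ½ X₁ ⟩
          X₁ * (ε * ½ + ε * ½)                                     ≡⟨ cong (X₁ *_) (x*½+x*½≡x ε) ⟩
          X₁ * ε                                                   ∎
          where open ≤-Reasoning
        error<ε : error s x < ε
        error<ε = *-cancelˡ-< 0<X₁ (subst (_< X₁ * ε) (sym (y*[x/y]≡x 0<X₁)) num<)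

-- From the Dirichlet sum to ζ and its derivative.

module ZetaDerivative (em : ExcludedMiddle 0ℓ) (R : Reals) (k : ℕ) where

  open Analysis R
  open OrderedField em R
  open Logarithm em R
  open IntegerCoefficientSolver commutativeRing
  open DigitProducts em R k
  open DirichletSum em R k L 0<L
  open DirichletDerivative em R k L 0<L

  -- The summands of ζ unfold to those of `power`: the first belongs to the digit 1, the others form
  -- `E`.
  ζ≡ : ∀ s → ζ b s ≡ 1# + E s
  ζ≡ s = cong (_+ E s) (power-1 s)

  1+ζ≡W : ∀ s → 1# + ζ b s ≡ W s
  1+ζ≡W s = trans (cong (1# +_) (ζ≡ s))
      (solve 1 (λ x₀ → (:1 :+ (:1 :+ x₀)) := (:1 :+ :1 :+ x₀)) refl (E s))

  deriv-ζ : ∀ s → deriv (ζ b) s ≡ - D s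
  deriv-ζ s = deriv-≡ {ζ b} {s} (HasDerivativeAt-cong {E} {ζ b} (λ y z → trans
      (solve 2 (λ x₀ x₁ → (x₀ :- x₁) :=
            (:1 :+ x₀ :- (:1 :+ x₁))) refl
            (E y) (E z)) (sym (cong₂ _-_ (ζ≡ y) (ζ≡ z)))) (E-derivative s))

open import Data.Nat.Properties using (<⇒≤)

theorem2p1 : ExcludedMiddle 0ℓ → (R : Reals) → let open Analysis R in
    (b : ℕ) (b≥3 : 3 ℕ.≤ b) →
    let IsSolution : ℝ → Set
        IsSolution s = 0# < s ×
          ((1# + s) * deriv (ζ b) s) / (1# + ζ b s)
            - log ((1# + ζ b s) / fromℕ b) ≡ 0#
        η : ℝ → ℝ
        η s = 1# + 1# / ((1# + s) * log (fromℕ b))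
                     * log ((1# + ζ b s) / fromℕ b)
    in ∃! _≡_ IsSolution ×
       (∀ s → IsSolution s →
          0# < η s × η s < 1# ×
          (λ x → # (𝒩₀ b (<⇒≤ b≥3) x)) <x^[ η s +o1])
theorem2p1 em R (suc (suc (suc k))) b≥3@(s≤s (s≤s (s≤s z≤n))) =
  (proj₁ critical-point , solution , λ {s} (0<s , eq) →
    critical-point-unique (proj₁ (proj₂ critical-point)) 0<s (proj₂ (proj₂ critical-point)) (trans (F≡equation s) eq)) ,
  λ s (0<s , _) → subst (0# <_) (η≡ s) (0<η 0<s) , subst (_< 1#) (η≡ s) (η<1 0<s) ,
    error (<⇒≤ b≥3) s , error-tends-to-0 (<⇒≤ b≥3) 0<s ,
    exp 1# , λ x e≤x → subst (λ h → # (𝒩₀ b (<⇒≤ b≥3) x) < x ^ (h + error (<⇒≤ b≥3) s x)) (η≡ s) (#𝒩< (<⇒≤ b≥3) 0<s x e≤x)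
  where
  open Analysis R
  open DigitProducts em R k
  open CriticalPoint em R k L 0<L
  open ZetaDerivative em R k
  -- Abstracts the derivative and 1 + ζ, so that a single congruence carries `F` to the stated
  -- equation.
  equation : ℝ → ℝ → ℝ → ℝ
  equation s dζ w = ((1# + s) * dζ) / w - log (w / fromℕ b)
  F≡equation : ∀ s → F s ≡ equation s (deriv (ζ b) s) (1# + ζ b s)
  F≡equation s = sym (cong₂ (equation s) (deriv-ζ s) (1+ζ≡W s))
  η≡ : ∀ s → η s ≡ 1# + 1# / ((1# + s) * log (fromℕ b)) * log ((1# + ζ b s) / fromℕ b)
  η≡ s = cong (λ w → 1# + 1# / ((1# + s) * log (fromℕ b)) * log (w / fromℕ b)) (sym (1+ζ≡W s))
  solution : 0# < proj₁ critical-point × equation (proj₁ critical-point) (deriv (ζ b) (proj₁ critical-point)) (1# + ζ b (proj₁ critical-point)) ≡ 0#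
  solution = proj₁ (proj₂ critical-point) , trans (sym (F≡equation (proj₁ critical-point))) (proj₂ (proj₂ critical-point))
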